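{- There is an algorithm which, given an integer $n\ge 1$ and the letter lengths $0\le c_1\le c_2\le\cdots\le c_r$ of an alphabet of $r\ge 2$ letters, computes in $O(n\log^2 r)$ time a tree representing an optimal prefix code with $n$ equiprobable codewords, i.e. a prefix-free set of $n$ words over the alphabet whose average length is minimum among all prefix-free sets of $n$ words over the alphabet.
   Context: Words are finite strings over an alphabet of $r$ letters; the $i$th letter has length $c_i$ (a non-negative real number). The length of a word is the sum of the lengths of its letters. A prefix code (prefix-free set) is a set of words none of which is a prefix of another. Each of the $n$ codewords occurs with probability $1/n$, so the average length is $\frac1n$ times the sum of the lengths of the codewords. A prefix code is represented by a finite rooted subtree, containing the root, of the infinite $r$-ary tree (in which the edge from a node to its $i$th child is labeled with the $i$th letter and has length $c_i$), with $n$ of its leaves designated as terminals; the codewords are the words spelled by the labels along the paths from the root to the terminals. Running time counts elementary operations, each arithmetic operation or comparison on numbers taking unit time. The letter lengths are given in sorted order and are available by random access. -}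

module Defs where

open import Level using (Level; _⊔_) renaming (suc to lsuc)
open import Algebra.Bundles using (CommutativeRing)
open import Algebra.Structures using (IsCommutativeRing)
import Algebra.Definitions.RawMonoid as RawMonoidDefs
open import Data.Bool.Base using (Bool; true; false; not; _∧_)
open import Data.Fin.Base using (Fin; toℕ; fromℕ<)
import Data.Fin.Base as Fin
open import Data.List.Base using (List; []; _∷_; _∷ʳ_; foldr; map; length; tabulate)
open import Data.List.Membership.Propositional using (_∈_; _∉_)
open import Data.List.Relation.Binary.Permutation.Propositional using (_↭_)
open import Data.List.Relation.Binary.Prefix.Heterogeneous using (Prefix)
open import Data.List.Relation.Unary.Unique.Propositional using (Unique)
open import Data.Nat.Base as ℕ using (ℕ; zero; suc)
import Data.Nat.DivMod as ℕ
import Data.Nat.Properties as ℕ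
open import Data.Product.Base using (_×_; ∃-syntax)
open import Function.Bundles using (_⇔_)
open import Relation.Binary.Core using (Rel)
open import Relation.Binary.Structures using (IsDecTotalOrder)
open import Relation.Binary.PropositionalEquality using (_≡_; _≢_)
open import Relation.Nullary.Decidable.Core using (does; yes; no)
open import Relation.Nullary.Negation.Core using (¬_)

-- The domain of the letter lengths.  The real numbers enter only through their
-- ordered-field structure; the order is decidable because comparisons are
-- elementary operations of the machine.  The value of 0# ⁻¹ is unspecified.

record OrderedField (a ℓ₁ ℓ₂ : Level) : Set (lsuc (a ⊔ ℓ₁ ⊔ ℓ₂)) where
  infix  4 _≈_ _≤_
  infixl 6 _+_
  infixl 7 _*_
  infix  8 -_ _⁻¹
  field
    Carrier : Set a
    _≈_     : Rel Carrier ℓ₁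
    _≤_     : Rel Carrier ℓ₂
    _+_ _*_ : Carrier → Carrier → Carrier
    -_ _⁻¹  : Carrier → Carrier
    0# 1#   : Carrier
    isCommutativeRing : IsCommutativeRing _≈_ _+_ _*_ -_ 0# 1#
    isDecTotalOrder   : IsDecTotalOrder _≈_ _≤_
    ⁻¹-cong     : ∀ {x y} → x ≈ y → x ⁻¹ ≈ y ⁻¹
    ⁻¹-inverseʳ : ∀ {x} → ¬ x ≈ 0# → x * x ⁻¹ ≈ 1#
    1≉0         : ¬ 1# ≈ 0#
    +-monoˡ-≤   : ∀ {x y} z → x ≤ y → x + z ≤ y + z
    *-nonNeg    : ∀ {x y} → 0# ≤ x → 0# ≤ y → 0# ≤ x * y

  commutativeRing : CommutativeRing a ℓ₁
  commutativeRing = record { isCommutativeRing = isCommutativeRing }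

  open IsDecTotalOrder isDecTotalOrder public using (_≤?_)

  fromℕ : ℕ → Carrier
  fromℕ n = n · 1#
    where open RawMonoidDefs (CommutativeRing.+-rawMonoid commutativeRing) renaming (_×_ to _·_)

------------------------------------------------------------------------
-- Words and prefix codes.  Letters are numbered from 0.

Word : ℕ → Set
Word r = List (Fin r)

PrefixFree : ∀ {r} → List (Word r) → Set
PrefixFree ws = ∀ {u v} → u ∈ ws → v ∈ ws → u ≢ v → ¬ Prefix _≡_ u v

-- A set of n words is given by a duplicate-free list of length n.
record IsPrefixCode {r} (n : ℕ) (ws : List (Word r)) : Set where
  field
    unique     : Unique ws
    size       : length ws ≡ n
    prefixFree : PrefixFree ws

-- A node of the infinite r-ary tree is identified with the word spelled by the
-- path from the root to it; in particular w ∷ʳ i is the child of w along letter i.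
record CodeTree (r n : ℕ) : Set where
  field
    nodes            : List (Word r)
    nodes-unique     : Unique nodes
    root∈nodes       : [] ∈ nodes
    parent∈nodes     : ∀ {w i} → w ∷ʳ i ∈ nodes → w ∈ nodes
    terminals        : List (Word r)
    terminals-unique : Unique terminals
    terminals-size   : length terminals ≡ n
    terminals⊆nodes  : ∀ {w} → w ∈ terminals → w ∈ nodes
    terminals-leaves : ∀ {w i} → w ∈ terminals → w ∷ʳ i ∉ nodes

  codewords : List (Word r)
  codewords = terminals

------------------------------------------------------------------------
-- Programs of a random access machine.  The store consists of arrays of natural
-- numbers and arrays of field elements, both of unbounded size.  The name of an
-- array is a constant of the program text (so a program uses finitely many arrays,
-- which a single memory could interleave); indices are computed.  Programs do not
-- mention the field.  In particular there is no rounding from field elements to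
-- natural numbers.

infixl 7 _⊗_ _⊘_
infixl 6 _⊕_ _⊖_
infix  4 _≤ᴺ_ _≤ᴸ_
infix  3 if_then_else_ while_loop_
infixr 2 _⨾_

data NatExp : Set where
  lit  : ℕ → NatExp
  load : (name : ℕ) (index : NatExp) → NatExp
  _⊕_ _⊖_ _⊗_ _⊘_ : NatExp → NatExp → NatExp

data LenExp : Set where
  load : (name : ℕ) (index : NatExp) → LenExp
  nat  : NatExp → LenExp
  _⊕_ _⊖_ _⊗_ _⊘_ : LenExp → LenExp → LenExp

data Test : Set where
  _≤ᴺ_ : NatExp → NatExp → Test
  _≤ᴸ_ : LenExp → LenExp → Test
  neg  : Test → Test
  and  : Test → Test → Test

data Program : Set where
  skip           : Program
  storeᴺ         : (name : ℕ) (index : NatExp) → NatExp → Program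
  storeᴸ         : (name : ℕ) (index : NatExp) → LenExp → Program
  _⨾_            : Program → Program → Program
  if_then_else_  : Test → Program → Program → Program
  while_loop_    : Test → Program → Program

-- The time to evaluate an expression is the number of operations in it,
-- with constants and memory accesses also counted.

timeᴺ : NatExp → ℕ
timeᴺ (lit _)    = 1
timeᴺ (load _ i) = suc (timeᴺ i)
timeᴺ (d ⊕ e)    = suc (timeᴺ d ℕ.+ timeᴺ e)
timeᴺ (d ⊖ e)    = suc (timeᴺ d ℕ.+ timeᴺ e)
timeᴺ (d ⊗ e)    = suc (timeᴺ d ℕ.+ timeᴺ e)
timeᴺ (d ⊘ e)    = suc (timeᴺ d ℕ.+ timeᴺ e)

timeᴸ : LenExp → ℕ
timeᴸ (load _ i) = suc (timeᴺ i)
timeᴸ (nat e)    = suc (timeᴺ e)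
timeᴸ (d ⊕ e)    = suc (timeᴸ d ℕ.+ timeᴸ e)
timeᴸ (d ⊖ e)    = suc (timeᴸ d ℕ.+ timeᴸ e)
timeᴸ (d ⊗ e)    = suc (timeᴸ d ℕ.+ timeᴸ e)
timeᴸ (d ⊘ e)    = suc (timeᴸ d ℕ.+ timeᴸ e)

timeᵀ : Test → ℕ
timeᵀ (d ≤ᴺ e)  = suc (timeᴺ d ℕ.+ timeᴺ e)
timeᵀ (d ≤ᴸ e)  = suc (timeᴸ d ℕ.+ timeᴸ e)
timeᵀ (neg b)   = suc (timeᵀ b)
timeᵀ (and b c) = suc (timeᵀ b ℕ.+ timeᵀ c)

infixl 7 _div_

_div_ : ℕ → ℕ → ℕ
m div zero    = zero
m div (suc n) = m ℕ./ suc n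

update : ∀ {a} {A : Set a} → (ℕ → ℕ → A) → ℕ → ℕ → A → ℕ → ℕ → A
update f name i x name′ i′ with name′ ℕ.≟ name | i′ ℕ.≟ i
... | yes _ | yes _ = x
... | yes _ | no  _ = f name′ i′
... | no  _ | _     = f name′ i′

module Machine {a ℓ₁ ℓ₂} (F : OrderedField a ℓ₁ ℓ₂) where
  open OrderedField F

  -- The arguments are the name of an array and an index.
  record Store : Set a where
    constructor store
    field
      nats : ℕ → ℕ → ℕ
      lens : ℕ → ℕ → Carrier
  open Store public

  evalᴺ : NatExp → Store → ℕ
  evalᴺ (lit k)    σ = k
  evalᴺ (load x i) σ = nats σ x (evalᴺ i σ)
  evalᴺ (d ⊕ e)    σ = evalᴺ d σ ℕ.+ evalᴺ e σ
  evalᴺ (d ⊖ e)    σ = evalᴺ d σ ℕ.∸ evalᴺ e σ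
  evalᴺ (d ⊗ e)    σ = evalᴺ d σ ℕ.* evalᴺ e σ
  evalᴺ (d ⊘ e)    σ = evalᴺ d σ div evalᴺ e σ

  evalᴸ : LenExp → Store → Carrier
  evalᴸ (load x i) σ = lens σ x (evalᴺ i σ)
  evalᴸ (nat e)    σ = fromℕ (evalᴺ e σ)
  evalᴸ (d ⊕ e)    σ = evalᴸ d σ + evalᴸ e σ
  evalᴸ (d ⊖ e)    σ = evalᴸ d σ + - evalᴸ e σ
  evalᴸ (d ⊗ e)    σ = evalᴸ d σ * evalᴸ e σ
  evalᴸ (d ⊘ e)    σ = evalᴸ d σ * evalᴸ e σ ⁻¹

  evalᵀ : Test → Store → Bool
  evalᵀ (d ≤ᴺ e)  σ = does (evalᴺ d σ ℕ.≤? evalᴺ e σ)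
  evalᵀ (d ≤ᴸ e)  σ = does (evalᴸ d σ ≤? evalᴸ e σ)
  evalᵀ (neg b)   σ = not (evalᵀ b σ)
  evalᵀ (and b c) σ = evalᵀ b σ ∧ evalᵀ c σ

  -- Run P σ t τ: started in σ, the program P halts in τ after t operations.
  data Run : Program → Store → ℕ → Store → Set a where
    skip   : ∀ {σ} → Run skip σ 1 σ
    storeᴺ : ∀ {σ x i e} → Run (storeᴺ x i e) σ (suc (timeᴺ i ℕ.+ timeᴺ e))
               (store (update (nats σ) x (evalᴺ i σ) (evalᴺ e σ)) (lens σ))
    storeᴸ : ∀ {σ x i e} → Run (storeᴸ x i e) σ (suc (timeᴺ i ℕ.+ timeᴸ e))
               (store (nats σ) (update (lens σ) x (evalᴺ i σ) (evalᴸ e σ)))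
    _⨾_    : ∀ {P Q ρ σ τ s t} → Run P ρ s σ → Run Q σ t τ → Run (P ⨾ Q) ρ (s ℕ.+ t) τ
    if-true     : ∀ {b P Q σ τ t} → evalᵀ b σ ≡ true → Run P σ t τ →
                  Run (if b then P else Q) σ (timeᵀ b ℕ.+ t) τ
    if-false    : ∀ {b P Q σ τ t} → evalᵀ b σ ≡ false → Run Q σ t τ →
                  Run (if b then P else Q) σ (timeᵀ b ℕ.+ t) τ
    while-true  : ∀ {b P ρ σ τ s t} → evalᵀ b ρ ≡ true → Run P ρ s σ → Run (while b loop P) σ t τ →
                  Run (while b loop P) ρ (timeᵀ b ℕ.+ (s ℕ.+ t)) τ
    while-false : ∀ {b P σ} → evalᵀ b σ ≡ false → Run (while b loop P) σ (timeᵀ b) σ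

  -- The input is n and r in cells 0 and 1 of array 0 of naturals, and the letter
  -- lengths in cells 0, …, r - 1 of array 0 of field elements.  All else is zero.
  input : (n : ℕ) {r : ℕ} → (Fin r → Carrier) → Store
  input n {r} c = store natCells lenCells
    where
    natCells : ℕ → ℕ → ℕ
    natCells 0 0 = n
    natCells 0 1 = r
    natCells _ _ = 0

    lenCells : ℕ → ℕ → Carrier
    lenCells zero i with i ℕ.<? r
    ... | yes i<r = c (fromℕ< i<r)
    ... | no  _   = 0#
    lenCells (suc _) _ = 0#

  -- The output is read from arrays 1 to 4 of naturals.  Nodes are numbered from 0,
  -- which is the root; every other node stores the number of its parent and the
  -- letter on the edge from its parent.
  module Output (σ : Store) where
    nodeCount : ℕ
    nodeCount = nats σ 1 0

    parent letter flag : Fin nodeCount → ℕ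
    parent v = nats σ 2 (toℕ v)
    letter v = nats σ 3 (toℕ v)
    flag   v = nats σ 4 (toℕ v)

  record Represents {r n} (σ : Store) (T : CodeTree r n) : Set where
    open Output σ
    open CodeTree T using (nodes; terminals)
    field
      word     : Fin nodeCount → Word r
      root     : ∀ v → toℕ v ≡ 0 → word v ≡ []
      edge     : ∀ v → toℕ v ≢ 0 → ∃[ u ] ∃[ i ]
                   parent v ≡ toℕ u × letter v ≡ toℕ i × word v ≡ word u ∷ʳ i
      node     : tabulate word ↭ nodes
      terminal : ∀ v → word v ∈ terminals ⇔ flag v ≡ 1

------------------------------------------------------------------------
-- Optimal codes

module Cost {a ℓ₁ ℓ₂} (F : OrderedField a ℓ₁ ℓ₂) where
  open OrderedField F

  Sorted NonNegative : ∀ {r} → (Fin r → Carrier) → Set ℓ₂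
  Sorted      c = ∀ {i j} → i Fin.≤ j → c i ≤ c j
  NonNegative c = ∀ i → 0# ≤ c i

  Σ[_] : List Carrier → Carrier
  Σ[_] = foldr _+_ 0#

  wordLength : ∀ {r} → (Fin r → Carrier) → Word r → Carrier
  wordLength c w = Σ[ map c w ]

  averageLength : ∀ {r} → (Fin r → Carrier) → ℕ → List (Word r) → Carrier
  averageLength c n ws = fromℕ n ⁻¹ * Σ[ map (wordLength c) ws ]

  record IsOptimalPrefixCode {r} (c : Fin r → Carrier) (n : ℕ) (ws : List (Word r)) : Set ℓ₂ where
    field
      isPrefixCode : IsPrefixCode n ws
      minimal      : ∀ ws′ → IsPrefixCode n ws′ → averageLength c n ws ≤ averageLength c n ws′

{-# OPTIONS --safe #-}

-- Among the code trees with m inner nodes, the best one takes the m shallowest nodes of the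
-- infinite tree as inner nodes and the n shallowest of their remaining children as
-- terminals.  Indeed, let D be the largest depth in the resulting tree, and charge each
-- inner node u the sum over its children v of depth v - D, minus depth u - D.  The cost of
-- a code telescopes into these charges; the charge of u is minimal for the children of
-- depth at most D, and, since u has a child, it does not decrease when u gets deeper.
--
-- The trees for m = 1, 2, … are maintained incrementally: row m brings in the children of
-- the m-th node that beat the deepest selected ones.  Once the second child of a row does
-- not, all further rows have non-negative charge and the search stops.  If row m brings in
-- k children, then so many children of every earlier row are selected as well, whence
-- k m ≤ n + m - 1 and, summing over m, O(n log r) children are brought in altogether.
-- Among the children along one letter the order is that of the parents, so both extracting
-- the shallowest and discarding the deepest node is a tournament among the r letters.

module Submission where

open import Algebra.Bundles using (CommutativeRing)
import Algebra.Properties.AbelianGroup as AbelianGroupProperties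
import Algebra.Properties.CommutativeSemigroup as CommutativeSemigroupProperties
import Algebra.Properties.Monoid.Mult as MonoidMult
import Algebra.Properties.Ring as RingProperties
open import Data.Bool.Base using (Bool; true; false; not; T; _∨_; _∧_)
open import Data.Empty using (⊥; ⊥-elim)
open import Data.Fin.Base using (Fin; zero; suc; toℕ; fromℕ<)
import Data.Fin.Properties as Finₚ
open import Data.List.Base using (List; []; _∷_; _++_; map; length; _∷ʳ_; tabulate)
open import Data.List.Membership.Propositional using (_∈_)
import Data.List.Membership.Propositional.Properties as ∈ₚ
import Data.List.Properties as Listₚ
open import Data.List.Relation.Binary.Permutation.Propositional using (↭-refl)
open import Data.List.Relation.Binary.Prefix.Heterogeneous using (Prefix; []; _∷_)
open import Data.List.Relation.Unary.All as All using (All; []; _∷_)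
import Data.List.Relation.Unary.All.Properties as Allₚ
open import Data.List.Relation.Unary.AllPairs using (AllPairs; []; _∷_)
open import Data.List.Relation.Unary.Any using (here; there)
open import Data.List.Relation.Unary.Unique.Propositional using (Unique)
import Data.List.Relation.Unary.Unique.Propositional.Properties as Uniqueₚ
open import Data.Nat.Base using (ℕ; zero; suc; z≤n; s≤s; z<s; _∸_; _≤_; _<_; _+_; _*_; _⊔_; _^_; _/_; _%_; _≡ᵇ_; _⊓_)
import Data.Nat.DivMod as DivMod
open import Data.Nat.Induction using (<-rec)
open import Data.Nat.Logarithm using (⌊log₂_⌋; ⌊log₂⌋-mono-≤; ⌊log₂[2^n]⌋≡n)
import Data.Nat.Properties as ℕₚ
open import Data.Nat.Tactic.RingSolver using (solve-∀)
open import Data.Product.Base using (_×_; _,_; proj₁; proj₂; ∃-syntax; Σ-syntax)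
open import Data.Sum.Base using (_⊎_; inj₁; inj₂)
open import Data.Unit.Base using (tt)
open import Data.Vec.Base using (Vec; []; _∷_; lookup)
open import Defs
open import Function.Bundles using (mk⇔)
import Level
open import Relation.Binary.Bundles using (Setoid)
open import Relation.Binary.Definitions using (tri<; tri≈; tri>)
open import Relation.Binary.PropositionalEquality using (_≡_; refl; _≢_; cong; subst)
import Relation.Binary.PropositionalEquality as ≡
import Relation.Binary.Reflection as Reflection
open import Relation.Binary.Structures using (IsDecTotalOrder)
open import Relation.Nullary.Decidable using (Dec; yes; no; dec-true; dec-false)
open import Relation.Nullary.Negation.Core using (¬_)

-- Along one letter the selected children belong to an initial segment of the nodes, so a selection
-- is just a count `q j` for each letter; adding or discarding a child changes one count, one key
-- and one path of the tournament. As the time may depend on r only through its logarithm, only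
-- children along R = min (r, n) letters are considered; that the other letters cannot improve
-- anything takes separate arguments. The search keeps no tree, only the best number b of inner
-- nodes and its cost. The tree is then enumerated afresh from the first b nodes, and since equal
-- depths may be resolved differently, its leaves are compared with the recorded selection by total
-- cost alone. In the lower bound a code may have inner nodes outside the m shallowest and may lack
-- some of these; both are compared with one common level that is at least every charge of the
-- selection. Times are counted in units of u operations, u being the binary logarithm of r rounded
-- down: repairing a tournament path takes O(1) units, and the O(n u) exchanges then give the square
-- of the logarithm.

module OrderedFieldLemmas {a ℓ₁ ℓ₂} (F : OrderedField a ℓ₁ ℓ₂) where
  open OrderedField F public using (Carrier; _≈_; 0#; 1#; fromℕ)
    renaming (_+_ to infixl 6 _⊞_; _*_ to infixl 7 _⊠_; -_ to infix 8 ⊟_; _≤_ to infix 4 _≼_; _⁻¹ to infix 8 _⁻¹; _≤?_ to _≼?_)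
  open OrderedField F using (isDecTotalOrder; commutativeRing; +-monoˡ-≤; *-nonNeg; 1≉0; ⁻¹-inverseʳ)
  open IsDecTotalOrder isDecTotalOrder public using () renaming
    (reflexive to ≼-reflexive; refl to ≼-refl; trans to ≼-trans; antisym to ≼-antisym; total to ≼-total)
  open CommutativeRing commutativeRing public using (setoid; +-cong; +-congˡ; +-congʳ; +-identityˡ; +-identityʳ; +-comm; +-assoc; -‿inverseʳ; -‿cong)
  open CommutativeRing commutativeRing using (+-abelianGroup; +-monoid; +-commutativeSemigroup; ring; *-comm; distribˡ; *-identityˡ)
  open Setoid setoid public using () renaming (refl to ≈-refl; sym to ≈-sym; trans to ≈-trans; reflexive to ≈-reflexive)
  open MonoidMult +-monoid using (×-homo-+) renaming (_×_ to infixr 8 _·_)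
  open AbelianGroupProperties +-abelianGroup using (⁻¹-∙-comm; ε⁻¹≈ε; ⁻¹-involutive)
  open CommutativeSemigroupProperties +-commutativeSemigroup using (interchange)
  open RingProperties ring using (-‿distribʳ-*)

  infix 4 _≺_
  _≺_ : Carrier → Carrier → Set ℓ₂
  x ≺ y = ¬ y ≼ x

  ≺⇒≼ : ∀ {x y} → x ≺ y → x ≼ y
  ≺⇒≼ {x} {y} x≺y with ≼-total x y
  ... | inj₁ x≼y = x≼y
  ... | inj₂ y≼x = ⊥-elim (x≺y y≼x)

  ≼-≺-trans : ∀ {x y z} → x ≼ y → y ≺ z → x ≺ z
  ≼-≺-trans x≼y y≺z z≼x = y≺z (≼-trans z≼x x≼y)

  ≺-≼-trans : ∀ {x y z} → x ≺ y → y ≼ z → x ≺ z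
  ≺-≼-trans x≺y y≼z z≼x = x≺y (≼-trans y≼z z≼x)

  ≼-respˡ : ∀ {x y z} → x ≈ y → x ≼ z → y ≼ z
  ≼-respˡ x≈y = ≼-trans (≼-reflexive (≈-sym x≈y))

  ≼-respʳ : ∀ {x y z} → y ≈ z → x ≼ y → x ≼ z
  ≼-respʳ y≈z x≼y = ≼-trans x≼y (≼-reflexive y≈z)

  ⊞-monoˡ : ∀ {x y} z → x ≼ y → x ⊞ z ≼ y ⊞ z
  ⊞-monoˡ = +-monoˡ-≤

  ⊞-monoʳ : ∀ {x y} z → x ≼ y → z ⊞ x ≼ z ⊞ y
  ⊞-monoʳ z x≼y = ≼-respˡ (+-comm _ _) (≼-respʳ (+-comm _ _) (⊞-monoˡ z x≼y))

  ⊞-mono : ∀ {x y z w} → x ≼ y → z ≼ w → x ⊞ z ≼ y ⊞ w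
  ⊞-mono x≼y z≼w = ≼-trans (⊞-monoˡ _ x≼y) (⊞-monoʳ _ z≼w)

  -- Equations in abelian groups: an expression normalises to its vector of
  -- positive and negative multiplicities, of which the common part is dropped.
  module GroupSolver where
    infixl 6 _:+_
    infix  8 :-_
    data Expr (n : ℕ) : Set where
      var  : Fin n → Expr n
      :0   : Expr n
      _:+_ : Expr n → Expr n → Expr n
      :-_  : Expr n → Expr n

    ⟦_⟧ : ∀ {n} → Expr n → Vec Carrier n → Carrier
    ⟦ var i ⟧ ρ = lookup ρ i
    ⟦ :0 ⟧ ρ = 0#
    ⟦ d :+ e ⟧ ρ = ⟦ d ⟧ ρ ⊞ ⟦ e ⟧ ρ
    ⟦ :- e ⟧ ρ = ⊟ ⟦ e ⟧ ρ

    infixl 6 _⊕ᶜ_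
    Coeffs : ℕ → Set
    Coeffs = Vec (ℕ × ℕ)

    zeros : ∀ n → Coeffs n
    zeros zero    = []
    zeros (suc n) = (0 , 0) ∷ zeros n

    unit : ∀ {n} → Fin n → Coeffs n
    unit zero    = (1 , 0) ∷ zeros _
    unit (suc i) = (0 , 0) ∷ unit i

    _⊕ᶜ_ : ∀ {n} → Coeffs n → Coeffs n → Coeffs n
    [] ⊕ᶜ [] = []
    ((p , q) ∷ v) ⊕ᶜ ((p′ , q′) ∷ w) = (p + p′ , q + q′) ∷ (v ⊕ᶜ w)

    flip : ∀ {n} → Coeffs n → Coeffs n
    flip [] = []
    flip ((p , q) ∷ v) = (q , p) ∷ flip v

    coeffs : ∀ {n} → Expr n → Coeffs n
    coeffs (var i)  = unit i
    coeffs :0       = zeros _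
    coeffs (d :+ e) = coeffs d ⊕ᶜ coeffs e
    coeffs (:- e)   = flip (coeffs e)

    eval : ∀ {n} → Coeffs n → Vec Carrier n → Carrier
    eval [] [] = 0#
    eval ((p , q) ∷ v) (x ∷ ρ) = (p · x ⊞ ⊟ (q · x)) ⊞ eval v ρ

    reduce : ∀ {n} → Coeffs n → Coeffs n
    reduce [] = []
    reduce ((p , q) ∷ v) = (p ∸ q , q ∸ p) ∷ reduce v

    eval-zeros : ∀ {n} (ρ : Vec Carrier n) → eval (zeros n) ρ ≈ 0#
    eval-zeros [] = ≈-refl
    eval-zeros (x ∷ ρ) = ≈-trans (+-cong (-‿inverseʳ 0#) (eval-zeros ρ)) (+-identityʳ 0#)

    eval-unit : ∀ {n} (i : Fin n) ρ → eval (unit i) ρ ≈ lookup ρ i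
    eval-unit zero (x ∷ ρ) = ≈-trans (+-cong (≈-trans (+-congˡ ε⁻¹≈ε) (≈-trans (+-identityʳ _) (+-identityʳ x))) (eval-zeros ρ)) (+-identityʳ x)
    eval-unit (suc i) (x ∷ ρ) = ≈-trans (+-cong (-‿inverseʳ 0#) (eval-unit i ρ)) (+-identityˡ _)

    eval-⊕ᶜ : ∀ {n} (v w : Coeffs n) ρ → eval (v ⊕ᶜ w) ρ ≈ eval v ρ ⊞ eval w ρ
    eval-⊕ᶜ [] [] [] = ≈-sym (+-identityʳ 0#)
    eval-⊕ᶜ ((p , q) ∷ v) ((p′ , q′) ∷ w) (x ∷ ρ) = ≈-trans
      (+-cong (≈-trans (+-cong (×-homo-+ x p p′) (≈-trans (-‿cong (×-homo-+ x q q′)) (≈-sym (⁻¹-∙-comm _ _)))) (interchange _ _ _ _)) (eval-⊕ᶜ v w ρ))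
      (interchange _ _ _ _)

    eval-flip : ∀ {n} (v : Coeffs n) ρ → eval (flip v) ρ ≈ ⊟ eval v ρ
    eval-flip [] [] = ≈-sym ε⁻¹≈ε
    eval-flip ((p , q) ∷ v) (x ∷ ρ) = ≈-trans
      (+-cong (≈-trans (+-comm _ _) (≈-trans (+-congˡ (≈-sym (⁻¹-involutive _))) (⁻¹-∙-comm _ _))) (eval-flip v ρ))
      (⁻¹-∙-comm _ _)

    cancel-common : ∀ p q x → (p ∸ q) · x ⊞ ⊟ ((q ∸ p) · x) ≈ p · x ⊞ ⊟ (q · x)
    cancel-common zero zero x = ≈-refl
    cancel-common zero (suc q) x = ≈-refl
    cancel-common (suc p) zero x = ≈-refl
    cancel-common (suc p) (suc q) x = ≈-trans (cancel-common p q x) (≈-sym (≈-trans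
      (≈-trans (+-congˡ (≈-sym (⁻¹-∙-comm _ _))) (interchange _ _ _ _))
      (≈-trans (+-congʳ (-‿inverseʳ x)) (+-identityˡ _))))

    eval-reduce : ∀ {n} (v : Coeffs n) ρ → eval (reduce v) ρ ≈ eval v ρ
    eval-reduce [] [] = ≈-refl
    eval-reduce ((p , q) ∷ v) (x ∷ ρ) = +-cong (cancel-common p q x) (eval-reduce v ρ)

    eval-coeffs : ∀ {n} (e : Expr n) ρ → eval (coeffs e) ρ ≈ ⟦ e ⟧ ρ
    eval-coeffs (var i) ρ = eval-unit i ρ
    eval-coeffs :0 ρ = eval-zeros ρ
    eval-coeffs (d :+ e) ρ = ≈-trans (eval-⊕ᶜ (coeffs d) (coeffs e) ρ) (+-cong (eval-coeffs d ρ) (eval-coeffs e ρ))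
    eval-coeffs (:- e) ρ = ≈-trans (eval-flip (coeffs e) ρ) (-‿cong (eval-coeffs e ρ))

    ⟦_⇓⟧ : ∀ {n} → Expr n → Vec Carrier n → Carrier
    ⟦ e ⇓⟧ = eval (reduce (coeffs e))

    open Reflection setoid var ⟦_⟧ ⟦_⇓⟧ (λ e ρ → ≈-trans (eval-reduce (coeffs e) ρ) (eval-coeffs e ρ)) public
      using (solve; _⊜_)

  open GroupSolver public using (solve; _⊜_; :0; _:+_; :-_)

  -- To prove x ≼ y, exhibit a valid inequality l ≼ u with x - y ≈ l - u.
  ≼-linear : ∀ {x y l u} → l ≼ u → x ⊞ u ≈ y ⊞ l → x ≼ y
  ≼-linear {x} {y} {l} {u} l≼u eq =
    ≼-respˡ (cancel x) (≼-respʳ (cancel y) (⊞-monoˡ (⊟ l) (≼-trans (⊞-monoʳ x l≼u) (≼-reflexive eq))))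
    where
    cancel : ∀ z → z ⊞ l ⊞ ⊟ l ≈ z
    cancel z = solve 2 (λ z l → z :+ l :+ :- l ⊜ z) ≈-refl z l

  ⊞-cancelʳ : ∀ {x y} z → x ⊞ z ≈ y ⊞ z → x ≈ y
  ⊞-cancelʳ {x} {y} z eq = ≈-trans (cancel x) (≈-trans (+-congʳ eq) (≈-sym (cancel y)))
    where
    cancel : ∀ w → w ≈ w ⊞ z ⊞ ⊟ z
    cancel w = solve 2 (λ w z → w ⊜ w :+ z :+ :- z) ≈-refl w z

  ⊟-anti : ∀ {x y} → x ≼ y → ⊟ y ≼ ⊟ x
  ⊟-anti {x} {y} x≼y = ≼-linear x≼y (solve 2 (λ x y → :- y :+ y ⊜ :- x :+ x) ≈-refl x y)

  ⊟-anti⁻¹ : ∀ {x y} → ⊟ x ≼ ⊟ y → y ≼ x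
  ⊟-anti⁻¹ {x} {y} le = ≼-linear le (solve 2 (λ x y → y :+ :- y ⊜ x :+ :- x) ≈-refl x y)

  -- If 1 were at most 0, then -1 would be non-negative, and so would its square, which is 1.
  0≼1 : 0# ≼ 1#
  0≼1 with ≼-total 0# 1#
  ... | inj₁ 0≼1 = 0≼1
  ... | inj₂ 1≼0 = ≼-respʳ (≈-trans (≈-sym (-‿distribʳ-* _ _)) (≈-trans (-‿cong (≈-trans (*-comm _ _) (*-identityˡ _))) (⁻¹-involutive 1#)))
                     (*-nonNeg 0≼-1 0≼-1)
    where
    0≼-1 : 0# ≼ ⊟ 1#
    0≼-1 = ≼-linear 1≼0 (solve 1 (λ u → :0 :+ :0 ⊜ :- u :+ u) ≈-refl 1#)

  0≺1 : 0# ≺ 1#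
  0≺1 1≼0 = 1≉0 (≼-antisym 1≼0 0≼1)

  x≺x+1 : ∀ x → x ≺ x ⊞ 1#
  x≺x+1 x le = 0≺1 (≼-linear le (solve 2 (λ x u → u :+ x ⊜ :0 :+ (x :+ u)) ≈-refl x 1#))

  fromℕ-nonNeg : ∀ n → 0# ≼ fromℕ n
  fromℕ-nonNeg zero = ≼-refl
  fromℕ-nonNeg (suc n) = ≼-respˡ (+-identityʳ 0#) (⊞-mono 0≼1 (fromℕ-nonNeg n))

  fromℕ-positive : ∀ n → 0# ≺ fromℕ (suc n)
  fromℕ-positive n = ≺-≼-trans 0≺1 (≼-respˡ (+-identityʳ 1#) (⊞-monoʳ 1# (fromℕ-nonNeg n)))

  -- If the inverse were at most 0, its negative times x, which is -1, would be a product of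
  -- non-negative factors.
  ⁻¹-nonNeg : ∀ {x} → 0# ≺ x → 0# ≼ x ⁻¹
  ⁻¹-nonNeg {x} 0≺x with ≼-total 0# (x ⁻¹)
  ... | inj₁ 0≼x⁻¹ = 0≼x⁻¹
  ... | inj₂ x⁻¹≼0 = ⊥-elim (0≺1 (⊟-anti⁻¹ (≼-respˡ (≈-sym ε⁻¹≈ε)
          (≼-respʳ (≈-trans (≈-sym (-‿distribʳ-* _ _)) (-‿cong (⁻¹-inverseʳ x≉0)))
            (*-nonNeg (≺⇒≼ 0≺x) (≼-respˡ ε⁻¹≈ε (⊟-anti x⁻¹≼0)))))))
    where
    x≉0 : ¬ x ≈ 0#
    x≉0 x≈0 = 0≺x (≼-reflexive x≈0)

  ⊠-monoʳ : ∀ {x y} z → 0# ≼ z → x ≼ y → z ⊠ x ≼ z ⊠ y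
  ⊠-monoʳ {x} {y} z 0≼z x≼y = ≼-linear
    (≼-respʳ (≈-trans (distribˡ z y (⊟ x)) (+-congˡ (≈-sym (-‿distribʳ-* z x))))
      (*-nonNeg 0≼z (≼-linear x≼y (solve 2 (λ x y → :0 :+ y ⊜ y :+ :- x :+ x) ≈-refl x y))))
    (solve 2 (λ x y → x :+ (y :+ :- x) ⊜ y :+ :0) ≈-refl (z ⊠ x) (z ⊠ y))

-- Finite sums of natural numbers and of field elements.

sumℕ : ℕ → (ℕ → ℕ) → ℕ
sumℕ zero    f = 0
sumℕ (suc n) f = f n + sumℕ n f

sumℕ-cong : ∀ n {f g} → (∀ i → i < n → f i ≡ g i) → sumℕ n f ≡ sumℕ n g
sumℕ-cong zero    eq = refl
sumℕ-cong (suc n) eq = ≡.cong₂ _+_ (eq n ℕₚ.≤-refl) (sumℕ-cong n (λ i i<n → eq i (ℕₚ.m<n⇒m<1+n i<n)))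

sumℕ-mono : ∀ n {f g} → (∀ i → i < n → f i ≤ g i) → sumℕ n f ≤ sumℕ n g
sumℕ-mono zero    le = z≤n
sumℕ-mono (suc n) le = ℕₚ.+-mono-≤ (le n ℕₚ.≤-refl) (sumℕ-mono n (λ i i<n → le i (ℕₚ.m<n⇒m<1+n i<n)))

sumℕ-const : ∀ n k → sumℕ n (λ _ → k) ≡ n * k
sumℕ-const zero    k = refl
sumℕ-const (suc n) k = cong (k +_) (sumℕ-const n k)

sumℕ-+ : ∀ n f g → sumℕ n (λ i → f i + g i) ≡ sumℕ n f + sumℕ n g
sumℕ-+ zero    f g = refl
sumℕ-+ (suc n) f g = ≡.trans (cong (f n + g n +_) (sumℕ-+ n f g)) (interchange (f n) (g n) (sumℕ n f) (sumℕ n g))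
  where open import Algebra.Properties.CommutativeSemigroup ℕₚ.+-commutativeSemigroup using (interchange)

below : ∀ {i n} → i < suc n → i ≢ n → i < n
below i≤n i≢n = ℕₚ.≤∧≢⇒< (ℕₚ.≤-pred i≤n) i≢n

sumℕ-suc : ∀ n {f g} w → w < n → g w ≡ suc (f w) → (∀ i → i < n → i ≢ w → g i ≡ f i) → sumℕ n g ≡ suc (sumℕ n f)
sumℕ-suc (suc n) {f} {g} w w≤n gw rest with n ℕₚ.≟ w
... | yes refl = ≡.cong₂ _+_ gw (sumℕ-cong n (λ i i<n → rest i (ℕₚ.m<n⇒m<1+n i<n) (ℕₚ.<⇒≢ i<n)))
... | no n≢w = ≡.trans (≡.cong₂ _+_ (rest n ℕₚ.≤-refl n≢w) (sumℕ-suc n w (below w≤n (λ e → n≢w (≡.sym e))) gw (λ i i<n → rest i (ℕₚ.m<n⇒m<1+n i<n))))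
                       (ℕₚ.+-suc (f n) (sumℕ n f))

-- Supplies a letter with a child left: `f` will count the children already taken along each letter.
sumℕ-pigeonhole : ∀ n f L → sumℕ n f < n * L → ∃[ j ] j < n × f j < L
sumℕ-pigeonhole (suc n) f L lt with f n ℕₚ.<? L
... | yes fn<L = n , ℕₚ.≤-refl , fn<L
... | no fn≮L with sumℕ-pigeonhole n f L (ℕₚ.+-cancelˡ-< L _ _ (ℕₚ.≤-<-trans (ℕₚ.+-monoˡ-≤ _ (ℕₚ.≮⇒≥ fn≮L)) lt))
...   | j , j<n , fj<L = j , ℕₚ.m<n⇒m<1+n j<n , fj<L

-- Turns the size of a selection into bounds on the length of a row and on the number of rows: the
-- first `j` letters will have all their `m` children selected.
sumℕ-prefix : ∀ n f j m → j ≤ n → (∀ i → i < j → f i ≡ m) → j * m ≤ sumℕ n f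
sumℕ-prefix zero    f .0 m z≤n eq = z≤n
sumℕ-prefix (suc n) f j m j≤n eq with j ℕₚ.≟ suc n
... | yes refl = ℕₚ.+-mono-≤ (ℕₚ.≤-reflexive (≡.sym (eq n ℕₚ.≤-refl))) (sumℕ-prefix n f n m ℕₚ.≤-refl (λ i i<n → eq i (ℕₚ.m<n⇒m<1+n i<n)))
... | no j≢ = ℕₚ.m≤n⇒m≤o+n (f n) (sumℕ-prefix n f j m (ℕₚ.≤-pred (ℕₚ.≤∧≢⇒< j≤n j≢)) eq)

sumℕ-prefix-positive : ∀ k f j m → (∀ i → i < j → f i ≡ m) → (∀ i → i < k + j → 1 ≤ f i) → k + j * m ≤ sumℕ (k + j) f
sumℕ-prefix-positive zero    f j m eq pos = sumℕ-prefix j f j m ℕₚ.≤-refl eq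
sumℕ-prefix-positive (suc k) f j m eq pos =
  ℕₚ.+-mono-≤ (pos (k + j) ℕₚ.≤-refl) (sumℕ-prefix-positive k f j m eq (λ i i< → pos i (ℕₚ.m<n⇒m<1+n i<)))

module Sums {a ℓ₁ ℓ₂} (F : OrderedField a ℓ₁ ℓ₂) where
  open OrderedFieldLemmas F
  open Cost F using (Σ[_])

  when : Bool → Carrier → Carrier
  when true  x = x
  when false x = 0#

  ∑ : ℕ → (ℕ → Carrier) → Carrier
  ∑ zero    f = 0#
  ∑ (suc n) f = f n ⊞ ∑ n f

  ∑-cong : ∀ n {f g} → (∀ i → i < n → f i ≈ g i) → ∑ n f ≈ ∑ n g
  ∑-cong zero    eq = ≈-refl
  ∑-cong (suc n) eq = +-cong (eq n ℕₚ.≤-refl) (∑-cong n (λ i i<n → eq i (ℕₚ.m<n⇒m<1+n i<n)))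

  ∑-mono : ∀ n {f g} → (∀ i → i < n → f i ≼ g i) → ∑ n f ≼ ∑ n g
  ∑-mono zero    le = ≼-refl
  ∑-mono (suc n) le = ⊞-mono (le n ℕₚ.≤-refl) (∑-mono n (λ i i<n → le i (ℕₚ.m<n⇒m<1+n i<n)))

  ∑-zero : ∀ n → ∑ n (λ _ → 0#) ≈ 0#
  ∑-zero zero    = ≈-refl
  ∑-zero (suc n) = ≈-trans (+-identityˡ _) (∑-zero n)

  ∑-⊞ : ∀ n f g → ∑ n (λ i → f i ⊞ g i) ≈ ∑ n f ⊞ ∑ n g
  ∑-⊞ zero    f g = ≈-sym (+-identityʳ 0#)
  ∑-⊞ (suc n) f g = ≈-trans (+-congˡ (∑-⊞ n f g))
    (solve 4 (λ x y z w → x :+ y :+ (z :+ w) ⊜ x :+ z :+ (y :+ w)) ≈-refl (f n) (g n) (∑ n f) (∑ n g))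

  ∑-⊟ : ∀ n f → ∑ n (λ i → ⊟ f i) ≈ ⊟ ∑ n f
  ∑-⊟ zero    f = solve 0 (:0 ⊜ :- :0) ≈-refl
  ∑-⊟ (suc n) f = ≈-trans (+-congˡ (∑-⊟ n f)) (solve 2 (λ x y → :- x :+ :- y ⊜ :- (x :+ y)) ≈-refl (f n) (∑ n f))

  ∑-const-+ : ∀ m n y → ∑ (m + n) (λ _ → y) ≈ ∑ m (λ _ → y) ⊞ ∑ n (λ _ → y)
  ∑-const-+ zero    n y = ≈-sym (+-identityˡ _)
  ∑-const-+ (suc m) n y = ≈-trans (+-congˡ (∑-const-+ m n y)) (≈-sym (+-assoc _ _ _))

  ∑-const-sumℕ : ∀ n q y → ∑ n (λ j → ∑ (q j) (λ _ → y)) ≈ ∑ (sumℕ n q) (λ _ → y)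
  ∑-const-sumℕ zero    q y = ≈-refl
  ∑-const-sumℕ (suc n) q y = ≈-trans (+-congˡ (∑-const-sumℕ n q y)) (≈-sym (∑-const-+ (q n) (sumℕ n q) y))

  ∑-change : ∀ n {f g δ} w → w < n → g w ≈ f w ⊞ δ → (∀ i → i < n → i ≢ w → g i ≈ f i) → ∑ n g ≈ ∑ n f ⊞ δ
  ∑-change (suc n) {f} {g} {δ} w w≤n gw rest with n ℕₚ.≟ w
  ... | yes refl = ≈-trans (+-cong gw (∑-cong n (λ i i<n → rest i (ℕₚ.m<n⇒m<1+n i<n) (ℕₚ.<⇒≢ i<n))))
                     (solve 3 (λ x d s → x :+ d :+ s ⊜ x :+ s :+ d) ≈-refl (f n) δ (∑ n f))
  ... | no n≢w = ≈-trans (+-cong (rest n ℕₚ.≤-refl n≢w) (∑-change n w (below w≤n (λ e → n≢w (≡.sym e))) gw (λ i i<n → rest i (ℕₚ.m<n⇒m<1+n i<n))))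
                   (≈-sym (+-assoc _ _ _))

  ∑-single : ∀ n {g δ} w → w < n → g w ≈ δ → (∀ i → i < n → i ≢ w → g i ≈ 0#) → ∑ n g ≈ δ
  ∑-single n {g} {δ} w w<n gw rest = ≈-trans
    (∑-change n {λ _ → 0#} w w<n (≈-trans gw (≈-sym (+-identityˡ δ))) rest)
    (≈-trans (+-congʳ (∑-zero n)) (+-identityˡ δ))

  ∑-pad : ∀ m n {f g} → m ≤ n → (∀ i → i < m → g i ≈ f i) → (∀ i → m ≤ i → i < n → g i ≈ 0#) → ∑ n g ≈ ∑ m f
  ∑-pad .0 zero z≤n eq out = ≈-refl
  ∑-pad m (suc n) m≤n eq out with m ℕₚ.≟ suc n
  ... | yes refl = ∑-cong (suc n) eq
  ... | no m≢ = ≈-trans (+-cong (out n (ℕₚ.≤-pred (ℕₚ.≤∧≢⇒< m≤n m≢)) ℕₚ.≤-refl)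
                                (∑-pad m n (ℕₚ.≤-pred (ℕₚ.≤∧≢⇒< m≤n m≢)) eq (λ i m≤i i<n → out i m≤i (ℕₚ.m<n⇒m<1+n i<n))))
                        (+-identityˡ _)

  ∑-swap : ∀ m n (f : ℕ → ℕ → Carrier) → ∑ m (λ i → ∑ n (f i)) ≈ ∑ n (λ j → ∑ m (λ i → f i j))
  ∑-swap zero    n f = ≈-sym (∑-zero n)
  ∑-swap (suc m) n f = ≈-trans (+-congˡ (∑-swap m n f)) (≈-sym (∑-⊞ n (f m) _))

  ∑-shift : ∀ n f → ∑ (suc n) f ≈ f 0 ⊞ ∑ n (λ i → f (suc i))
  ∑-shift zero    f = ≈-refl
  ∑-shift (suc n) f = ≈-trans (+-congˡ (∑-shift n f))
    (solve 3 (λ x y z → x :+ (y :+ z) ⊜ y :+ (x :+ z)) ≈-refl (f (suc n)) (f 0) _)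

  ∑-++ : ∀ m n f → ∑ (m + n) f ≈ ∑ m f ⊞ ∑ n (λ i → f (m + i))
  ∑-++ zero    n f = ≈-sym (+-identityˡ _)
  ∑-++ (suc m) n f = ≈-trans (∑-shift (m + n) f) (≈-trans (+-congˡ (∑-++ m n (λ i → f (suc i))))
    (≈-trans (≈-sym (+-assoc _ _ _)) (+-congʳ (≈-sym (∑-shift m f)))))

  ∑ᴸ : ∀ {b} {B : Set b} → (B → Carrier) → List B → Carrier
  ∑ᴸ f xs = Σ[ map f xs ]

  module _ {b} {B : Set b} where
    ∑ᴸ-⊞ : ∀ (f g : B → Carrier) xs → ∑ᴸ (λ x → f x ⊞ g x) xs ≈ ∑ᴸ f xs ⊞ ∑ᴸ g xs
    ∑ᴸ-⊞ f g []       = ≈-sym (+-identityʳ 0#)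
    ∑ᴸ-⊞ f g (x ∷ xs) = ≈-trans (+-congˡ (∑ᴸ-⊞ f g xs))
      (solve 4 (λ x y z w → x :+ y :+ (z :+ w) ⊜ x :+ z :+ (y :+ w)) ≈-refl (f x) (g x) (∑ᴸ f xs) (∑ᴸ g xs))

    ∑ᴸ-const : ∀ y (xs : List B) → ∑ᴸ (λ _ → y) xs ≈ ∑ (length xs) (λ _ → y)
    ∑ᴸ-const y []       = ≈-refl
    ∑ᴸ-const y (x ∷ xs) = +-congˡ (∑ᴸ-const y xs)

    ∑ᴸ-++ : ∀ (f : B → Carrier) xs ys → ∑ᴸ f (xs ++ ys) ≈ ∑ᴸ f xs ⊞ ∑ᴸ f ys
    ∑ᴸ-++ f []       ys = ≈-sym (+-identityˡ _)
    ∑ᴸ-++ f (x ∷ xs) ys = ≈-trans (+-congˡ (∑ᴸ-++ f xs ys)) (≈-sym (+-assoc _ _ _))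

    ∑ᴸ-swap : ∀ n (f : B → ℕ → Carrier) xs → ∑ᴸ (λ x → ∑ n (f x)) xs ≈ ∑ n (λ i → ∑ᴸ (λ x → f x i) xs)
    ∑ᴸ-swap n f []       = ≈-sym (∑-zero n)
    ∑ᴸ-swap n f (x ∷ xs) = ≈-trans (+-congˡ (∑ᴸ-swap n f xs)) (≈-sym (∑-⊞ n (f x) _))

-- Prefix codes decomposed into the inner nodes of their trees.

Incomparable : ∀ {r} → Word r → Word r → Set
Incomparable u v = ¬ Prefix _≡_ u v × ¬ Prefix _≡_ v u

Antichain : ∀ {r} → List (Word r) → Set
Antichain = AllPairs Incomparable

prefixCode⇒antichain : ∀ {r n} {ws : List (Word r)} → IsPrefixCode n ws → Antichain ws
prefixCode⇒antichain code = go _ (IsPrefixCode.unique code) (IsPrefixCode.prefixFree code)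
  where
  go : ∀ ws → Unique ws → PrefixFree ws → Antichain ws
  go [] [] pf = []
  go (w ∷ ws) (w∉ ∷ u) pf =
    All.tabulate (λ {v} v∈ → pf (here refl) (there v∈) (All.lookup w∉ v∈) ,
                             pf (there v∈) (here refl) (λ e → All.lookup w∉ v∈ (≡.sym e)))
    ∷ go ws u (λ x y → pf (there x) (there y))

-- Describes what is left of a code while the letters are split off from the largest to the
-- smallest.
FirstBelow : ∀ {r} → ℕ → Word r → Set
FirstBelow k []      = ⊥
FirstBelow k (i ∷ w) = toℕ i < k

tails others : ∀ {r} → ℕ → List (Word r) → List (Word r)
tails k [] = []
tails k ([] ∷ ws) = tails k ws
tails k ((i ∷ w) ∷ ws) with toℕ i ℕₚ.≟ k
... | yes _ = w ∷ tails k ws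
... | no  _ = tails k ws
others k [] = []
others k ([] ∷ ws) = [] ∷ others k ws
others k ((i ∷ w) ∷ ws) with toℕ i ℕₚ.≟ k
... | yes _ = others k ws
... | no  _ = (i ∷ w) ∷ others k ws

module _ {r : ℕ} (i : Fin r) where
  tails-All : ∀ {p} {P : Word r → Set p} ws → All P ws → All (λ w → P (i ∷ w)) (tails (toℕ i) ws)
  tails-All [] [] = []
  tails-All ([] ∷ ws) (p ∷ ps) = tails-All ws ps
  tails-All ((j ∷ w) ∷ ws) (p ∷ ps) with toℕ j ℕₚ.≟ toℕ i
  ... | yes e rewrite Finₚ.toℕ-injective e = p ∷ tails-All ws ps
  ... | no _ = tails-All ws ps

  others-All : ∀ {p} {P : Word r → Set p} ws → All P ws → All P (others (toℕ i) ws)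
  others-All [] [] = []
  others-All ([] ∷ ws) (p ∷ ps) = p ∷ others-All ws ps
  others-All ((j ∷ w) ∷ ws) (p ∷ ps) with toℕ j ℕₚ.≟ toℕ i
  ... | yes _ = others-All ws ps
  ... | no _ = p ∷ others-All ws ps

  tails-antichain : ∀ ws → Antichain ws → Antichain (tails (toℕ i) ws)
  tails-antichain [] [] = []
  tails-antichain ([] ∷ ws) (p ∷ ps) = tails-antichain ws ps
  tails-antichain ((j ∷ w) ∷ ws) (p ∷ ps) with toℕ j ℕₚ.≟ toℕ i
  ... | yes e rewrite Finₚ.toℕ-injective e =
        All.map (λ (p , q) → (λ x → p (refl ∷ x)) , (λ x → q (refl ∷ x))) (tails-All ws p) ∷ tails-antichain ws ps
  ... | no _ = tails-antichain ws ps

  others-antichain : ∀ ws → Antichain ws → Antichain (others (toℕ i) ws)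
  others-antichain [] [] = []
  others-antichain ([] ∷ ws) (p ∷ ps) = others-All ws p ∷ others-antichain ws ps
  others-antichain ((j ∷ w) ∷ ws) (p ∷ ps) with toℕ j ℕₚ.≟ toℕ i
  ... | yes _ = others-antichain ws ps
  ... | no _ = others-All ws p ∷ others-antichain ws ps

  others-FirstBelow : ∀ (ws : List (Word r)) → All (FirstBelow (suc (toℕ i))) ws → All (FirstBelow (toℕ i)) (others (toℕ i) ws)
  others-FirstBelow [] [] = []
  others-FirstBelow ((j ∷ w) ∷ ws) (p ∷ ps) with toℕ j ℕₚ.≟ toℕ i
  ... | yes _ = others-FirstBelow ws ps
  ... | no j≢k = below p j≢k ∷ others-FirstBelow ws ps

  length-tails+others : ∀ (ws : List (Word r)) → length ws ≡ length (tails (toℕ i) ws) + length (others (toℕ i) ws)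
  length-tails+others [] = refl
  length-tails+others ([] ∷ ws) = ≡.trans (cong suc (length-tails+others ws)) (≡.sym (ℕₚ.+-suc _ _))
  length-tails+others ((j ∷ w) ∷ ws) with toℕ j ℕₚ.≟ toℕ i
  ... | yes _ = cong suc (length-tails+others ws)
  ... | no _ = ≡.trans (cong suc (length-tails+others ws)) (≡.sym (ℕₚ.+-suc _ _))

cons-of-length : ∀ {b} {B : Set b} {xs : List B} {n} → length xs ≡ suc n → ∃[ y ] ∃[ ys ] xs ≡ y ∷ ys
cons-of-length {xs = y ∷ ys} _ = y , ys , refl

maxLength : ∀ {r} → List (Word r) → ℕ
maxLength [] = 0
maxLength (w ∷ ws) = length w ⊔ maxLength ws

maxLength-bound : ∀ {r} (ws : List (Word r)) → All (λ w → length w ≤ maxLength ws) ws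
maxLength-bound [] = []
maxLength-bound (w ∷ ws) = ℕₚ.m≤m⊔n _ _ ∷ All.map (λ le → ℕₚ.≤-trans le (ℕₚ.m≤n⊔m (length w) _)) (maxLength-bound ws)

-- `some-child` rules out inner nodes without children, whose charge would fall as the node gets
-- deeper.
record Row (r : ℕ) : Set where
  constructor row
  field
    node : Word r
    edge : ℕ → Bool
    some-child : ∃[ j ] j < r × edge j ≡ true
open Row public

below-Row : ∀ {r} → Fin r → Row r → Row r
below-Row i (row u J s) = row (i ∷ u) J s

private
  +-shuffle : ∀ t l o l′ → t + o + (l + l′) ≡ t + l + (o + l′)
  +-shuffle = solve-∀

  suc-shuffle : ∀ k l l′ r → suc (l * r) + (k + l′ * r) ≡ suc k + (l + l′) * r
  suc-shuffle = solve-∀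

module Decomposition {a ℓ₁ ℓ₂} (F : OrderedField a ℓ₁ ℓ₂) {r : ℕ}
  (c : Fin r → OrderedField.Carrier F) (ĉ : ℕ → OrderedField.Carrier F) (ĉ-toℕ : ∀ i → ĉ (toℕ i) ≡ c i) where
  open OrderedFieldLemmas F
  open Sums F
  open Cost F using (wordLength)

  depth : Word r → Carrier
  depth = wordLength c

  childSum : ℕ → (ℕ → Bool) → Carrier → Carrier
  childSum k J x = ∑ k (λ j → when (J j) (x ⊞ ĉ j))

  -- For `x` = -D this is the charge of the overview. Keeping `x` variable allows a subtree to be
  -- hung below a letter by adding the length of that letter to `x`.
  rowValue : Carrier → Row r → Carrier
  rowValue x (row u J _) = childSum r J (x ⊞ depth u) ⊞ ⊟ (x ⊞ depth u)

  childSum-cong : ∀ k J {x y} → x ≈ y → childSum k J x ≈ childSum k J y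
  childSum-cong k J x≈y = ∑-cong k λ j _ → aux (J j) j
    where
    aux : ∀ b j → when b (_ ⊞ ĉ j) ≈ when b (_ ⊞ ĉ j)
    aux true  j = +-congʳ x≈y
    aux false j = ≈-refl

  rowValue-below : ∀ x i ρ → rowValue x (below-Row i ρ) ≈ rowValue (x ⊞ c i) ρ
  rowValue-below x i (row u J _) = +-cong (childSum-cong r J eq) (-‿cong eq)
    where eq = ≈-sym (+-assoc x (c i) (depth u))

  ∑ᴸ-below : ∀ x i ρs → ∑ᴸ (rowValue x) (map (below-Row i) ρs) ≈ ∑ᴸ (rowValue (x ⊞ c i)) ρs
  ∑ᴸ-below x i [] = ≈-refl
  ∑ᴸ-below x i (ρ ∷ ρs) = +-cong (rowValue-below x i ρ) (∑ᴸ-below x i ρs)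

  ∑ᴸ-split : ∀ x i ws → ∑ᴸ (λ w → x ⊞ depth w) ws ≈
    ∑ᴸ (λ w → x ⊞ c i ⊞ depth w) (tails (toℕ i) ws) ⊞ ∑ᴸ (λ w → x ⊞ depth w) (others (toℕ i) ws)
  ∑ᴸ-split x i [] = ≈-sym (+-identityʳ 0#)
  ∑ᴸ-split x i ([] ∷ ws) = ≈-trans (+-congˡ (∑ᴸ-split x i ws))
    (solve 3 (λ a b c → a :+ (b :+ c) ⊜ b :+ (a :+ c)) ≈-refl _ _ _)
  ∑ᴸ-split x i ((j ∷ w) ∷ ws) with toℕ j ℕₚ.≟ toℕ i
  ... | yes e rewrite Finₚ.toℕ-injective e = ≈-trans (+-cong (≈-sym (+-assoc _ _ _)) (∑ᴸ-split x i ws)) (≈-sym (+-assoc _ _ _))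
  ... | no _ = ≈-trans (+-congˡ (∑ᴸ-split x i ws))
    (solve 3 (λ a b c → a :+ (b :+ c) ⊜ b :+ (a :+ c)) ≈-refl _ _ _)

  nodes-below : ∀ (i : Fin r) ρs → map node (map (below-Row i) ρs) ≡ map (i ∷_) (map node ρs)
  nodes-below i ρs = ≡.trans (≡.sym (Listₚ.map-∘ ρs)) (Listₚ.map-∘ ρs)

  -- The rows are the inner nodes of the tree spanned by the code, with their outgoing
  -- edges; the sum over the code telescopes along the tree.
  record Decomposed (ws : List (Word r)) : Set (a Level.⊔ ℓ₁) where
    field
      rows   : List (Row r)
      unique : Unique (map node rows)
      size   : length ws + length rows ≤ suc (length rows * r)
      total  : ∀ x → ∑ᴸ (λ w → x ⊞ depth w) ws ≈ x ⊞ ∑ᴸ (rowValue x) rows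

  -- The forest left after deleting the root, restricted to first letters below `k`. The edges `J`
  -- out of the root are kept apart because its row is complete only when `k` reaches `r`. In
  -- `size`, every node of the forest is a child of the root or of a row.
  record Children (k : ℕ) (ws : List (Word r)) : Set (a Level.⊔ ℓ₁) where
    field
      J      : ℕ → Bool
      some-J : ∀ w ws′ → ws ≡ w ∷ ws′ → ∃[ j ] j < k × J j ≡ true
      rows   : List (Row r)
      first  : All (FirstBelow k) (map node rows)
      unique : Unique (map node rows)
      size   : length ws + length rows ≤ k + length rows * r
      total  : ∀ x → ∑ᴸ (λ w → x ⊞ depth w) ws ≈ childSum k J x ⊞ ∑ᴸ (rowValue x) rows

  childSum-extend : ∀ k J J′ b x → J′ k ≡ b → (∀ j → j < k → J′ j ≡ J j) →
    childSum (suc k) J′ x ≈ when b (x ⊞ ĉ k) ⊞ childSum k J x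
  childSum-extend k J J′ b x refl eq = +-congˡ (∑-cong k λ j j<k → ≈-reflexive (cong (λ b → when b (x ⊞ ĉ j)) (eq j j<k)))

  extend : (ℕ → Bool) → ℕ → Bool → ℕ → Bool
  extend J k b j with j ℕₚ.≟ k
  ... | yes _ = b
  ... | no  _ = J j

  extend-at : ∀ J k b → extend J k b k ≡ b
  extend-at J k b with k ℕₚ.≟ k
  ... | yes _ = refl
  ... | no k≢k = ⊥-elim (k≢k refl)

  extend-off : ∀ J k b j → j ≢ k → extend J k b j ≡ J j
  extend-off J k b j j≢k with j ℕₚ.≟ k
  ... | yes e = ⊥-elim (j≢k e)
  ... | no _ = refl

  first-suc : ∀ {k} ws → All (FirstBelow {r} k) ws → All (FirstBelow (suc k)) ws
  first-suc [] [] = []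
  first-suc ((j ∷ w) ∷ ws) (p ∷ ps) = ℕₚ.m<n⇒m<1+n p ∷ first-suc ws ps

  first-below : ∀ i (us : List (Word r)) → All (FirstBelow (suc (toℕ i))) (map (i ∷_) us)
  first-below i [] = []
  first-below i (u ∷ us) = ℕₚ.≤-refl ∷ first-below i us

  decompose-root : ∀ w ws → All (FirstBelow r) (w ∷ ws) → Children r (w ∷ ws) → Decomposed (w ∷ ws)
  decompose-root w ws fb ch = record
    { rows = row [] J (some-J _ _ refl) ∷ rows
    ; unique = fresh rows first ∷ unique
    ; size = ℕₚ.≤-trans (ℕₚ.≤-reflexive (ℕₚ.+-suc (length (w ∷ ws)) (length rows))) (s≤s size)
    ; total = λ x → ≈-trans (total x) (≈-trans (+-congʳ (childSum-cong r J (≈-sym (+-identityʳ x))))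
        (solve 3 (λ s x v → s :+ v ⊜ x :+ (s :+ :- (x :+ :0) :+ v)) ≈-refl _ x _))
    }
    where
    open Children ch

    fresh : ∀ ρs → All (FirstBelow r) (map node ρs) → All (λ v → [] ≢ v) (map node ρs)
    fresh [] [] = []
    fresh (row [] _ _ ∷ ρs) (() ∷ ps)
    fresh (row (j ∷ u) _ _ ∷ ρs) (p ∷ ps) = (λ ()) ∷ fresh ρs ps

  children-skip : ∀ {k} {i : Fin r} → toℕ i ≡ k → ∀ ws → [] ≡ tails k ws → Children k (others k ws) → Children (suc k) ws
  children-skip {i = i} refl ws e ch = record
    { J = J′ ; some-J = λ w ws′ eq → let (j , j<k , Jj) = some-J′ w ws′ eq in j , ℕₚ.m<n⇒m<1+n j<k , ≡.trans (extend-off J k false j (ℕₚ.<⇒≢ j<k)) Jj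
    ; rows = rows ; first = first-suc _ first ; unique = unique
    ; size = ℕₚ.≤-trans (ℕₚ.≤-reflexive (cong (_+ length rows) len)) (ℕₚ.m≤n⇒m≤1+n size)
    ; total = λ x → ≈-trans (∑ᴸ-split x i ws) (≈-trans (+-cong (≈-reflexive (cong (∑ᴸ _) (≡.sym e))) (total x))
        (≈-trans (≈-sym (+-assoc _ _ _)) (+-congʳ (≈-sym (childSum-extend k J J′ false x (extend-at J k false) (λ j j<k → extend-off J k false j (ℕₚ.<⇒≢ j<k)))))))
    }
    where
    open Children ch
    k = toℕ i
    J′ = extend J k false

    len : length ws ≡ length (others k ws)
    len = ≡.trans (length-tails+others i ws) (cong (λ z → length z + length (others k ws)) (≡.sym e))

    some-J′ : ∀ w ws′ → ws ≡ w ∷ ws′ → ∃[ j ] j < k × J j ≡ true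
    some-J′ w ws′ eq = let (v , vs , eq′) = cons-of-length (≡.trans (≡.sym len) (cong length eq)) in some-J v vs eq′

  -- The words that start with letter `k` form a code of their own, whose rows are moved below that
  -- letter. They differ from the rows found before, all of whose first letters are below `k`.
  children-add : ∀ {k} {i : Fin r} → toℕ i ≡ k → ∀ ws {t ts} → t ∷ ts ≡ tails k ws → Decomposed (t ∷ ts) →
    Children k (others k ws) → Children (suc k) ws
  children-add {i = i} refl ws {t} {ts} e sub ch = record
    { J = J′ ; some-J = λ _ _ _ → k , ℕₚ.≤-refl , extend-at J k true
    ; rows = map (below-Row i) T.rows ++ rows
    ; first = subst (All _) (≡.sym nodes-++) (Allₚ.++⁺ (first-below i _) (first-suc _ first))
    ; unique = subst Unique (≡.sym nodes-++) (Uniqueₚ.++⁺ (Uniqueₚ.map⁺ Listₚ.∷-injectiveʳ T.unique) unique disjoint)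
    ; size = size′
    ; total = λ x → ≈-trans (∑ᴸ-split x i ws) (≈-trans (+-cong (≈-trans (≈-reflexive (cong (∑ᴸ _) (≡.sym e))) (T.total (x ⊞ c i))) (total x))
        (≈-trans (solve 4 (λ p q s t → p :+ q :+ (s :+ t) ⊜ p :+ s :+ (q :+ t)) ≈-refl _ _ _ _)
          (+-cong (≈-sym (≈-trans (childSum-extend k J J′ true x (extend-at J k true) (λ j j<k → extend-off J k true j (ℕₚ.<⇒≢ j<k)))
                                  (+-congʳ (+-congˡ (≈-reflexive (ĉ-toℕ i))))))
                  (≈-sym (≈-trans (∑ᴸ-++ (rowValue x) (map (below-Row i) T.rows) rows) (+-congʳ (∑ᴸ-below x i T.rows)))))))
    }
    where
    open Children ch
    module T = Decomposed sub
    k = toℕ i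
    J′ = extend J k true

    nodes-++ : map node (map (below-Row i) T.rows ++ rows) ≡ map (i ∷_) (map node T.rows) ++ map node rows
    nodes-++ = ≡.trans (Listₚ.map-++ node (map (below-Row i) T.rows) rows) (cong (_++ map node rows) (nodes-below i T.rows))

    disjoint : ∀ {v} → ¬ (v ∈ map (i ∷_) (map node T.rows) × v ∈ map node rows)
    disjoint (v∈ , v∈′) with ∈ₚ.∈-map⁻ (i ∷_) v∈
    ... | u , _ , refl = ℕₚ.<-irrefl refl (All.lookup first v∈′)

    len : length ws ≡ length (t ∷ ts) + length (others k ws)
    len = ≡.trans (length-tails+others i ws) (cong (λ z → length z + length (others k ws)) (≡.sym e))

    lenRows : length (map (below-Row i) T.rows ++ rows) ≡ length T.rows + length rows
    lenRows = ≡.trans (Listₚ.length-++ (map (below-Row i) T.rows)) (cong (_+ length rows) (Listₚ.length-map _ T.rows))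

    size′ : length ws + length (map (below-Row i) T.rows ++ rows) ≤ suc k + length (map (below-Row i) T.rows ++ rows) * r
    size′ = subst (λ l → length ws + l ≤ suc k + l * r) (≡.sym lenRows) (ℕₚ.≤-trans
      (ℕₚ.≤-reflexive (≡.trans (cong (_+ (length T.rows + length rows)) len) (+-shuffle (length (t ∷ ts)) (length T.rows) (length (others k ws)) (length rows))))
      (ℕₚ.≤-trans (ℕₚ.+-mono-≤ T.size size) (ℕₚ.≤-reflexive (suc-shuffle k (length T.rows) (length rows) r))))

  others-premises : ∀ {b k} {i : Fin r} → toℕ i ≡ k → ∀ ws → All (FirstBelow (suc k)) ws → All (λ v → length v ≤ suc b) ws → Antichain ws →
    All (FirstBelow k) (others k ws) × All (λ v → length v ≤ suc b) (others k ws) × Antichain (others k ws)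
  others-premises {i = i} refl ws fb bound ac = others-FirstBelow i ws fb , others-All i ws bound , others-antichain i ws ac

  tails-premises : ∀ {b k} {i : Fin r} → toℕ i ≡ k → ∀ ws → All (λ v → length v ≤ suc b) ws → Antichain ws →
    All (λ v → length v ≤ b) (tails k ws) × Antichain (tails k ws)
  tails-premises {i = i} refl ws bound ac = All.map ℕₚ.≤-pred (tails-All i ws bound) , tails-antichain i ws ac

  mutual
    -- Stripping a first letter lowers the bound `b` on the word lengths, and splitting off a letter
    -- lowers `k`, so the two recursions terminate together. The empty word is a prefix of every
    -- other word; a code that contains it is a single leaf.
    decompose : ∀ b w ws → All (λ v → length v ≤ b) (w ∷ ws) → Antichain (w ∷ ws) → Decomposed (w ∷ ws)
    decompose b [] [] bound ac = record
      { rows = [] ; unique = [] ; size = ℕₚ.≤-refl ; total = λ x → +-congʳ (+-identityʳ x) }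
    decompose b [] (v ∷ ws) bound (((¬p , _) ∷ _) ∷ _) = ⊥-elim (¬p [])
    decompose zero (i ∷ w) ws (() ∷ _) ac
    decompose (suc b) (i ∷ w) ws bound ac@(ac-head ∷ _) =
      decompose-root (i ∷ w) ws firsts (children b r ℕₚ.≤-refl ((i ∷ w) ∷ ws) firsts bound ac)
      where
      nonempty : ∀ vs → All (Incomparable (i ∷ w)) vs → All (FirstBelow r) vs
      nonempty [] [] = []
      nonempty ([] ∷ vs) ((_ , ¬p) ∷ ps) = ⊥-elim (¬p [])
      nonempty ((j ∷ v) ∷ vs) (p ∷ ps) = Finₚ.toℕ<n j ∷ nonempty vs ps

      firsts : All (FirstBelow r) ((i ∷ w) ∷ ws)
      firsts = Finₚ.toℕ<n i ∷ nonempty ws ac-head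

    children : ∀ b k → k ≤ r → ∀ ws → All (FirstBelow k) ws → All (λ v → length v ≤ suc b) ws → Antichain ws → Children k ws
    children b zero k≤r [] [] bound ac = record
      { J = λ _ → false ; some-J = λ _ _ () ; rows = [] ; first = [] ; unique = [] ; size = z≤n
      ; total = λ x → ≈-sym (+-identityʳ 0#) }
    children b zero k≤r ([] ∷ ws) (() ∷ _) bound ac
    children b zero k≤r ((j ∷ w) ∷ ws) (() ∷ _) bound ac
    children b (suc k) k<r ws fb bound ac =
      let (fb′ , bound′ , ac′) = others-premises i≡k ws fb bound ac
          (tbound , tac) = tails-premises i≡k ws bound ac
      in by-tails (tails k ws) refl tbound tac (children b k (ℕₚ.<⇒≤ k<r) (others k ws) fb′ bound′ ac′)
      where
      i≡k = Finₚ.toℕ-fromℕ< k<r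

      by-tails : ∀ ts → ts ≡ tails k ws → All (λ v → length v ≤ b) ts → Antichain ts → Children k (others k ws) → Children (suc k) ws
      by-tails []       e bd ac′ rest = children-skip i≡k ws e rest
      by-tails (t ∷ ts) e bd ac′ rest = children-add i≡k ws e (decompose b t ts bd ac′) rest

  code-decomposition : ∀ {n ws} → 1 ≤ n → IsPrefixCode n ws → Decomposed ws
  code-decomposition {ws = []} 1≤n code with () ← subst (1 ≤_) (≡.sym (IsPrefixCode.size code)) 1≤n
  code-decomposition {ws = w ∷ ws} 1≤n code = decompose (maxLength (w ∷ ws)) w ws (maxLength-bound (w ∷ ws)) (prefixCode⇒antichain code)

-- The nodes of the infinite tree in order of depth, encoded by their last letters.

count : (ℕ → ℕ) → ℕ → ℕ → ℕ
count ℓ j zero = 0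
count ℓ j (suc t) with ℓ t ℕₚ.≟ j
... | yes _ = suc (count ℓ j t)
... | no  _ = count ℓ j t

count-hit : ∀ ℓ {j} t → ℓ t ≡ j → count ℓ j (suc t) ≡ suc (count ℓ j t)
count-hit ℓ {j} t eq with ℓ t ℕₚ.≟ j
... | yes _ = refl
... | no ≢j = ⊥-elim (≢j eq)

count-miss : ∀ ℓ {j} t → ℓ t ≢ j → count ℓ j (suc t) ≡ count ℓ j t
count-miss ℓ {j} t neq with ℓ t ℕₚ.≟ j
... | yes eq = ⊥-elim (neq eq)
... | no _ = refl

count-cong : ∀ {ℓ ℓ′} j t → (∀ s → s < t → ℓ′ s ≡ ℓ s) → count ℓ′ j t ≡ count ℓ j t
count-cong j zero eq = refl
count-cong {ℓ} {ℓ′} j (suc t) eq with ℓ t ℕₚ.≟ j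
... | yes e = ≡.trans (count-hit ℓ′ t (≡.trans (eq t ℕₚ.≤-refl) e)) (cong suc (count-cong j t (λ s s<t → eq s (ℕₚ.m<n⇒m<1+n s<t))))
... | no ≢j = ≡.trans (count-miss ℓ′ t (λ e → ≢j (≡.trans (≡.sym (eq t ℕₚ.≤-refl)) e))) (count-cong j t (λ s s<t → eq s (ℕₚ.m<n⇒m<1+n s<t)))

count-suc : ∀ ℓ j t → count ℓ j t ≤ count ℓ j (suc t)
count-suc ℓ j t with ℓ t ℕₚ.≟ j
... | yes _ = ℕₚ.n≤1+n _
... | no _ = ℕₚ.≤-refl

count-mono : ∀ ℓ j {s t} → s ≤ t → count ℓ j s ≤ count ℓ j t
count-mono ℓ j {s} {zero} z≤n = ℕₚ.≤-refl
count-mono ℓ j {s} {suc t} s≤t with s ℕₚ.≟ suc t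
... | yes refl = ℕₚ.≤-refl
... | no s≢ = ℕₚ.≤-trans (count-mono ℓ j (ℕₚ.≤-pred (ℕₚ.≤∧≢⇒< s≤t s≢))) (count-suc ℓ j t)

-- Children along one letter appear in the order of their parents, so the occurrence of `j` that has
-- `i` others before it is the child of node `i`. This recovers the child from the parent.
count-find : ∀ ℓ j t i → i < count ℓ j t → ∃[ s ] s < t × ℓ s ≡ j × count ℓ j s ≡ i
count-find ℓ j (suc t) i i< with ℓ t ℕₚ.≟ j
... | no _ = let (s , s<t , eq) = count-find ℓ j t i i< in s , ℕₚ.m<n⇒m<1+n s<t , eq
... | yes e with i ℕₚ.≟ count ℓ j t
...   | yes refl = t , ℕₚ.≤-refl , e , refl
...   | no i≢ = let (s , s<t , eq) = count-find ℓ j t i (below i< i≢) in s , ℕₚ.m<n⇒m<1+n s<t , eq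

count-strict : ∀ ℓ j {s t} → s < t → ℓ s ≡ j → count ℓ j s < count ℓ j t
count-strict ℓ j {s} s<t e = ℕₚ.≤-trans (ℕₚ.≤-reflexive (≡.sym (count-hit ℓ s e))) (count-mono ℓ j s<t)

count-injective : ∀ ℓ j {s t} → ℓ s ≡ j → ℓ t ≡ j → count ℓ j s ≡ count ℓ j t → s ≡ t
count-injective ℓ j {s} {t} es et eq with ℕₚ.<-cmp s t
... | tri< s<t _ _ = ⊥-elim (ℕₚ.<⇒≢ (count-strict ℓ j s<t es) eq)
... | tri≈ _ s≡t _ = s≡t
... | tri> _ _ t<s = ⊥-elim (ℕₚ.<⇒≢ (count-strict ℓ j t<s et) (≡.sym eq))

count-first : ∀ ℓ j t → ℓ 0 ≢ j → count ℓ j (suc t) ≤ t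
count-first ℓ j zero ≢j = ℕₚ.≤-reflexive (count-miss ℓ 0 ≢j)
count-first ℓ j (suc t) ≢j with ℓ (suc t) ℕₚ.≟ j
... | yes _ = s≤s (count-first ℓ j t ≢j)
... | no _ = ℕₚ.m≤n⇒m≤1+n (count-first ℓ j t ≢j)

-- Position 0 does not contribute to the count. This is what makes parents precede their children.
count-<-self : ∀ ℓ j t → 1 ≤ t → ℓ 0 ≢ j → count ℓ j t < t
count-<-self ℓ j (suc t) _ ≢j = s≤s (count-first ℓ j t ≢j)

-- Each position except the root carries exactly one letter below `R`.
count-total : ∀ ℓ R t → ℓ 0 ≡ R → (∀ s → 1 ≤ s → s < suc t → ℓ s < R) → sumℕ R (λ j → count ℓ j (suc t)) ≡ t
count-total ℓ R zero e lt = ≡.trans (sumℕ-cong R (λ j j<R → count-miss ℓ 0 (λ e′ → ℕₚ.<⇒≢ j<R (≡.trans (≡.sym e′) e)))) (≡.trans (sumℕ-const R 0) (ℕₚ.*-zeroʳ R))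
count-total ℓ R (suc t) e lt = ≡.trans
  (sumℕ-suc R (ℓ (suc t)) (lt (suc t) (s≤s z≤n) ℕₚ.≤-refl) (count-hit ℓ (suc t) refl) (λ j _ j≢ → count-miss ℓ (suc t) (λ e′ → j≢ (≡.sym e′))))
  (cong suc (count-total ℓ R t e (λ s 1≤s s< → lt s 1≤s (ℕₚ.m<n⇒m<1+n s<))))

module Enumeration {a ℓ₁ ℓ₂} (F : OrderedField a ℓ₁ ℓ₂) {r : ℕ} (R : ℕ) (R≤r : R ≤ r) (0<r : 0 < r)
  (c : Fin r → OrderedField.Carrier F) (ĉ : ℕ → OrderedField.Carrier F) (ĉ-toℕ : ∀ i → ĉ (toℕ i) ≡ c i)
  (ĉ-nonNeg : ∀ {j} → j < r → OrderedField._≤_ F (OrderedField.0# F) (ĉ j))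
  (ĉ-sorted : ∀ {i j} → i ≤ j → j < r → OrderedField._≤_ F (ĉ i) (ĉ j)) where
  open OrderedFieldLemmas F
  open Sums F
  open Decomposition F c ĉ ĉ-toℕ

  -- Node s is the child of node count ℓ (ℓ s) s along letter ℓ s, and E s is its depth.
  -- Nodes come in order of depth among the children of nodes below L.
  -- The letter R of the root is a dummy: it keeps the root out of all counts.
  record Good (L t : ℕ) (ℓ : ℕ → ℕ) (E : ℕ → Carrier) : Set (a Level.⊔ ℓ₂) where
    field
      letter-root : ℓ 0 ≡ R
      E-root      : E 0 ≡ 0#
      letter<R    : ∀ s → 1 ≤ s → s < t → ℓ s < R
      row<L       : ∀ s → 1 ≤ s → s < t → count ℓ (ℓ s) s < L
      E-child     : ∀ s → 1 ≤ s → s < t → E s ≡ E (count ℓ (ℓ s) s) ⊞ ĉ (ℓ s)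
      least       : ∀ s → 1 ≤ s → s < t → ∀ j → j < R → count ℓ j s < L → E s ≼ E (count ℓ j s) ⊞ ĉ j

  module GoodLemmas {L t ℓ E} (good : Good L t ℓ E) where
    open Good good

    root≢ : ∀ {j} → j < R → ℓ 0 ≢ j
    root≢ j<R e = ℕₚ.<⇒≢ j<R (≡.trans (≡.sym e) letter-root)

    count<self : ∀ j s → j < R → 1 ≤ s → count ℓ j s < s
    count<self j s j<R 1≤s = count-<-self ℓ j s 1≤s (root≢ j<R)

    parent<self : ∀ s → 1 ≤ s → s < t → count ℓ (ℓ s) s < s
    parent<self s 1≤s s<t = count<self (ℓ s) s (letter<R s 1≤s s<t) 1≤s

    E-nonNeg : ∀ s → s < t → 0# ≼ E s
    E-nonNeg = <-rec _ step
      where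
      step : ∀ s → (∀ {s′} → s′ < s → s′ < t → 0# ≼ E s′) → s < t → 0# ≼ E s
      step zero rec s<t = ≼-reflexive (≈-reflexive (≡.sym E-root))
      step s@(suc _) rec s<t = ≼-respʳ (≈-reflexive (≡.sym (E-child s (s≤s z≤n) s<t)))
        (≼-respˡ (+-identityʳ 0#) (⊞-mono (rec par< (ℕₚ.<-trans par< s<t)) (ĉ-nonNeg (ℕₚ.<-≤-trans (letter<R s (s≤s z≤n) s<t) R≤r))))
        where par< = parent<self s (s≤s z≤n) s<t

    -- If the two nodes carry different letters, the second was already a candidate when the first
    -- was chosen. If they carry the same letter, their parents are consecutive as well, and the
    -- inequality is inherited from them.
    E-suc : ∀ s → suc s < t → E s ≼ E (suc s)
    E-suc = <-rec _ step
      where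
      step : ∀ s → (∀ {s′} → s′ < s → suc s′ < t → E s′ ≼ E (suc s′)) → suc s < t → E s ≼ E (suc s)
      step zero rec s<t = ≼-respˡ (≈-reflexive (≡.sym E-root)) (E-nonNeg 1 s<t)
      step s@(suc _) rec s<t with ℓ s ℕₚ.≟ ℓ (suc s)
      ... | no ≢ℓ = ≼-respʳ (≈-reflexive (≡.trans (cong (λ i → E i ⊞ ĉ (ℓ (suc s))) (≡.sym (count-miss ℓ s ≢ℓ))) (≡.sym (E-child (suc s) (s≤s z≤n) s<t))))
              (least s (s≤s z≤n) (ℕₚ.<⇒≤ s<t) (ℓ (suc s)) (letter<R (suc s) (s≤s z≤n) s<t)
                (subst (_< L) (count-miss ℓ s ≢ℓ) (row<L (suc s) (s≤s z≤n) s<t)))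
      ... | yes ≡ℓ = ≼-respˡ (≈-reflexive (≡.sym (E-child s (s≤s z≤n) (ℕₚ.<⇒≤ s<t))))
              (≼-respʳ (≈-reflexive (≡.sym (E-child (suc s) (s≤s z≤n) s<t)))
                (subst (λ j → E (count ℓ (ℓ s) s) ⊞ ĉ (ℓ s) ≼ E (count ℓ j (suc s)) ⊞ ĉ j) ≡ℓ
                  (subst (λ i → E (count ℓ (ℓ s) s) ⊞ ĉ (ℓ s) ≼ E i ⊞ ĉ (ℓ s)) (≡.sym (count-hit ℓ s refl))
                    (⊞-monoˡ _ (rec par< (ℕₚ.≤-<-trans par< (ℕₚ.<⇒≤ s<t)))))))
        where par< = parent<self s (s≤s z≤n) (ℕₚ.<⇒≤ s<t)

    E-mono : ∀ {s s′} → s ≤ s′ → s′ < t → E s ≼ E s′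
    E-mono {s} {zero} z≤n s′<t = ≼-refl
    E-mono {s} {suc s′} s≤s′ s′<t with s ℕₚ.≟ suc s′
    ... | yes refl = ≼-refl
    ... | no s≢ = ≼-trans (E-mono (ℕₚ.≤-pred (ℕₚ.≤∧≢⇒< s≤s′ s≢)) (ℕₚ.<⇒≤ s′<t)) (E-suc s′ s′<t)

    -- A child that has been counted was enumerated no later than node `s`, and depths do not
    -- decrease.
    popped : ∀ {j i s} → s < t → i < count ℓ j (suc s) → j < R → E i ⊞ ĉ j ≼ E s
    popped {j} {i} {s} s<t i< j<R with count-find ℓ j (suc s) i i<
    ... | zero , _ , e , _ = ⊥-elim (root≢ j<R e)
    ... | s′@(suc _) , s′≤s , refl , refl = ≼-respˡ (≈-reflexive (E-child s′ (s≤s z≤n) (ℕₚ.≤-<-trans (ℕₚ.≤-pred s′≤s) s<t))) (E-mono (ℕₚ.≤-pred s′≤s) s<t)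

    count-sum : ∀ s → suc s ≤ t → sumℕ R (λ j → count ℓ j (suc s)) ≡ s
    count-sum s s≤t = count-total ℓ R s letter-root (λ s′ 1≤s′ s′≤s → letter<R s′ 1≤s′ (ℕₚ.<-≤-trans s′≤s s≤t))

    -- Regroups the enumerated nodes by letter, the form in which their total can be compared with a
    -- selection given by counts.
    E-sum : ∀ s → suc s ≤ t → ∑ R (λ j → ∑ (count ℓ j (suc s)) (λ i → E i ⊞ ĉ j)) ≈ ∑ s (λ i → E (suc i))
    E-sum zero s<t = ≈-trans (∑-cong R (λ j j<R → ≈-reflexive (cong (λ k → ∑ k (λ i → E i ⊞ ĉ j)) (count-miss ℓ 0 (root≢ j<R))))) (∑-zero R)
    E-sum (suc s) s<t = ≈-trans
      (∑-change R w (letter<R (suc s) (s≤s z≤n) s<t)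
        (≈-trans (≈-reflexive (cong (λ k → ∑ k (λ i → E i ⊞ ĉ w)) (count-hit ℓ (suc s) refl)))
          (≈-trans (+-comm _ _) (+-congˡ (≈-reflexive (≡.sym (E-child (suc s) (s≤s z≤n) s<t))))))
        (λ j _ j≢ → ≈-reflexive (cong (λ k → ∑ k (λ i → E i ⊞ ĉ j)) (count-miss ℓ (suc s) (λ e → j≢ (≡.sym e))))))
      (≈-trans (+-comm _ _) (+-congˡ (E-sum s (ℕₚ.<⇒≤ s<t))))
      where w = ℓ (suc s)

    toLetter : ℕ → Fin r
    toLetter j with j ℕₚ.<? r
    ... | yes j<r = fromℕ< j<r
    ... | no _ = fromℕ< 0<r

    toℕ-toLetter : ∀ {j} → j < R → toℕ (toLetter j) ≡ j
    toℕ-toLetter {j} j<R with j ℕₚ.<? r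
    ... | yes j<r = Finₚ.toℕ-fromℕ< j<r
    ... | no j≮r = ⊥-elim (j≮r (ℕₚ.<-≤-trans j<R R≤r))

    -- Fuel replaces the recursion on the parent; `s` steps suffice because parents have smaller
    -- numbers.
    pathFrom : ℕ → ℕ → Word r
    pathFrom zero    s       = []
    pathFrom (suc f) zero    = []
    pathFrom (suc f) (suc s) = pathFrom f (count ℓ (ℓ (suc s)) (suc s)) ∷ʳ toLetter (ℓ (suc s))

    path : ℕ → Word r
    path s = pathFrom s s

    pathFrom-fuel : ∀ f f′ s → s ≤ f → s ≤ f′ → s < t → pathFrom f s ≡ pathFrom f′ s
    pathFrom-fuel zero zero zero _ _ _ = refl
    pathFrom-fuel zero (suc f′) zero _ _ _ = refl
    pathFrom-fuel (suc f) zero zero _ _ _ = refl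
    pathFrom-fuel (suc f) (suc f′) zero _ _ _ = refl
    pathFrom-fuel (suc f) (suc f′) (suc s) (s≤s s≤f) (s≤s s≤f′) s<t = cong (_∷ʳ _)
      (pathFrom-fuel f f′ _ (ℕₚ.≤-trans par≤s s≤f) (ℕₚ.≤-trans par≤s s≤f′) (ℕₚ.≤-<-trans par≤s (ℕₚ.<⇒≤ s<t)))
      where par≤s = ℕₚ.≤-pred (parent<self (suc s) (s≤s z≤n) s<t)

    path-child : ∀ s → 1 ≤ s → s < t → path s ≡ path (count ℓ (ℓ s) s) ∷ʳ toLetter (ℓ s)
    path-child (suc s) 1≤s s<t = cong (_∷ʳ toLetter (ℓ (suc s))) (pathFrom-fuel s _ _ par≤s ℕₚ.≤-refl (ℕₚ.≤-<-trans par≤s (ℕₚ.<⇒≤ s<t)))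
      where par≤s = ℕₚ.≤-pred (parent<self (suc s) (s≤s z≤n) s<t)

    -- Equal words have equal last letters and, by induction, equal parents; the parent is the
    -- number of earlier occurrences of that letter, which determines the position.
    path-injective : ∀ s s′ → s < t → s′ < t → path s ≡ path s′ → s ≡ s′
    path-injective = <-rec _ step
      where
      snoc≢[] : ∀ {w : Word r} {x} → [] ≢ w ∷ʳ x
      snoc≢[] {[]} ()
      snoc≢[] {_ ∷ _} ()
      step : ∀ s → (∀ {s₁} → s₁ < s → ∀ s′ → s₁ < t → s′ < t → path s₁ ≡ path s′ → s₁ ≡ s′) →
             ∀ s′ → s < t → s′ < t → path s ≡ path s′ → s ≡ s′
      step zero rec zero _ _ eq = refl
      step zero rec (suc s′) _ s′<t eq = ⊥-elim (snoc≢[] eq)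
      step (suc s) rec zero s<t _ eq = ⊥-elim (snoc≢[] (≡.sym eq))
      step s@(suc _) rec s′@(suc _) s<t s′<t eq = count-injective ℓ (ℓ s) refl (≡.sym ℓ≡)
          (≡.trans (rec (parent<self s (s≤s z≤n) s<t) _ (ℕₚ.<-trans (parent<self s (s≤s z≤n) s<t) s<t)
                        (ℕₚ.<-trans (parent<self s′ (s≤s z≤n) s′<t) s′<t) (proj₁ split))
                   (cong (λ j → count ℓ j s′) (≡.sym ℓ≡)))
        where
        split = Listₚ.∷ʳ-injective _ _ (≡.trans (≡.sym (path-child s (s≤s z≤n) s<t)) (≡.trans eq (path-child s′ (s≤s z≤n) s′<t)))
        ℓ≡ : ℓ s ≡ ℓ s′
        ℓ≡ = ≡.trans (≡.sym (toℕ-toLetter (letter<R s (s≤s z≤n) s<t))) (≡.trans (cong toℕ (proj₂ split)) (toℕ-toLetter (letter<R s′ (s≤s z≤n) s′<t)))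

    depth-∷ʳ : ∀ w x → depth (w ∷ʳ x) ≈ depth w ⊞ c x
    depth-∷ʳ [] x = +-comm _ _
    depth-∷ʳ (y ∷ w) x = ≈-trans (+-congˡ (depth-∷ʳ w x)) (≈-sym (+-assoc _ _ _))

    depth-path : ∀ s → s < t → depth (path s) ≈ E s
    depth-path = <-rec _ step
      where
      step : ∀ s → (∀ {s′} → s′ < s → s′ < t → depth (path s′) ≈ E s′) → s < t → depth (path s) ≈ E s
      step zero rec s<t = ≈-reflexive (≡.sym E-root)
      step s@(suc _) rec s<t = ≈-trans (≈-reflexive (cong depth (path-child s (s≤s z≤n) s<t)))
        (≈-trans (depth-∷ʳ (path (count ℓ (ℓ s) s)) _)
          (≈-trans (+-cong (rec (parent<self s (s≤s z≤n) s<t) (ℕₚ.<-trans (parent<self s (s≤s z≤n) s<t) s<t))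
                           (≈-reflexive (≡.trans (≡.sym (ĉ-toℕ _)) (cong ĉ (toℕ-toLetter (letter<R s (s≤s z≤n) s<t))))))
                   (≈-reflexive (≡.sym (E-child s (s≤s z≤n) s<t)))))

    depth-nonNeg : ∀ w → 0# ≼ depth w
    depth-nonNeg [] = ≼-refl
    depth-nonNeg (x ∷ w) = ≼-respˡ (+-identityʳ 0#) (⊞-mono (subst (0# ≼_) (ĉ-toℕ x) (ĉ-nonNeg (Finₚ.toℕ<n x))) (depth-nonNeg w))

    -- A letter that is not enumerated is only available when few nodes are needed:
    -- then the root still has a cheaper child.
    module _ (t≤L : t ≤ L) (m : ℕ) (1≤m : 1 ≤ m) (m<t : m < t) (letters : R ≡ r ⊎ m ≤ R) where

      E≼child : ∀ i j → i < m → j < r → count ℓ j m ≤ i ⊎ R ≤ j → E m ≼ E i ⊞ ĉ j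
      E≼child i j i<m j<r past with j ℕₚ.<? R
      E≼child i j i<m j<r (inj₁ ≤i) | yes j<R = ≼-trans
        (least m 1≤m m<t j j<R (ℕₚ.<-≤-trans (count<self j m j<R 1≤m) (ℕₚ.≤-trans (ℕₚ.<⇒≤ m<t) t≤L)))
        (⊞-monoˡ _ (E-mono ≤i (ℕₚ.<-trans i<m m<t)))
      E≼child i j i<m j<r (inj₂ R≤j) | yes j<R = ⊥-elim (ℕₚ.<⇒≱ j<R R≤j)
      E≼child i j i<m j<r past | no j≮R = by-letters letters
        where
        i<t = ℕₚ.<-trans i<m m<t

        by-letters : R ≡ r ⊎ m ≤ R → E m ≼ E i ⊞ ĉ j
        unused : ∀ m → 1 ≤ m → m < t → m ≤ R → E m ≼ E i ⊞ ĉ j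
        unused (suc m′) _ m<t m≤R with sumℕ-pigeonhole R (λ j → count ℓ j (suc m′)) 1
            (subst (_< R * 1) (≡.sym (count-sum m′ (ℕₚ.<⇒≤ m<t))) (ℕₚ.<-≤-trans m≤R (ℕₚ.≤-reflexive (≡.sym (ℕₚ.*-identityʳ R)))))
        ... | j₀ , j₀<R , cnt<1 = ≼-trans
              (least (suc m′) (s≤s z≤n) m<t j₀ j₀<R (ℕₚ.<-≤-trans (count<self j₀ (suc m′) j₀<R (s≤s z≤n)) (ℕₚ.≤-trans (ℕₚ.<⇒≤ m<t) t≤L)))
              (⊞-mono (E-mono (ℕₚ.≤-trans (ℕₚ.≤-pred cnt<1) z≤n) i<t) (ĉ-sorted (ℕₚ.≤-trans (ℕₚ.<⇒≤ j₀<R) (ℕₚ.≮⇒≥ j≮R)) j<r))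

        by-letters (inj₁ R≡r) = ⊥-elim (j≮R (subst (j <_) (≡.sym R≡r) j<r))
        by-letters (inj₂ m≤R) = unused m 1≤m m<t m≤R

      private
        -- Follow `u` from node `i`. Either all nodes on the way are among the first `m`, or the
        -- walk leaves them at a child of depth at least `E m`, and the remaining letters have
        -- non-negative length.
        walk : ∀ u i → i < m → (∃[ i′ ] i′ < m × path i ++ u ≡ path i′) ⊎ E m ≼ E i ⊞ depth u
        walk [] i i<m = inj₁ (i , i<m , Listₚ.++-identityʳ _)
        walk (x ∷ u) i i<m with i ℕₚ.<? count ℓ (toℕ x) m | toℕ x ℕₚ.<? R
        ... | no i≮ | _ = inj₂ (≼-trans (E≼child i (toℕ x) i<m (Finₚ.toℕ<n x) (inj₁ (ℕₚ.≮⇒≥ i≮)))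
                (≼-respʳ (solve 3 (λ e x d → e :+ x :+ d ⊜ e :+ (x :+ d)) ≈-refl _ _ _)
                  (≼-respˡ (≈-trans (+-identityʳ _) (+-congˡ (≈-reflexive (≡.sym (ĉ-toℕ x))))) (⊞-monoʳ (E i ⊞ c x) (depth-nonNeg u)))))
        ... | yes _ | no x≮R = inj₂ (≼-trans (E≼child i (toℕ x) i<m (Finₚ.toℕ<n x) (inj₂ (ℕₚ.≮⇒≥ x≮R)))
                (≼-respʳ (solve 3 (λ e x d → e :+ x :+ d ⊜ e :+ (x :+ d)) ≈-refl _ _ _)
                  (≼-respˡ (≈-trans (+-identityʳ _) (+-congˡ (≈-reflexive (≡.sym (ĉ-toℕ x))))) (⊞-monoʳ (E i ⊞ c x) (depth-nonNeg u)))))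
        ... | yes i< | yes x<R with count-find ℓ (toℕ x) m i i<
        ...   | zero , _ , e , _ = ⊥-elim (root≢ x<R e)
        ...   | s@(suc _) , s<m , ℓs≡x , refl with walk u s s<m
        ...     | inj₁ (i′ , i′<m , eq) = inj₁ (i′ , i′<m , ≡.trans (≡.trans (≡.sym (Listₚ.∷ʳ-++ _ x u)) (cong (_++ u) (≡.sym path≡))) eq)
            where
            path≡ : path s ≡ path (count ℓ (toℕ x) s) ∷ʳ x
            path≡ = ≡.trans (path-child s (s≤s z≤n) (ℕₚ.<-trans s<m m<t))
              (≡.cong₂ (λ j x → path (count ℓ j s) ∷ʳ x) ℓs≡x (Finₚ.toℕ-injective (≡.trans (toℕ-toLetter (subst (_< R) (≡.sym ℓs≡x) x<R)) ℓs≡x)))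
        ...     | inj₂ le = inj₂ (≼-respʳ (≈-trans (+-congʳ (≈-reflexive (≡.trans (E-child s (s≤s z≤n) (ℕₚ.<-trans s<m m<t))
                    (≡.trans (cong (λ j → E (count ℓ j s) ⊞ ĉ j) ℓs≡x) (cong (_ ⊞_) (ĉ-toℕ x)))))) (+-assoc _ _ _)) le)

      -- Here the enumeration, which sees finitely many nodes and only `R` letters, is shown to
      -- yield shallowest nodes of the whole infinite tree.
      inside-or-deep : ∀ u → (∃[ i ] i < m × u ≡ path i) ⊎ E m ≼ depth u
      inside-or-deep u with walk u 0 1≤m
      ... | inj₁ found = inj₁ found
      ... | inj₂ le = inj₂ (≼-respʳ (≈-trans (+-congʳ (≈-reflexive E-root)) (+-identityˡ _)) le)

-- A lower bound for the cost of codes, in terms of the charges of a selection.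

module LowerBound {a ℓ₁ ℓ₂} (F : OrderedField a ℓ₁ ℓ₂) {r : ℕ} (R : ℕ) (R≤r : R ≤ r) (0<r : 0 < r)
  (c : Fin r → OrderedField.Carrier F) (ĉ : ℕ → OrderedField.Carrier F) (ĉ-toℕ : ∀ i → ĉ (toℕ i) ≡ c i)
  (ĉ-nonNeg : ∀ {j} → j < r → OrderedField._≤_ F (OrderedField.0# F) (ĉ j))
  (ĉ-sorted : ∀ {i j} → i ≤ j → j < r → OrderedField._≤_ F (ĉ i) (ĉ j)) where
  open OrderedFieldLemmas F
  open Sums F
  open Decomposition F c ĉ ĉ-toℕ
  open Enumeration F R R≤r 0<r c ĉ ĉ-toℕ ĉ-nonNeg ĉ-sorted

  whenᵈ : ∀ {p} {P : Set p} → Dec P → Carrier → Carrier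
  whenᵈ (yes _) x = x
  whenᵈ (no _)  x = 0#

  whenᵈ-≼0 : ∀ {p} {P : Set p} (d : Dec P) {x} → x ≼ 0# → whenᵈ d x ≼ 0#
  whenᵈ-≼0 (yes _) le = le
  whenᵈ-≼0 (no _)  le = ≼-refl

  ∑-indicator : ∀ n w x → w < n → ∑ n (λ j → whenᵈ (j ℕₚ.≟ w) x) ≈ x
  ∑-indicator n w x w<n = ∑-single n w w<n (at (w ℕₚ.≟ w)) (λ j _ j≢w → off j≢w (j ℕₚ.≟ w))
    where
    at : (d : Dec (w ≡ w)) → whenᵈ d x ≈ x
    at (yes _) = ≈-refl
    at (no ≢) = ⊥-elim (≢ refl)
    off : ∀ {j} → j ≢ w → (d : Dec (j ≡ w)) → whenᵈ d x ≈ 0#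
    off j≢w (yes e) = ⊥-elim (j≢w e)
    off j≢w (no _) = ≈-refl

  -- The base value `β` makes the maximum exist for an empty family too; later it carries a bound
  -- for the rows outside the first `m` nodes.
  least-upper-bound : ∀ m (β : Carrier) (G : ℕ → Carrier) →
    ∃[ Γ ] (∀ i → i < m → G i ≼ Γ) × β ≼ Γ × (∀ {z} → β ≼ z → (∀ i → i < m → G i ≼ z) → Γ ≼ z)
  least-upper-bound zero β G = β , (λ _ ()) , ≼-refl , (λ β≼z _ → β≼z)
  least-upper-bound (suc m) β G with least-upper-bound m β G
  ... | Γ , ub , β≼Γ , lub with ≼-total (G m) Γ
  ...   | inj₁ Gm≼Γ = Γ , (λ i i≤m → upper i (i ℕₚ.≟ m) i≤m) , β≼Γ , (λ β≼z G≼z → lub β≼z (λ i i<m → G≼z i (ℕₚ.m<n⇒m<1+n i<m)))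
    where
    upper : ∀ i → _ → i < suc m → G i ≼ Γ
    upper i (yes refl) _ = Gm≼Γ
    upper i (no i≢m) i≤m = ub i (below i≤m i≢m)
  ...   | inj₂ Γ≼Gm = G m , (λ i i≤m → upper i (i ℕₚ.≟ m) i≤m) , ≼-trans β≼Γ Γ≼Gm , (λ _ G≼z → G≼z m ℕₚ.≤-refl)
    where
    upper : ∀ i → _ → i < suc m → G i ≼ G m
    upper i (yes refl) _ = ≼-refl
    upper i (no i≢m) i≤m = ≼-trans (ub i (below i≤m i≢m)) Γ≼Gm

  _≟ʷ_ : (u v : Word r) → _
  _≟ʷ_ = Listₚ.≡-dec Finₚ._≟_

  -- Distinct rows meet `v` at most once, so the sum is `g` or 0, and `g` is not positive.
  at-most-once : ∀ (ρs : List (Row r)) v {g} → Unique (map node ρs) → g ≼ 0# → g ≼ ∑ᴸ (λ ρ → whenᵈ (node ρ ≟ʷ v) g) ρs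
  at-most-once [] v _ g≼0 = g≼0
  at-most-once (ρ ∷ ρs) v {g} (fresh ∷ uniq) g≼0 with node ρ ≟ʷ v
  ... | no _ = ≼-respʳ (≈-sym (+-identityˡ _)) (at-most-once ρs v uniq g≼0)
  ... | yes refl = ≼-reflexive (≈-sym (≈-trans (+-congˡ (absent ρs fresh)) (+-identityʳ g)))
    where
    absent : ∀ ρs′ → All (λ u → node ρ ≢ u) (map node ρs′) → ∑ᴸ (λ ρ′ → whenᵈ (node ρ′ ≟ʷ node ρ) g) ρs′ ≈ 0#
    absent [] _ = ≈-refl
    absent (ρ′ ∷ ρs′) (≢ρ ∷ ps) with node ρ′ ≟ʷ node ρ
    ... | yes e = ⊥-elim (≢ρ (≡.sym e))
    ... | no _ = ≈-trans (+-identityˡ _) (absent ρs′ ps)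

  ∑ᴸ-mono : ∀ {b} {B : Set b} {f g : B → Carrier} xs → (∀ x → f x ≼ g x) → ∑ᴸ f xs ≼ ∑ᴸ g xs
  ∑ᴸ-mono []       le = ≼-refl
  ∑ᴸ-mono (x ∷ xs) le = ⊞-mono (le x) (∑ᴸ-mono xs le)

  ∑-const-mono : ∀ {m n y} → m ≤ n → 0# ≼ y → ∑ m (λ _ → y) ≼ ∑ n (λ _ → y)
  ∑-const-mono {n = zero} z≤n 0≼y = ≼-refl
  ∑-const-mono {n = suc n} z≤n 0≼y = ≼-respˡ (+-identityʳ 0#) (⊞-mono 0≼y (∑-const-mono {n = n} z≤n 0≼y))
  ∑-const-mono (s≤s m≤n) 0≼y = ⊞-monoʳ _ (∑-const-mono m≤n 0≼y)

  -- The pairs (i , j) with i < q j stand for the selected children; D separates them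
  -- from the others.  With D as price of a leaf, the excess of each inner node over
  -- this selection can be bounded row by row.
  module _ {t : ℕ} {ℓ : ℕ → ℕ} {E : ℕ → Carrier} (good : Good t t ℓ E)
    (m n′ : ℕ) (1≤m : 1 ≤ m) (m<t : m < t) (letters : R ≡ r ⊎ m ≤ R)
    (q : ℕ → ℕ) (D S : Carrier)
    (q≤m : ∀ j → j < R → q j ≤ m)
    (selected : ∀ i j → j < R → i < q j → E i ⊞ ĉ j ≼ D)
    (unselected : ∀ i j → i < m → j < r → R ≤ j ⊎ q j ≤ i → D ≼ E i ⊞ ĉ j)
    (q-sum : sumℕ R q ≡ n′ + m)
    (S-value : S ⊞ ∑ m E ≈ ∑ R (λ j → ∑ (q j) (λ i → E i ⊞ ĉ j))) where
    open GoodLemmas good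

    private
      y : Carrier
      y = ⊟ D

      term : ℕ → ℕ → Carrier
      term i j = whenᵈ (i ℕₚ.<? q j) (y ⊞ E i ⊞ ĉ j)

      -- The charge of node `i` when exactly its selected children are kept.
      G : ℕ → Carrier
      G i = ∑ R (term i) ⊞ ⊟ (y ⊞ E i)

      padded : ℕ → ℕ → Carrier
      padded i j = whenᵈ (j ℕₚ.<? R) (term i j)

      padded-sum : ∀ i → ∑ r (padded i) ≈ ∑ R (term i)
      padded-sum i = ∑-pad R r R≤r inside outside
        where
        inside : ∀ j → j < R → padded i j ≈ term i j
        inside j j<R with j ℕₚ.<? R
        ... | yes _ = ≈-refl
        ... | no j≮R = ⊥-elim (j≮R j<R)
        outside : ∀ j → R ≤ j → j < r → padded i j ≈ 0#
        outside j R≤j _ with j ℕₚ.<? R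
        ... | yes j<R = ⊥-elim (ℕₚ.<⇒≱ j<R R≤j)
        ... | no _ = ≈-refl

      price : ∀ {x} → D ≼ x → 0# ≼ y ⊞ x
      price {x} le = ≼-linear le (solve 2 (λ x d → :0 :+ x ⊜ :- d :+ x :+ d) ≈-refl x D)

      price′ : ∀ {x} → x ≼ D → y ⊞ x ≼ 0#
      price′ {x} le = ≼-linear le (solve 2 (λ x d → :- d :+ x :+ d ⊜ :0 :+ x) ≈-refl x D)

      padded≼ : ∀ i j → i < m → j < r → padded i j ≼ y ⊞ E i ⊞ ĉ j
      padded≼ i j i<m j<r with j ℕₚ.<? R | i ℕₚ.<? q j
      ... | yes _ | yes _ = ≼-refl
      ... | yes _ | no i≮ = ≼-respʳ (≈-sym (+-assoc _ _ _)) (price (unselected i j i<m j<r (inj₂ (ℕₚ.≮⇒≥ i≮))))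
      ... | no j≮R | _ = ≼-respʳ (≈-sym (+-assoc _ _ _)) (price (unselected i j i<m j<r (inj₁ (ℕₚ.≮⇒≥ j≮R))))

      padded≼0 : ∀ i j → padded i j ≼ 0#
      padded≼0 i j with j ℕₚ.<? R | i ℕₚ.<? q j
      ... | yes j<R | yes i< = ≼-respˡ (≈-sym (+-assoc _ _ _)) (price′ (selected i j j<R i<))
      ... | yes _ | no _ = ≼-refl
      ... | no _ | _ = ≼-refl

      -- With the price included, selected children of node `i` count at most 0 and all others at
      -- least 0, so no set of children at depth `E i` does better. Moving the node down by `δ`
      -- lowers the charge by `δ` for the node itself, and the child `j₀` alone makes up for it.
      row-bound : ∀ i (ρ : Row r) → i < m → E i ≼ depth (node ρ) → G i ≼ rowValue y ρ
      row-bound i (row u J (j₀ , j₀<r , Jj₀)) i<m Ei≼x = ≼-linear ∑≼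
          (≈-trans (+-congʳ (+-congʳ (≈-sym (padded-sum i))))
            (solve 5 (λ p y e x s → p :+ :- (y :+ e) :+ s ⊜ s :+ :- (y :+ x) :+ (p :+ (x :+ :- e))) ≈-refl _ y (E i) (depth u) _))
        where
        x = depth u
        δ = x ⊞ ⊟ E i
        0≼δ : 0# ≼ δ
        0≼δ = ≼-linear Ei≼x (solve 2 (λ e x → :0 :+ x ⊜ x :+ :- e :+ e) ≈-refl (E i) x)
        δ-at : ℕ → Carrier
        δ-at j = whenᵈ (j ℕₚ.≟ j₀) δ
        chosen : ∀ j → j < r → padded i j ⊞ δ ≼ y ⊞ x ⊞ ĉ j
        chosen j j<r = ≼-respʳ (solve 4 (λ y e d x → y :+ e :+ d :+ (x :+ :- e) ⊜ y :+ x :+ d) ≈-refl y (E i) (ĉ j) x) (⊞-monoˡ δ (padded≼ i j i<m j<r))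
        pointwise : ∀ j → j < r → padded i j ⊞ δ-at j ≼ when (J j) (y ⊞ x ⊞ ĉ j)
        pointwise j j<r with j ℕₚ.≟ j₀ | J j in Jj
        ... | yes refl | true = chosen j j<r
        ... | yes refl | false with () ← ≡.trans (≡.sym Jj) Jj₀
        pointwise j j<r | no _ | true = ≼-trans (⊞-monoʳ _ 0≼δ) (chosen j j<r)
        pointwise j j<r | no _ | false = ≼-respˡ (≈-sym (+-identityʳ _)) (padded≼0 i j)
        ∑≼ : ∑ r (padded i) ⊞ δ ≼ childSum r J (y ⊞ x)
        ∑≼ = ≼-respˡ (≈-trans (∑-⊞ r (padded i) δ-at) (+-congˡ (∑-indicator r j₀ δ j₀<r))) (∑-mono r pointwise)

      -- One child pays for the node itself, because its edge has non-negative length. The child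
      -- along letter 0 is taken for this whenever it is present, since only its priced depth may be
      -- negative; from letter 1 on, children have depth at least `D`.
      row-nonNeg : ∀ (ρ : Row r) → 1 < r → D ≼ depth (node ρ) ⊞ ĉ 1 → 0# ≼ rowValue y ρ
      row-nonNeg (row u J (j₀ , j₀<r , Jj₀)) 1<r deep = case-J0 (J 0) refl
        where
        x = depth u
        later : ∀ j → 1 ≤ j → j < r → 0# ≼ y ⊞ x ⊞ ĉ j
        later j 1≤j j<r = ≼-respʳ (≈-sym (+-assoc _ _ _)) (price (≼-trans deep (⊞-monoʳ x (ĉ-sorted 1≤j j<r))))
        module _ (j* : ℕ) (j*<r : j* < r) (Jj* : J j* ≡ true) (least-J : ∀ j → J j ≡ true → j ≢ j* → 1 ≤ j) where
          at : ℕ → Carrier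
          at j = whenᵈ (j ℕₚ.≟ j*) (y ⊞ x)
          pointwise : ∀ j → j < r → at j ≼ when (J j) (y ⊞ x ⊞ ĉ j)
          pointwise j j<r with j ℕₚ.≟ j* | J j in Jj
          ... | yes refl | true = ≼-respˡ (+-identityʳ _) (⊞-monoʳ _ (ĉ-nonNeg j<r))
          ... | yes refl | false with () ← ≡.trans (≡.sym Jj) Jj*
          pointwise j j<r | no j≢ | true = later j (least-J j Jj j≢) j<r
          pointwise j j<r | no _ | false = ≼-refl
          nonNeg : 0# ≼ childSum r J (y ⊞ x) ⊞ ⊟ (y ⊞ x)
          nonNeg = ≼-linear (≼-respˡ (∑-indicator r j* (y ⊞ x) j*<r) (∑-mono r pointwise)) (solve 2 (λ s z → :0 :+ s ⊜ s :+ :- z :+ z) ≈-refl _ _)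
        case-J0 : ∀ b → J 0 ≡ b → 0# ≼ childSum r J (y ⊞ x) ⊞ ⊟ (y ⊞ x)
        case-J0 true eq = nonNeg 0 (ℕₚ.<-trans z<s 1<r) eq (λ j _ j≢0 → ℕₚ.n≢0⇒n>0 j≢0)
        case-J0 false eq = nonNeg j₀ j₀<r Jj₀ positive
          where
          positive : ∀ j → J j ≡ true → j ≢ j₀ → 1 ≤ j
          positive zero J0 _ with () ← ≡.trans (≡.sym J0) eq
          positive (suc j) _ _ = s≤s z≤n

      -- The `n′ + m` selected edges and the `m` nodes themselves leave `n′` prices over, and the
      -- depths telescope to the cost `S`.
      G-sum : ∑ m G ≈ S ⊞ ∑ n′ (λ _ → y)
      G-sum = ⊞-cancelʳ (∑ m E) (≈-trans (+-congʳ step₁) (≈-trans step₂ step₃))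
        where
        Y = λ k → ∑ k (λ _ → y)
        keys = ∑ R (λ j → ∑ (q j) (λ i → E i ⊞ ĉ j))
        column : ∀ j → j < R → ∑ m (λ i → term i j) ≈ Y (q j) ⊞ ∑ (q j) (λ i → E i ⊞ ĉ j)
        column j j<R = ≈-trans (∑-pad (q j) m {f = λ i → y ⊞ (E i ⊞ ĉ j)} (q≤m j j<R) inside outside) (∑-⊞ (q j) (λ _ → y) (λ i → E i ⊞ ĉ j))
          where
          inside : ∀ i → i < q j → term i j ≈ y ⊞ (E i ⊞ ĉ j)
          inside i i< with i ℕₚ.<? q j
          ... | yes _ = +-assoc _ _ _
          ... | no i≮ = ⊥-elim (i≮ i<)
          outside : ∀ i → q j ≤ i → i < m → term i j ≈ 0#
          outside i ≤i _ with i ℕₚ.<? q j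
          ... | yes i< = ⊥-elim (ℕₚ.<⇒≱ i< ≤i)
          ... | no _ = ≈-refl
        terms : ∑ m (λ i → ∑ R (term i)) ≈ (Y n′ ⊞ Y m) ⊞ keys
        terms = ≈-trans (∑-swap m R term) (≈-trans (∑-cong R column) (≈-trans (∑-⊞ R (λ j → Y (q j)) _)
          (+-congʳ (≈-trans (∑-const-sumℕ R q y) (≈-trans (≈-reflexive (cong Y q-sum)) (∑-const-+ n′ m y))))))
        step₁ : ∑ m G ≈ (Y n′ ⊞ Y m) ⊞ keys ⊞ ⊟ (Y m ⊞ ∑ m E)
        step₁ = ≈-trans (∑-⊞ m (λ i → ∑ R (term i)) _) (+-cong terms (≈-trans (∑-⊟ m (λ i → y ⊞ E i)) (-‿cong (∑-⊞ m (λ _ → y) E))))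
        step₂ : (Y n′ ⊞ Y m) ⊞ keys ⊞ ⊟ (Y m ⊞ ∑ m E) ⊞ ∑ m E ≈ Y n′ ⊞ keys
        step₂ = solve 4 (λ a b k e → a :+ b :+ k :+ :- (b :+ e) :+ e ⊜ a :+ k) ≈-refl _ _ _ _
        step₃ : Y n′ ⊞ keys ≈ S ⊞ Y n′ ⊞ ∑ m E
        step₃ = ≈-trans (+-congˡ (≈-sym S-value)) (solve 3 (λ a s e → a :+ (s :+ e) ⊜ s :+ a :+ e) ≈-refl _ _ _)

      module _ (β : Carrier) (ρs : List (Row r)) (unique : Unique (map node ρs))
        (deep-β : ∀ ρ → E m ≼ depth (node ρ) → β ≼ rowValue y ρ)
        (enough : length ρs ≡ m ⊎ (m ≤ length ρs × 0# ≼ β)) where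

        Γ-data = least-upper-bound m β G
        Γ = proj₁ Γ-data
        G≼Γ = proj₁ (proj₂ Γ-data)
        g : ℕ → Carrier
        g i = G i ⊞ ⊟ Γ

        g≼0 : ∀ i → i < m → g i ≼ 0#
        g≼0 i i<m = ≼-linear (G≼Γ i i<m) (solve 2 (λ g γ → g :+ :- γ :+ γ ⊜ :0 :+ g) ≈-refl (G i) Γ)

        -- A row at one of the first `m` nodes is compared with the charge of that node; every other
        -- row is deep and worth at least `Γ`. As no `g i` is positive, nodes absent from the code
        -- can only help the bound.
        row-excess : ∀ ρ → ∑ m (λ i → whenᵈ (node ρ ≟ʷ path i) (g i)) ≼ rowValue y ρ ⊞ ⊟ Γ
        row-excess ρ with inside-or-deep ℕₚ.≤-refl m 1≤m m<t letters (node ρ)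
        ... | inj₂ deep = ≼-trans (≼-respʳ (∑-zero m) (∑-mono m (λ i i<m → whenᵈ-≼0 (node ρ ≟ʷ path i) (g≼0 i i<m))))
              (≼-linear (proj₂ (proj₂ (proj₂ Γ-data)) (deep-β ρ deep) (λ i i<m → row-bound i ρ i<m (≼-trans (E-mono (ℕₚ.<⇒≤ i<m) m<t) deep)))
                (solve 2 (λ v γ → :0 :+ v ⊜ v :+ :- γ :+ γ) ≈-refl _ Γ))
        ... | inj₁ (i₀ , i₀<m , u≡) = ≼-trans (∑-mono m pointwise)
              (≼-respˡ (≈-sym (∑-indicator m i₀ (g i₀) i₀<m)) (⊞-monoˡ _ (row-bound i₀ ρ i₀<m (≼-reflexive (≈-sym (≈-trans (≈-reflexive (cong depth u≡)) (depth-path i₀ (ℕₚ.<-trans i₀<m m<t))))))))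
          where
          only : ℕ → Carrier
          only i = whenᵈ (i ℕₚ.≟ i₀) (g i₀)
          pointwise : ∀ i → i < m → whenᵈ (node ρ ≟ʷ path i) (g i) ≼ only i
          pointwise i i<m with i ℕₚ.≟ i₀
          ... | no _ = whenᵈ-≼0 (node ρ ≟ʷ path i) (g≼0 i i<m)
          ... | yes refl with node ρ ≟ʷ path i
          ...   | yes _ = ≼-refl
          ...   | no ≢ = ⊥-elim (≢ u≡)

        rows-bound : ∑ m G ≼ ∑ᴸ (rowValue y) ρs
        rows-bound = ≼-linear (⊞-mono excess Γ-count)
          (≈-trans (+-congˡ (+-cong split-L ≈-refl)) (≈-trans
            (solve 5 (λ G V NΓ mΓ x → G :+ (V :+ :- NΓ :+ NΓ) ⊜ V :+ (G :+ :- mΓ :+ mΓ)) ≈-refl (∑ m G) (∑ᴸ (rowValue y) ρs) NΓ mΓ 0#)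
            (+-congˡ (+-cong (≈-sym split-G) ≈-refl))))
          where
          NΓ = ∑ (length ρs) (λ _ → Γ)
          mΓ = ∑ m (λ _ → Γ)
          N⊟ : ∑ᴸ (λ _ → ⊟ Γ) ρs ≈ ⊟ NΓ
          N⊟ = ≈-trans (∑ᴸ-const (⊟ Γ) ρs) (∑-⊟ (length ρs) (λ _ → Γ))
          split-L : ∑ᴸ (λ ρ → rowValue y ρ ⊞ ⊟ Γ) ρs ≈ ∑ᴸ (rowValue y) ρs ⊞ ⊟ NΓ
          split-L = ≈-trans (∑ᴸ-⊞ (rowValue y) (λ _ → ⊟ Γ) ρs) (+-congˡ N⊟)
          split-G : ∑ m g ≈ ∑ m G ⊞ ⊟ mΓ
          split-G = ≈-trans (∑-⊞ m G (λ _ → ⊟ Γ)) (+-congˡ (∑-⊟ m (λ _ → Γ)))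
          excess : ∑ m g ≼ ∑ᴸ (λ ρ → rowValue y ρ ⊞ ⊟ Γ) ρs
          excess = ≼-trans (∑-mono m (λ i i<m → at-most-once ρs (path i) unique (g≼0 i i<m)))
            (≼-respˡ (∑ᴸ-swap m (λ ρ i → whenᵈ (node ρ ≟ʷ path i) (g i)) ρs) (∑ᴸ-mono ρs row-excess))
          count≼ : length ρs ≡ m ⊎ (m ≤ length ρs × 0# ≼ β) → mΓ ≼ NΓ
          count≼ (inj₁ e) = ≼-reflexive (≈-reflexive (cong (λ k → ∑ k (λ _ → Γ)) (≡.sym e)))
          -- Surplus rows may be counted at the level `Γ` each, since `Γ` is at least `β` and hence
          -- not negative.
          count≼ (inj₂ (m≤N , 0≼β)) = ∑-const-mono m≤N (≼-trans 0≼β (proj₁ (proj₂ (proj₂ Γ-data))))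
          Γ-count : mΓ ≼ NΓ
          Γ-count = count≼ enough

    -- Measured from `y`, the code costs its own length plus `n` prices, one of which belongs to the
    -- root in `total`. So the rows of the code and the charges `G` both carry `n′` prices, which
    -- cancel.
    cost-bound : 1 < r → ∀ {ws} → length ws ≡ suc n′ → (dec : Decomposed ws) →
      length (Decomposed.rows dec) ≡ m ⊎ (m < length (Decomposed.rows dec) × D ≼ E m ⊞ ĉ 1) →
      S ≼ ∑ᴸ depth ws
    cost-bound 1<r {ws} len dec case = ≼-linear (rows-≼ case) (⊞-cancelʳ y (≈-trans
        (solve 3 (λ s v y → s :+ v :+ y ⊜ s :+ (y :+ v)) ≈-refl _ _ _)
        (≈-trans (+-congˡ (≈-sym (total y)))
        (≈-trans (+-congˡ (≈-trans (∑ᴸ-⊞ (λ _ → y) depth ws) (+-congʳ (≈-trans (∑ᴸ-const y ws) (≈-reflexive (cong (λ k → ∑ k (λ _ → y)) len))))))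
        (≈-trans (solve 4 (λ s y Y d → s :+ (y :+ Y :+ d) ⊜ d :+ (s :+ Y) :+ y) ≈-refl _ _ _ _) (+-congʳ (+-congˡ (≈-sym G-sum))))))))
      where
      open Decomposed dec
      rows-≼ : length rows ≡ m ⊎ (m < length rows × D ≼ E m ⊞ ĉ 1) → ∑ m G ≼ ∑ᴸ (rowValue y) rows
      -- For equally many rows `β` may be any value that deep rows attain, such as `G 0`, by
      -- `row-bound`.
      rows-≼ (inj₁ e) = rows-bound (G 0) rows unique (λ ρ deep → row-bound 0 ρ 1≤m (≼-trans (E-mono z≤n m<t) deep)) (inj₁ e)
      rows-≼ (inj₂ (m<N , D≼)) = rows-bound 0# rows unique
        (λ ρ deep → row-nonNeg ρ 1<r (≼-trans D≼ (⊞-monoˡ _ deep))) (inj₂ (ℕₚ.<⇒≤ m<N , ≼-refl))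

-- The machine programs and rules for reasoning about their runs and costs.

winnerᵃ countᵃ Rᵛ tᵛ Lᵛ iᵛ jᵛ Nᵛ wᵛ mᵛ totalᵛ bestᵛ : ℕ
winnerᵃ = 5
countᵃ  = 6
Rᵛ      = 7
tᵛ      = 8
Lᵛ      = 9
iᵛ      = 10
jᵛ      = 11
Nᵛ      = 12
wᵛ      = 13
mᵛ      = 14
totalᵛ  = 15
bestᵛ   = 16

lengthᵃ depthᵃ keyᵃ Sᵛ bestCostᵛ : ℕ
lengthᵃ   = 0
depthᵃ    = 1
keyᵃ      = 2
Sᵛ        = 3
bestCostᵛ = 4

infix 4 _≔_
_≔_ : ℕ → NatExp → Program
x ≔ e = storeᴺ x (lit 0) e

var : ℕ → NatExp
var x = load x (lit 0)

play : Program
play = if load keyᵃ (load winnerᵃ (var iᵛ ⊗ lit 2)) ≤ᴸ load keyᵃ (load winnerᵃ (var iᵛ ⊗ lit 2 ⊕ lit 1))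
       then storeᴺ winnerᵃ (var iᵛ) (load winnerᵃ (var iᵛ ⊗ lit 2))
       else storeᴺ winnerᵃ (var iᵛ) (load winnerᵃ (var iᵛ ⊗ lit 2 ⊕ lit 1))

mend : Program
mend = while lit 1 ≤ᴺ var iᵛ loop (play ⨾ iᵛ ≔ var iᵛ ⊘ lit 2)

build : Program
build = iᵛ ≔ var Rᵛ ⊖ lit 1 ⨾ while lit 1 ≤ᴺ var iᵛ loop (play ⨾ iᵛ ≔ var iᵛ ⊖ lit 1)

update-at : ∀ {b} {B : Set b} (f : ℕ → ℕ → B) x i v → update f x i v x i ≡ v
update-at f x i v with x ℕₚ.≟ x | i ℕₚ.≟ i
... | yes _ | yes _ = refl
... | yes _ | no ≢ = ⊥-elim (≢ refl)
... | no ≢ | _ = ⊥-elim (≢ refl)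

update-off : ∀ {b} {B : Set b} (f : ℕ → ℕ → B) x i v {i′} → i′ ≢ i → update f x i v x i′ ≡ f x i′
update-off f x i v {i′} i′≢i with x ℕₚ.≟ x | i′ ℕₚ.≟ i
... | yes _ | yes e = ⊥-elim (i′≢i e)
... | yes _ | no _ = refl
... | no _ | _ = refl

update-other : ∀ {b} {B : Set b} (f : ℕ → ℕ → B) x i v {x′} i′ → x′ ≢ x → update f x i v x′ i′ ≡ f x′ i′
update-other f x i v {x′} i′ x′≢x with x′ ℕₚ.≟ x | i′ ℕₚ.≟ i
... | yes e | _ = ⊥-elim (x′≢x e)
... | no _ | _ = refl

-- The cost `k` of a round is indexed by the number of rounds still to come after it, because the
-- rows of the search have different costs.
loopCost : ℕ → (ℕ → ℕ) → ℕ → ℕ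
loopCost b k zero    = b
loopCost b k (suc f) = b + (k f + loopCost b k f)

loopCost-const : ∀ b k f → loopCost b (λ _ → k) f ≡ b + f * (b + k)
loopCost-const b k zero = ≡.sym (ℕₚ.+-identityʳ b)
loopCost-const b k (suc f) = cong (b +_) (≡.trans (cong (k +_) (loopCost-const b k f))
  (≡.trans (≡.sym (ℕₚ.+-assoc k b _)) (cong (_+ f * (b + k)) (ℕₚ.+-comm k b))))

linear-cost : ∀ {b c k f m C} → 1 ≤ m → f ≤ m → c + b + (b + k) ≤ C → c + loopCost b (λ _ → k) f ≤ m * C
linear-cost {b} {c} {k} {f} {m} {C} 1≤m f≤m le = begin
  c + loopCost b (λ _ → k) f  ≡⟨ cong (c +_) (loopCost-const b k f) ⟩
  c + (b + f * (b + k))       ≡⟨ ≡.sym (ℕₚ.+-assoc c b _) ⟩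
  c + b + f * (b + k)         ≤⟨ ℕₚ.+-mono-≤ (ℕₚ.≤-trans (ℕₚ.≤-reflexive (≡.sym (ℕₚ.*-identityˡ _))) (ℕₚ.*-monoˡ-≤ (c + b) 1≤m)) (ℕₚ.*-monoˡ-≤ (b + k) f≤m) ⟩
  m * (c + b) + m * (b + k)   ≡⟨ ≡.sym (ℕₚ.*-distribˡ-+ m (c + b) (b + k)) ⟩
  m * (c + b + (b + k))       ≤⟨ ℕₚ.*-monoʳ-≤ m le ⟩
  m * C                       ∎
  where open ℕₚ.≤-Reasoning

module Execution {a ℓ₁ ℓ₂} (F : OrderedField a ℓ₁ ℓ₂) where
  open OrderedFieldLemmas F
  open Machine F public

  Holds : Test → Store → Set ℓ₂
  Holds (d ≤ᴺ e) σ  = Level.Lift ℓ₂ (evalᴺ d σ ≤ evalᴺ e σ)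
  Holds (d ≤ᴸ e) σ  = evalᴸ d σ ≼ evalᴸ e σ
  Holds (neg b) σ   = ¬ Holds b σ
  Holds (and b c) σ = Holds b σ × Holds c σ

  decideᵀ : ∀ b σ → (evalᵀ b σ ≡ true × Holds b σ) ⊎ (evalᵀ b σ ≡ false × ¬ Holds b σ)
  decideᵀ (d ≤ᴺ e) σ with evalᴺ d σ ℕₚ.≤? evalᴺ e σ
  ... | yes p = inj₁ (dec-true (_ ℕₚ.≤? _) p , Level.lift p)
  ... | no ¬p = inj₂ (dec-false (_ ℕₚ.≤? _) ¬p , λ (Level.lift p) → ¬p p)
  decideᵀ (d ≤ᴸ e) σ with evalᴸ d σ ≼? evalᴸ e σ
  ... | yes p = inj₁ (refl , p)
  ... | no ¬p = inj₂ (refl , ¬p)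
  decideᵀ (neg b) σ with decideᵀ b σ
  ... | inj₁ (e , p) rewrite e = inj₂ (refl , λ ¬p → ¬p p)
  ... | inj₂ (e , ¬p) rewrite e = inj₁ (refl , ¬p)
  decideᵀ (and b c) σ with decideᵀ b σ
  ... | inj₂ (e , ¬p) rewrite e = inj₂ (refl , λ (p , _) → ¬p p)
  ... | inj₁ (e , p) with decideᵀ c σ
  ...   | inj₁ (e′ , p′) rewrite e | e′ = inj₁ (refl , p , p′)
  ...   | inj₂ (e′ , ¬p′) rewrite e | e′ = inj₂ (refl , λ (_ , p′) → ¬p′ p′)

  -- Started in σ, P halts within k * u operations in a store satisfying Q.
  record Exec (u : ℕ) (P : Program) (σ : Store) (k : ℕ) {q} (Q : Store → Set q) : Set (a Level.⊔ q) where
    constructor exec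
    field
      {time}  : ℕ
      {final} : Store
      run     : Run P σ time final
      bound   : time ≤ k * u
      post    : Q final

  change-unit : ∀ {u u′ P σ k k′ q} {Q : Store → Set q} → k * u ≤ k′ * u′ → Exec u P σ k Q → Exec u′ P σ k′ Q
  change-unit le (exec run bound post) = exec run (ℕₚ.≤-trans bound le) post

  module Rules (u : ℕ) (1≤u : 1 ≤ u) where

    scale : ∀ k → k ≤ k * u
    scale k = ℕₚ.≤-trans (ℕₚ.≤-reflexive (≡.sym (ℕₚ.*-identityʳ k))) (ℕₚ.*-monoʳ-≤ k 1≤u)

    weaken : ∀ {P σ k k′ q} {Q : Store → Set q} → k ≤ k′ → Exec u P σ k Q → Exec u P σ k′ Q
    weaken k≤k′ = change-unit (ℕₚ.*-monoˡ-≤ u k≤k′)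

    consequence : ∀ {P σ k q q′} {Q : Store → Set q} {Q′ : Store → Set q′} → (∀ {τ} → Q τ → Q′ τ) → Exec u P σ k Q → Exec u P σ k Q′
    consequence f (exec run bound post) = exec run bound (f post)

    skipˣ : ∀ {σ q} {Q : Store → Set q} → Q σ → Exec u skip σ 1 Q
    skipˣ post = exec skip (scale 1) post

    assignᴺ : ∀ {σ x i e q} {Q : Store → Set q} →
      Q (store (update (nats σ) x (evalᴺ i σ) (evalᴺ e σ)) (lens σ)) → Exec u (storeᴺ x i e) σ (suc (timeᴺ i + timeᴺ e)) Q
    assignᴺ post = exec storeᴺ (scale _) post

    assignᴸ : ∀ {σ x i e q} {Q : Store → Set q} →
      Q (store (nats σ) (update (lens σ) x (evalᴺ i σ) (evalᴸ e σ))) → Exec u (storeᴸ x i e) σ (suc (timeᴺ i + timeᴸ e)) Q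
    assignᴸ post = exec storeᴸ (scale _) post

    sequence : ∀ {P P′ σ k l q} {Q : Store → Set q} → Exec u P σ k (λ τ → Exec u P′ τ l Q) → Exec u (P ⨾ P′) σ (k + l) Q
    sequence {k = k} {l} (exec run bound (exec run′ bound′ post)) =
      exec (run ⨾ run′) (ℕₚ.≤-trans (ℕₚ.+-mono-≤ bound bound′) (ℕₚ.≤-reflexive (≡.sym (ℕₚ.*-distribʳ-+ u k l)))) post

    branch : ∀ {b P P′ σ k l q} {Q : Store → Set q} → (Holds b σ → Exec u P σ k Q) → (¬ Holds b σ → Exec u P′ σ l Q) →
      Exec u (if b then P else P′) σ (timeᵀ b + (k ⊔ l)) Q
    branch {b} {σ = σ} {k} {l} yes-case no-case with decideᵀ b σ
    ... | inj₁ (e , p) = let exec run bound post = yes-case p in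
          exec (if-true e run) (ℕₚ.≤-trans (ℕₚ.+-mono-≤ (scale (timeᵀ b)) (ℕₚ.≤-trans bound (ℕₚ.*-monoˡ-≤ u (ℕₚ.m≤m⊔n k l)))) (ℕₚ.≤-reflexive (≡.sym (ℕₚ.*-distribʳ-+ u (timeᵀ b) (k ⊔ l))))) post
    ... | inj₂ (e , ¬p) = let exec run bound post = no-case ¬p in
          exec (if-false e run) (ℕₚ.≤-trans (ℕₚ.+-mono-≤ (scale (timeᵀ b)) (ℕₚ.≤-trans bound (ℕₚ.*-monoˡ-≤ u (ℕₚ.m≤n⊔m k l)))) (ℕₚ.≤-reflexive (≡.sym (ℕₚ.*-distribʳ-+ u (timeᵀ b) (k ⊔ l))))) post

    -- The fuel `f` bounds the rounds still to come. The body has to show that a successful test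
    -- leaves some fuel, which yields termination and cost at once.
    iterate : ∀ {b P q} (I : ℕ → Store → Set q) (k : ℕ → ℕ) →
      (∀ f σ → I f σ → Holds b σ → ∃[ f′ ] f ≡ suc f′ × Exec u P σ (k f′) (I f′)) →
      ∀ f σ → I f σ → Exec u (while b loop P) σ (loopCost (timeᵀ b) k f) (λ τ → ∃[ f′ ] I f′ τ × ¬ Holds b τ)
    iterate {b} {P} I k body f σ inv with decideᵀ b σ
    ... | inj₂ (e , ¬p) = exec (while-false e) (ℕₚ.≤-trans (scale (timeᵀ b)) (ℕₚ.*-monoˡ-≤ u (first f))) (f , inv , ¬p)
      where
      first : ∀ f → timeᵀ b ≤ loopCost (timeᵀ b) k f
      first zero = ℕₚ.≤-refl
      first (suc f) = ℕₚ.m≤m+n _ _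
    ... | inj₁ (e , p) with body f σ inv p
    ...   | f′ , refl , exec run bound post with iterate {b} {P} I k body f′ _ post
    ...     | exec run′ bound′ post′ = exec (while-true e run run′)
              (ℕₚ.≤-trans (ℕₚ.+-mono-≤ (scale (timeᵀ b)) (ℕₚ.+-mono-≤ bound bound′))
                (ℕₚ.≤-reflexive (≡.sym (≡.trans (ℕₚ.*-distribʳ-+ u (timeᵀ b) _) (cong (timeᵀ b * u +_) (ℕₚ.*-distribʳ-+ u (k f′) _)))))) post′

    count-up : ∀ (x : ℕ) (e : NatExp) {P q} (J : ℕ → Store → Set q) (lim k : ℕ) →
      (∀ {j σ} → J j σ → nats σ x 0 ≡ j) → (∀ {j σ} → J j σ → evalᴺ e σ ≡ lim) →
      (∀ j σ → j < lim → J j σ → Exec u P σ k (J (suc j))) →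
      ∀ j f → j + f ≡ lim → ∀ σ → J j σ →
      Exec u (while lit 1 ⊕ var x ≤ᴺ e loop P) σ (loopCost (timeᵀ (lit 1 ⊕ var x ≤ᴺ e)) (λ _ → k) f) (J lim)
    count-up x e {P} J lim k x≡ e≡ body j₀ f₀ j₀+f₀ σ₀ start = consequence finish (iterate I (λ _ → k) step f₀ σ₀ (j₀ , j₀+f₀ , start))
      where
      I : ℕ → Store → Set _
      I f σ = ∃[ j ] j + f ≡ lim × J j σ
      step : ∀ f σ → I f σ → Holds (lit 1 ⊕ var x ≤ᴺ e) σ → ∃[ f′ ] f ≡ suc f′ × Exec u P σ k (I f′)
      step zero σ (j , j+0 , inv) (Level.lift j<) =
        ⊥-elim (ℕₚ.<-irrefl refl (≡.subst₂ _<_ (≡.trans (x≡ inv) (≡.trans (≡.sym (ℕₚ.+-identityʳ j)) j+0)) (e≡ inv) j<))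
      step (suc f) σ (j , j+f , inv) (Level.lift j<) = f , refl ,
        consequence (λ inv′ → suc j , ≡.trans (≡.sym (ℕₚ.+-suc j f)) j+f , inv′) (body j σ (≡.subst₂ _<_ (x≡ inv) (e≡ inv) j<) inv)
      finish : ∀ {τ} → (∃[ f ] I f τ × ¬ Holds (lit 1 ⊕ var x ≤ᴺ e) τ) → J lim τ
      finish (zero , (j , j+f , inv) , done) = subst (λ k → J k _) (≡.trans (≡.sym (ℕₚ.+-identityʳ j)) j+f) inv
      finish (suc f , (j , j+f , inv) , done) = ⊥-elim (done (Level.lift (≡.subst₂ _<_ (≡.sym (x≡ inv)) (≡.sym (e≡ inv))
        (subst (suc j ≤_) (≡.trans (≡.sym (ℕₚ.+-suc j f)) j+f) (s≤s (ℕₚ.m≤m+n j f))))))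

-- Tournaments stored like binary heaps.

data Above : ℕ → ℕ → Set where
  here : ∀ {i} → Above i i
  up   : ∀ {i k} → Above (i / 2) k → Above i k

half-double : ∀ i → i * 2 / 2 ≡ i
half-double i = DivMod.m*n/n≡m i 2

half-double+1 : ∀ i → (i * 2 + 1) / 2 ≡ i
half-double+1 i = ≡.trans (DivMod.+-distrib-/-∣ˡ {i * 2} 1 (divides i refl)) (≡.trans (ℕₚ.+-identityʳ _) (half-double i))
  where open import Data.Nat.Divisibility using (divides)

double-or : ∀ i → i ≡ i / 2 * 2 ⊎ i ≡ i / 2 * 2 + 1
double-or i with i % 2 | DivMod.m%n<n i 2 | DivMod.m≡m%n+[m/n]*n i 2
... | 0 | _ | e = inj₁ e
... | 1 | _ | e = inj₂ (≡.trans e (ℕₚ.+-comm 1 _))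
... | suc (suc _) | s≤s (s≤s ()) | _

half< : ∀ {i k} → i < k * 2 → i / 2 < k
half< {i} {k} lt = DivMod.m<n*o⇒m/o<n lt

above-even : ∀ {x i} → Above x (i * 2) → Above x i
above-even {i = i} here = up (subst (λ k → Above k i) (≡.sym (half-double i)) here)
above-even (up p) = up (above-even p)

above-odd : ∀ {x i} → Above x (i * 2 + 1) → Above x i
above-odd {i = i} here = up (subst (λ k → Above k i) (≡.sym (half-double+1 i)) here)
above-odd (up p) = up (above-odd p)

above-zero : ∀ {x i} → Above x i → x ≡ 0 → i ≡ 0
above-zero here e = e
above-zero (up p) refl = above-zero p refl

double : ∀ i → i * 2 ≡ i + i
double i = ≡.trans (ℕₚ.*-comm i 2) (cong (i +_) (ℕₚ.+-identityʳ i))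

i<i*2 : ∀ {i} → 1 ≤ i → i < i * 2
i<i*2 {i} 1≤i = ℕₚ.<-≤-trans (ℕₚ.m<m+n i 1≤i) (ℕₚ.≤-reflexive (≡.sym (double i)))

i*2<R+R : ∀ {i R} → i < R → i * 2 + 1 < R + R
i*2<R+R {i} {R} i<R = ℕₚ.≤-trans (ℕₚ.≤-reflexive (≡.trans (cong suc (ℕₚ.+-comm (i * 2) 1)) refl))
  (ℕₚ.≤-trans (ℕₚ.*-monoˡ-≤ 2 i<R) (ℕₚ.≤-reflexive (double R)))

module Tournament {a ℓ₁ ℓ₂} (F : OrderedField a ℓ₁ ℓ₂) (R : ℕ) where
  open OrderedFieldLemmas F
  open Execution F

  -- The winner must come from a leaf below node `i`; hence a changed key can only spoil matches
  -- above the leaf of its own letter.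
  Winner : (ℕ → ℕ) → ℕ → Set
  Winner win i = win i < R × Above (R + win i) i

  Best : (ℕ → ℕ) → (ℕ → Carrier) → ℕ → Set ℓ₂
  Best win K i = K (win i) ≼ K (win (i * 2)) × K (win i) ≼ K (win (i * 2 + 1))

  Leaves : (ℕ → ℕ) → Set
  Leaves win = ∀ j → j < R → win (R + j) ≡ j

  -- A tournament on the keys: leaf R + j belongs to letter j, the children of
  -- node i are 2 i and 2 i + 1.
  record Tree (win : ℕ → ℕ) (K : ℕ → Carrier) : Set ℓ₂ where
    field
      leaves : Leaves win
      winner : ∀ i → 1 ≤ i → i < R → Winner win i
      best   : ∀ i → 1 ≤ i → i < R → Best win K i

  -- A leaf is its own winner. With this both children of a match are treated alike, although for
  -- general `R` leaves may lie on two levels.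
  winner-all : ∀ {win} → Leaves win → ∀ i → (i < R → Winner win i) → i < R + R → Winner win i
  winner-all {win} leaves i inner i<2R with i ℕₚ.<? R
  ... | yes i<R = inner i<R
  ... | no i≮R = subst (Winner win) (ℕₚ.m+[n∸m]≡n R≤i) (at-leaf (i ∸ R) (ℕₚ.+-cancelˡ-< R _ _ (subst (_< R + R) (≡.sym (ℕₚ.m+[n∸m]≡n R≤i)) i<2R)))
    where
    R≤i = ℕₚ.≮⇒≥ i≮R
    at-leaf : ∀ j → j < R → Winner win (R + j)
    at-leaf j j<R rewrite leaves j j<R = j<R , here

  module _ {win K} (tree : Tree win K) where
    open Tree tree

    champion<R : 1 ≤ R → win 1 < R
    champion<R 1≤R = proj₁ (winner-all {win} leaves 1 (winner 1 ℕₚ.≤-refl) (ℕₚ.+-mono-≤ 1≤R 1≤R))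

    -- Halving leads from every position to the root, and on the way the key of the winner does not
    -- increase.
    champion-node : ∀ i → 1 ≤ i → i < R + R → K (win 1) ≼ K (win i)
    champion-node = <-rec _ step
      where
      step : ∀ i → (∀ {i′} → i′ < i → 1 ≤ i′ → i′ < R + R → K (win 1) ≼ K (win i′)) → 1 ≤ i → i < R + R → K (win 1) ≼ K (win i)
      step 1 rec _ _ = ≼-refl
      step i@(suc (suc i″)) rec _ i<2R = ≼-trans (rec h<i 1≤h (ℕₚ.<-trans h<i i<2R)) (child (double-or i))
        where
        h = i / 2
        1≤h : 1 ≤ h
        1≤h = DivMod./-monoˡ-≤ {m = 2} {n = i} 2 (s≤s (s≤s z≤n))
        h<i : h < i
        h<i = DivMod.m/n<m i 2 (s≤s (s≤s z≤n))
        h<R : h < R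
        h<R = half< (subst (i <_) (≡.sym (double R)) i<2R)
        child : i ≡ h * 2 ⊎ i ≡ h * 2 + 1 → K (win h) ≼ K (win i)
        child (inj₁ e) = subst (λ k → K (win h) ≼ K (win k)) (≡.sym e) (proj₁ (best h 1≤h h<R))
        child (inj₂ e) = subst (λ k → K (win h) ≼ K (win k)) (≡.sym e) (proj₂ (best h 1≤h h<R))

    champion : ∀ j → j < R → K (win 1) ≼ K j
    champion j j<R = subst (λ w → K (win 1) ≼ K w) (leaves j j<R) (champion-node (R + j) (ℕₚ.≤-trans (ℕₚ.≤-trans (s≤s z≤n) j<R) (ℕₚ.m≤m+n R j)) (ℕₚ.+-monoʳ-< R j<R))

  record OnlyWinners (σ τ : Store) : Set a where
    field
      same-lens : lens τ ≡ lens σ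
      same-nats : ∀ x i → x ≢ winnerᵃ → x ≢ iᵛ → nats τ x i ≡ nats σ x i

  OnlyWinners-refl : ∀ {σ} → OnlyWinners σ σ
  OnlyWinners-refl = record { same-lens = refl ; same-nats = λ _ _ _ _ → refl }

  OnlyWinners-trans : ∀ {ρ σ τ} → OnlyWinners ρ σ → OnlyWinners σ τ → OnlyWinners ρ τ
  OnlyWinners-trans p q = record
    { same-lens = ≡.trans (OnlyWinners.same-lens q) (OnlyWinners.same-lens p)
    ; same-nats = λ x i ≢w ≢i → ≡.trans (OnlyWinners.same-nats q x i ≢w ≢i) (OnlyWinners.same-nats p x i ≢w ≢i) }

  record Played (i : ℕ) (σ τ : Store) : Set (a Level.⊔ ℓ₂) where
    field
      frame    : OnlyWinners σ τ
      same-i   : nats τ iᵛ 0 ≡ nats σ iᵛ 0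
      off      : ∀ i′ → i′ ≢ i → nats τ winnerᵃ i′ ≡ nats σ winnerᵃ i′
      chosen   : nats τ winnerᵃ i ≡ nats σ winnerᵃ (i * 2) ⊎ nats τ winnerᵃ i ≡ nats σ winnerᵃ (i * 2 + 1)
      beats    : lens σ keyᵃ (nats τ winnerᵃ i) ≼ lens σ keyᵃ (nats σ winnerᵃ (i * 2)) ×
                 lens σ keyᵃ (nats τ winnerᵃ i) ≼ lens σ keyᵃ (nats σ winnerᵃ (i * 2 + 1))

  play-exec : ∀ u (1≤u : 1 ≤ u) σ → Exec u play σ 28 (Played (nats σ iᵛ 0) σ)
  play-exec u 1≤u σ = weaken (ℕₚ.≤ᵇ⇒≤ _ _ _) (branch
    (λ le → assignᴺ (record
      { frame = record { same-lens = refl ; same-nats = λ x i′ ≢w _ → update-other _ winnerᵃ i _ i′ ≢w }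
      ; same-i = refl
      ; off = λ i′ ≢i → update-off (nats σ) winnerᵃ i _ ≢i
      ; chosen = inj₁ at-i
      ; beats = subst (λ w → K w ≼ K (win (i * 2)) × K w ≼ K (win (i * 2 + 1))) (≡.sym at-i) (≼-refl , le) }))
    (λ gt → assignᴺ (record
      { frame = record { same-lens = refl ; same-nats = λ x i′ ≢w _ → update-other _ winnerᵃ i _ i′ ≢w }
      ; same-i = refl
      ; off = λ i′ ≢i → update-off (nats σ) winnerᵃ i _ ≢i
      ; chosen = inj₂ at-i
      ; beats = subst (λ w → K w ≼ K (win (i * 2)) × K w ≼ K (win (i * 2 + 1))) (≡.sym at-i) (≺⇒≼ gt , ≼-refl) })))
    where
    open Rules u 1≤u
    i = nats σ iᵛ 0
    K = lens σ keyᵃ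
    win = nats σ winnerᵃ
    at-i : ∀ {v} → update (nats σ) winnerᵃ i v winnerᵃ i ≡ v
    at-i {v} = update-at (nats σ) winnerᵃ i v

  played-winner : ∀ {i σ τ} → Leaves (nats σ winnerᵃ) → Played i σ τ → 1 ≤ i → i < R →
    (∀ i′ → i < i′ → i′ < R → Winner (nats σ winnerᵃ) i′) → Winner (nats τ winnerᵃ) i
  played-winner {i} {σ} {τ} leaves played 1≤i i<R inner with Played.chosen played
  ... | inj₁ e rewrite e = let (w<R , ab) = winner-all {nats σ winnerᵃ} leaves (i * 2) (inner (i * 2) (i<i*2 1≤i)) (ℕₚ.<-trans (ℕₚ.m<m+n (i * 2) z<s) (i*2<R+R i<R)) in w<R , above-even ab
  ... | inj₂ e rewrite e = let (w<R , ab) = winner-all {nats σ winnerᵃ} leaves (i * 2 + 1) (inner (i * 2 + 1) (ℕₚ.<-trans (i<i*2 1≤i) (ℕₚ.m<m+n (i * 2) z<s))) (i*2<R+R i<R) in w<R , above-odd ab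

  played-leaves : ∀ {i σ τ} → Played i σ τ → i < R → Leaves (nats σ winnerᵃ) → Leaves (nats τ winnerᵃ)
  played-leaves played i<R leaves j j<R = ≡.trans (Played.off played (R + j) (λ e → ℕₚ.<⇒≱ i<R (ℕₚ.≤-trans (ℕₚ.m≤m+n R j) (ℕₚ.≤-reflexive e)))) (leaves j j<R)

  played-best-self : ∀ {i σ τ} → Played i σ τ → 1 ≤ i → Best (nats τ winnerᵃ) (lens σ keyᵃ) i
  played-best-self {i} {σ} {τ} played 1≤i =
    subst (λ w → K (nats τ winnerᵃ i) ≼ K w) (≡.sym (off (i * 2) (λ e → ℕₚ.<⇒≢ (i<i*2 1≤i) (≡.sym e)))) (proj₁ beats) ,
    subst (λ w → K (nats τ winnerᵃ i) ≼ K w) (≡.sym (off (i * 2 + 1) (λ e → ℕₚ.<⇒≢ (ℕₚ.<-trans (i<i*2 1≤i) (ℕₚ.m<m+n (i * 2) z<s)) (≡.sym e)))) (proj₂ beats)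
    where
    open Played played
    K = lens σ keyᵃ

  played-best-off : ∀ {i σ τ i′} → Played i σ τ → i′ ≢ i → i′ ≢ i / 2 → Best (nats σ winnerᵃ) (lens σ keyᵃ) i′ → Best (nats τ winnerᵃ) (lens σ keyᵃ) i′
  played-best-off {i} {σ} {τ} {i′} played i′≢i i′≢h (b₁ , b₂) = ≡.subst₂ _≼_ (same i′ i′≢i) (same (i′ * 2) even) b₁ , ≡.subst₂ _≼_ (same i′ i′≢i) (same (i′ * 2 + 1) odd) b₂
    where
    K = lens σ keyᵃ
    same : ∀ k → k ≢ i → K (nats σ winnerᵃ k) ≡ K (nats τ winnerᵃ k)
    same k ≢i = cong K (≡.sym (Played.off played k ≢i))
    even : i′ * 2 ≢ i
    even e = i′≢h (≡.trans (≡.sym (half-double i′)) (cong (_/ 2) e))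
    odd : i′ * 2 + 1 ≢ i
    odd e = i′≢h (≡.trans (≡.sym (half-double+1 i′)) (cong (_/ 2) e))

  -- Only the matches on the path above node i may have a wrong winner.
  record Mending (i : ℕ) (win : ℕ → ℕ) (K : ℕ → Carrier) : Set ℓ₂ where
    field
      i<R    : i < R
      leaves : Leaves win
      winner : ∀ i′ → 1 ≤ i′ → i′ < R → Winner win i′
      best   : ∀ i′ → 1 ≤ i′ → i′ < R → ¬ Above i i′ → Best win K i′

  mending-step : ∀ {i σ τ} → Played i σ τ → 1 ≤ i → Mending i (nats σ winnerᵃ) (lens σ keyᵃ) → Mending (i / 2) (nats τ winnerᵃ) (lens σ keyᵃ)
  mending-step {i} {σ} {τ} played 1≤i mending = record
    { i<R = ℕₚ.≤-<-trans (DivMod.m/n≤m i 2) i<R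
    ; leaves = played-leaves played i<R leaves
    ; winner = winner′
    ; best = best′ }
    where
    open Mending mending
    winner′ : ∀ i′ → 1 ≤ i′ → i′ < R → Winner (nats τ winnerᵃ) i′
    winner′ i′ 1≤i′ i′<R with i′ ℕₚ.≟ i
    ... | yes refl = played-winner leaves played 1≤i i<R (λ k i<k → winner k (ℕₚ.≤-trans 1≤i (ℕₚ.<⇒≤ i<k)))
    ... | no ≢i rewrite Played.off played i′ ≢i = winner i′ 1≤i′ i′<R
    best′ : ∀ i′ → 1 ≤ i′ → i′ < R → ¬ Above (i / 2) i′ → Best (nats τ winnerᵃ) (lens σ keyᵃ) i′
    best′ i′ 1≤i′ i′<R not-above with i′ ℕₚ.≟ i
    ... | yes refl = played-best-self played 1≤i
    ... | no ≢i = played-best-off played ≢i (λ { refl → not-above here }) (best i′ 1≤i′ i′<R (λ { here → ≢i refl ; (up p) → not-above p }))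

  -- In a match that is not above the leaf of `w`, neither the winner nor a participant is `w`, so
  -- the outcome stands under the new keys.
  mending-start : ∀ {win K K′} w → w < R → Tree win K → (∀ j → j < R → j ≢ w → K′ j ≡ K j) → Mending ((R + w) / 2) win K′
  mending-start {win} {K} {K′} w w<R tree same = record
    { i<R = half< (subst (R + w <_) (≡.sym (double R)) (ℕₚ.+-monoʳ-< R w<R))
    ; leaves = leaves ; winner = winner ; best = best′ }
    where
    open Tree tree
    best′ : ∀ i → 1 ≤ i → i < R → ¬ Above ((R + w) / 2) i → Best win K′ i
    best′ i 1≤i i<R not-above =
      ≡.subst₂ _≼_ (eq self (λ p → p)) (eq even above-even) (proj₁ b) , ≡.subst₂ _≼_ (eq self (λ p → p)) (eq odd above-odd) (proj₂ b)
      where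
      b = best i 1≤i i<R
      absurd : Above (R + w) i → ⊥
      absurd here = ℕₚ.<⇒≱ i<R (ℕₚ.m≤m+n R w)
      absurd (up p) = not-above p
      self = winner i 1≤i i<R
      even : Winner win (i * 2)
      even = winner-all {win} leaves (i * 2) (winner (i * 2) (ℕₚ.<⇒≤ (ℕₚ.≤-<-trans 1≤i (i<i*2 1≤i)))) (ℕₚ.<-trans (ℕₚ.m<m+n (i * 2) z<s) (i*2<R+R i<R))
      odd : Winner win (i * 2 + 1)
      odd = winner-all {win} leaves (i * 2 + 1) (winner (i * 2 + 1) (ℕₚ.m≤n+m 1 (i * 2))) (i*2<R+R i<R)
      eq : ∀ {k} → Winner win k → (Above (R + w) k → Above (R + w) i) → K (win k) ≡ K′ (win k)
      eq {k} (win<R , above) lift = ≡.sym (same (win k) win<R (λ e → absurd (lift (subst (λ v → Above (R + v) k) e above))))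

  mending-end : ∀ {i win K} → i ≡ 0 → Mending i win K → Tree win K
  mending-end i≡0 mending = record
    { leaves = leaves ; winner = winner
    ; best = λ i′ 1≤i′ i′<R → best i′ 1≤i′ i′<R (λ p → ℕₚ.<⇒≢ 1≤i′ (≡.sym (above-zero p i≡0))) }
    where open Mending mending

  -- A position below 2 ^ suc u reaches 0 after at most `suc u` halvings. These rounds are counted
  -- in single operations, 42 + 38 u in all, which is less than 84 u for positive u: a constant
  -- number of units, whatever the size of the alphabet.
  mend-exec : ∀ u → 1 ≤ u → R ≤ 2 ^ suc u → ∀ σ → Mending (nats σ iᵛ 0) (nats σ winnerᵃ) (lens σ keyᵃ) →
    Exec u mend σ 84 (λ τ → OnlyWinners σ τ × Tree (nats τ winnerᵃ) (lens σ keyᵃ))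
  mend-exec u 1≤u R≤ σ mending = change-unit cost (consequence finish (iterate I (λ _ → 34) body (suc u) σ
      (OnlyWinners-refl , ℕₚ.<-≤-trans (Mending.i<R mending) R≤ , mending)))
    where
    open Rules 1 ℕₚ.≤-refl
    I : ℕ → Store → Set _
    I f τ = OnlyWinners σ τ × nats τ iᵛ 0 < 2 ^ f × Mending (nats τ iᵛ 0) (nats τ winnerᵃ) (lens σ keyᵃ)
    body : ∀ f ρ → I f ρ → Holds (lit 1 ≤ᴺ var iᵛ) ρ → ∃[ f′ ] f ≡ suc f′ × Exec 1 (play ⨾ iᵛ ≔ var iᵛ ⊘ lit 2) ρ 34 (I f′)
    body zero ρ (_ , i<1 , _) (Level.lift 1≤i) = ⊥-elim (ℕₚ.<⇒≱ i<1 1≤i)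
    body (suc f) ρ (frame , i< , mending) (Level.lift 1≤i) = f , refl , sequence (consequence after (play-exec 1 ℕₚ.≤-refl ρ))
      where
      after : ∀ {τ} → Played (nats ρ iᵛ 0) ρ τ → Exec 1 (iᵛ ≔ var iᵛ ⊘ lit 2) τ 6 (I f)
      after {τ} played = assignᴺ
        ( record { same-lens = same-lens ; same-nats = λ x i ≢w ≢i → ≡.trans (update-other (nats τ) iᵛ 0 _ i ≢i) (same-nats x i ≢w ≢i) }
        , subst (λ k → k / 2 < 2 ^ f) (≡.sym same-i) (half< (subst (nats ρ iᵛ 0 <_) (ℕₚ.*-comm 2 (2 ^ f)) i<))
        , subst (λ k → Mending (k / 2) (nats τ winnerᵃ) (lens σ keyᵃ)) (≡.sym same-i)
            (subst (λ l → Mending (nats ρ iᵛ 0 / 2) (nats τ winnerᵃ) (l keyᵃ)) (OnlyWinners.same-lens frame)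
              (mending-step played 1≤i (subst (λ l → Mending (nats ρ iᵛ 0) (nats ρ winnerᵃ) (l keyᵃ)) (≡.sym (OnlyWinners.same-lens frame)) mending))))
        where
        open OnlyWinners (OnlyWinners-trans frame (Played.frame played))
        open Played played using (same-i)
    finish : ∀ {τ} → (∃[ f ] I f τ × ¬ Holds (lit 1 ≤ᴺ var iᵛ) τ) → OnlyWinners σ τ × Tree (nats τ winnerᵃ) (lens σ keyᵃ)
    finish {τ} (f , (frame , _ , mending) , done) = frame , mending-end (ℕₚ.n<1⇒n≡0 (ℕₚ.≰⇒> (λ le → done (Level.lift le)))) mending
    cost : loopCost 4 (λ _ → 34) (suc u) * 1 ≤ 84 * u
    cost = begin
      loopCost 4 (λ _ → 34) (suc u) * 1 ≡⟨ ℕₚ.*-identityʳ _ ⟩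
      loopCost 4 (λ _ → 34) (suc u) ≡⟨ loopCost-const 4 34 (suc u) ⟩
      42 + u * 38 ≤⟨ ℕₚ.+-monoˡ-≤ (u * 38) (ℕₚ.*-mono-≤ 1≤u (ℕₚ.≤-refl {42})) ⟩
      u * 42 + u * 38 ≡⟨ ≡.sym (ℕₚ.*-distribˡ-+ u 42 38) ⟩
      u * 80 ≤⟨ ℕₚ.*-monoʳ-≤ u (ℕₚ.m≤n+m 80 4) ⟩
      u * 84 ≡⟨ ℕₚ.*-comm u 84 ⟩
      84 * u ∎
      where open ℕₚ.≤-Reasoning

  -- Matches are played from the last to the first, so both participants are already settled when a
  -- match is played, and later matches stay untouched.
  build-exec : ∀ u → 1 ≤ u → 1 ≤ R → ∀ σ → nats σ Rᵛ 0 ≡ R → Leaves (nats σ winnerᵃ) →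
    Exec u build σ (R * 50) (λ τ → OnlyWinners σ τ × Tree (nats τ winnerᵃ) (lens σ keyᵃ))
  build-exec u 1≤u 1≤R σ R≡ leaves = weaken (linear-cost {b = 4} {6} 1≤R (ℕₚ.m∸n≤m R 1) (ℕₚ.≤ᵇ⇒≤ _ _ _)) (sequence (assignᴺ (consequence finish (iterate I (λ _ → 34) body (R ∸ 1) _ start))))
    where
    open Rules u 1≤u
    I : ℕ → Store → Set _
    I f τ = OnlyWinners σ τ × nats τ iᵛ 0 ≡ f × f < R × Leaves (nats τ winnerᵃ)
          × (∀ i → f < i → i < R → Winner (nats τ winnerᵃ) i × Best (nats τ winnerᵃ) (lens σ keyᵃ) i)
    start : I (R ∸ 1) (store (update (nats σ) iᵛ 0 (nats σ Rᵛ 0 ∸ 1)) (lens σ))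
    start = record { same-lens = refl ; same-nats = λ x i _ ≢i → update-other (nats σ) iᵛ 0 _ i ≢i }
          , cong (_∸ 1) R≡ , ℕₚ.≤-reflexive (ℕₚ.m+[n∸m]≡n 1≤R) , leaves
          , λ i R∸1<i i<R → ⊥-elim (ℕₚ.<⇒≱ i<R (ℕₚ.≤-trans (ℕₚ.≤-reflexive (≡.sym (ℕₚ.m+[n∸m]≡n 1≤R))) R∸1<i))
    body : ∀ f ρ → I f ρ → Holds (lit 1 ≤ᴺ var iᵛ) ρ → ∃[ f′ ] f ≡ suc f′ × Exec u (play ⨾ iᵛ ≔ var iᵛ ⊖ lit 1) ρ 34 (I f′)
    body zero ρ (_ , i≡0 , _) (Level.lift 1≤i) = ⊥-elim (ℕₚ.<⇒≢ 1≤i (≡.sym i≡0))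
    body (suc f) ρ (frame , i≡ , f<R , leaves , done) (Level.lift 1≤i) = f , refl , sequence (consequence after (play-exec u 1≤u ρ))
      where
      after : ∀ {τ} → Played (nats ρ iᵛ 0) ρ τ → Exec u (iᵛ ≔ var iᵛ ⊖ lit 1) τ 6 (I f)
      after {τ} played₀ = assignᴺ
        ( record { same-lens = same-lens ; same-nats = λ x i ≢w ≢i → ≡.trans (update-other (nats τ) iᵛ 0 _ i ≢i) (same-nats x i ≢w ≢i) }
        , cong (_∸ 1) (≡.trans (Played.same-i played₀) i≡) , ℕₚ.<-trans (ℕₚ.n<1+n f) f<R , played-leaves played f<R leaves , won )
        where
        open OnlyWinners (OnlyWinners-trans frame (Played.frame played₀))
        played : Played (suc f) ρ τ
        played = subst (λ k → Played k ρ τ) i≡ played₀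
        K≡ = OnlyWinners.same-lens frame
        won : ∀ i → f < i → i < R → Winner (nats τ winnerᵃ) i × Best (nats τ winnerᵃ) (lens σ keyᵃ) i
        won i f<i i<R with i ℕₚ.≟ suc f
        ... | yes refl = played-winner leaves played (s≤s z≤n) i<R (λ i′ lt <R → proj₁ (done i′ lt <R))
                       , subst (λ l → Best (nats τ winnerᵃ) (l keyᵃ) i) K≡ (played-best-self played (s≤s z≤n))
        ... | no ≢f = winner′
                    , subst (λ l → Best (nats τ winnerᵃ) (l keyᵃ) i) K≡
                        (played-best-off played ≢f (λ e → ℕₚ.<⇒≱ (DivMod.m/n<m (suc f) 2 (s≤s (s≤s z≤n))) (ℕₚ.≤-trans f<i (ℕₚ.≤-reflexive e)))
                          (subst (λ l → Best (nats ρ winnerᵃ) (l keyᵃ) i) (≡.sym K≡) (proj₂ old)))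
          where
          old = done i (ℕₚ.≤∧≢⇒< f<i (λ e → ≢f (≡.sym e))) i<R
          winner′ : Winner (nats τ winnerᵃ) i
          winner′ rewrite Played.off played i ≢f = proj₁ old
    finish : ∀ {τ} → (∃[ f ] I f τ × ¬ Holds (lit 1 ≤ᴺ var iᵛ) τ) → OnlyWinners σ τ × Tree (nats τ winnerᵃ) (lens σ keyᵃ)
    finish {τ} (f , (frame , i≡f , _ , leaves , won) , done) = frame , record
      { leaves = leaves ; winner = λ i 1≤i i<R → proj₁ (won i (f<i 1≤i) i<R) ; best = λ i 1≤i i<R → proj₂ (won i (f<i 1≤i) i<R) }
      where
      f<i : ∀ {i} → 1 ≤ i → f < i
      f<i 1≤i = ℕₚ.<-≤-trans (subst (_< 1) i≡f (ℕₚ.≰⇒> (λ le → done (Level.lift le)))) 1≤i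

-- Enumeration of the shallowest nodes.

parentᵃ letterᵃ flagᵃ : ℕ
parentᵃ = 2
letterᵃ = 3
flagᵃ   = 4

clear : Program
clear = jᵛ ≔ lit 0 ⨾ while lit 1 ⊕ var jᵛ ≤ᴺ var Rᵛ loop
  ( storeᴺ countᵃ (var jᵛ) (lit 0)
  -- The key 1 serves as infinity in the search, whose other keys are negated depths; the
  -- enumeration replaces it in `refill`.
  ⨾ storeᴸ keyᵃ (var jᵛ) (nat (lit 1))
  ⨾ storeᴺ winnerᵃ (var Rᵛ ⊕ var jᵛ) (var jᵛ)
  ⨾ jᵛ ≔ lit 1 ⊕ var jᵛ )

tally : Program
tally = jᵛ ≔ lit 0 ⨾ while lit 1 ⊕ var jᵛ ≤ᴺ var tᵛ loop
  ( storeᴺ countᵃ (load letterᵃ (var jᵛ)) (lit 1 ⊕ load countᵃ (load letterᵃ (var jᵛ)))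
  ⨾ jᵛ ≔ lit 1 ⊕ var jᵛ )

-- A letter whose next parent would be node `L` has no child left. The key for this case exceeds by
-- one the depth of the last admissible parent plus the longest letter, and so stands for infinity.
nextKey : ℕ → Program
nextKey x = if lit 1 ⊕ load countᵃ (var x) ≤ᴺ var Lᵛ
  then storeᴸ keyᵃ (var x) (load depthᵃ (load countᵃ (var x)) ⊕ load lengthᵃ (var x))
  else storeᴸ keyᵃ (var x) (load depthᵃ (var Lᵛ ⊖ lit 1) ⊕ load lengthᵃ (var Rᵛ ⊖ lit 1) ⊕ nat (lit 1))

refill : Program
refill = jᵛ ≔ lit 0 ⨾ while lit 1 ⊕ var jᵛ ≤ᴺ var Rᵛ loop (nextKey jᵛ ⨾ jᵛ ≔ lit 1 ⊕ var jᵛ)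

newNode : Program
newNode = wᵛ ≔ load winnerᵃ (lit 1)
  ⨾ storeᴸ depthᵃ (var tᵛ) (load keyᵃ (var wᵛ))
  ⨾ storeᴺ parentᵃ (var tᵛ) (load countᵃ (var wᵛ))
  ⨾ storeᴺ letterᵃ (var tᵛ) (var wᵛ)
  -- Subtraction is truncated, so the flag is 1 exactly when t is at least L. In the first
  -- enumeration L is n and all flags written are 0; in the second L is the number of inner nodes
  -- and every new node becomes a terminal.
  ⨾ storeᴺ flagᵃ (var tᵛ) (lit 1 ⊖ (var Lᵛ ⊖ var tᵛ))
  ⨾ storeᴺ countᵃ (var wᵛ) (lit 1 ⊕ load countᵃ (var wᵛ))

pop : Program
pop = newNode ⨾ nextKey wᵛ ⨾ iᵛ ≔ (var Rᵛ ⊕ var wᵛ) ⊘ lit 2 ⨾ mend ⨾ tᵛ ≔ lit 1 ⊕ var tᵛ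

enumerate : Program
enumerate = clear ⨾ tally ⨾ refill ⨾ build ⨾ while lit 1 ⊕ var tᵛ ≤ᴺ var Nᵛ loop pop

-- Boolean membership makes the side conditions on concrete array names compute to the unit type, so
-- that `_` fills them in.
elem : ℕ → List ℕ → Bool
elem x []       = false
elem x (y ∷ ys) = (x ≡ᵇ y) ∨ elem x ys

elem-≢ : ∀ {x y} ys → T (not (elem x ys)) → T (elem y ys) → x ≢ y
elem-≢ {x} ys out in′ refl with elem x ys
elem-≢ ys () in′ refl | true
elem-≢ ys out () refl | false

module Frames {a ℓ₁ ℓ₂} (F : OrderedField a ℓ₁ ℓ₂) where
  open OrderedFieldLemmas F
  open Execution F

  record Frame (xs ys : List ℕ) (σ τ : Store) : Set a where
    field
      same-nats : ∀ x i → T (not (elem x xs)) → nats τ x i ≡ nats σ x i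
      same-lens : ∀ y i → T (not (elem y ys)) → lens τ y i ≡ lens σ y i
  open Frame public

  frame-refl : ∀ {xs ys σ} → Frame xs ys σ σ
  frame-refl = record { same-nats = λ _ _ _ → refl ; same-lens = λ _ _ _ → refl }

  frame-trans : ∀ {xs ys ρ σ τ} → Frame xs ys ρ σ → Frame xs ys σ τ → Frame xs ys ρ τ
  frame-trans p q = record
    { same-nats = λ x i out → ≡.trans (same-nats q x i out) (same-nats p x i out)
    ; same-lens = λ y i out → ≡.trans (same-lens q y i out) (same-lens p y i out) }

  subset : List ℕ → List ℕ → Bool
  subset []       ys = true
  subset (x ∷ xs) ys = elem x ys ∧ subset xs ys

  outside-subset : ∀ xs ys x → T (subset xs ys) → T (not (elem x ys)) → T (not (elem x xs))
  outside-subset [] ys x sub out = tt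
  outside-subset (z ∷ xs) ys x sub out with elem z ys in z∈
  ... | true with x ≡ᵇ z in x≡z
  ...   | false = outside-subset xs ys x sub out
  ...   | true = elem-≢ ys out (subst T (≡.sym z∈) tt) (ℕₚ.≡ᵇ⇒≡ x z (subst T (≡.sym x≡z) tt))

  frame-weaken : ∀ {xs xs′ ys ys′ σ τ} → T (subset xs xs′) → T (subset ys ys′) → Frame xs ys σ τ → Frame xs′ ys′ σ τ
  frame-weaken {xs} {xs′} {ys} {ys′} sub sub′ fr = record
    { same-nats = λ x i out → same-nats fr x i (outside-subset xs xs′ x sub out)
    ; same-lens = λ y i out → same-lens fr y i (outside-subset ys ys′ y sub′ out) }

  frame-updateᴺ : ∀ {xs ys σ τ} x i v → T (elem x xs) → Frame xs ys σ τ → Frame xs ys σ (store (update (nats τ) x i v) (lens τ))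
  frame-updateᴺ {xs} {τ = τ} x i v x∈ fr = record
    { same-nats = λ x′ i′ out → ≡.trans (update-other (nats τ) x i v i′ (elem-≢ xs out x∈)) (same-nats fr x′ i′ out)
    ; same-lens = same-lens fr }

  frame-updateᴸ : ∀ {xs ys σ τ} y i v → T (elem y ys) → Frame xs ys σ τ → Frame xs ys σ (store (nats τ) (update (lens τ) y i v))
  frame-updateᴸ {ys = ys} {τ = τ} y i v y∈ fr = record
    { same-nats = same-nats fr
    ; same-lens = λ y′ i′ out → ≡.trans (update-other (lens τ) y i v i′ (elem-≢ ys out y∈)) (same-lens fr y′ i′ out) }

  frame-winners : ∀ {R σ τ} → Tournament.OnlyWinners F R σ τ → Frame (winnerᵃ ∷ iᵛ ∷ []) [] σ τ
  frame-winners {R} ow = record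
    { same-nats = λ x i out → OnlyWinners.same-nats ow x i (elem-≢ (winnerᵃ ∷ iᵛ ∷ []) out tt) (elem-≢ (winnerᵃ ∷ iᵛ ∷ []) out tt)
    ; same-lens = λ y i _ → cong (λ l → l y i) (OnlyWinners.same-lens ow) }
    where open Tournament F R

module Enumerate {a ℓ₁ ℓ₂} (F : OrderedField a ℓ₁ ℓ₂) {r : ℕ} (R : ℕ) (R≤r : R ≤ r) (0<r : 0 < r)
  (c : Fin r → OrderedField.Carrier F) (ĉ : ℕ → OrderedField.Carrier F) (ĉ-toℕ : ∀ i → ĉ (toℕ i) ≡ c i)
  (ĉ-nonNeg : ∀ {j} → j < r → OrderedField._≤_ F (OrderedField.0# F) (ĉ j))
  (ĉ-sorted : ∀ {i j} → i ≤ j → j < r → OrderedField._≤_ F (ĉ i) (ĉ j))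
  (n u : ℕ) (1≤R : 1 ≤ R) (1≤u : 1 ≤ u) (R≤2^1+u : R ≤ 2 ^ suc u) where
  open OrderedFieldLemmas F
  open Enumeration F R R≤r 0<r c ĉ ĉ-toℕ ĉ-nonNeg ĉ-sorted
  open Execution F
  open Rules u 1≤u
  open Frames F
  open Tournament F R

  good-cong : ∀ {L t ℓ ℓ′ E E′} → 1 ≤ t → Good L t ℓ E → (∀ s → s < t → ℓ′ s ≡ ℓ s) → (∀ s → s < t → E′ s ≡ E s) → Good L t ℓ′ E′
  good-cong {L} {t} {ℓ} {ℓ′} {E} {E′} 1≤t good ℓ≡ E≡ = record
    { letter-root = ≡.trans (ℓ≡ 0 1≤t) letter-root
    ; E-root = ≡.trans (E≡ 0 1≤t) E-root
    ; letter<R = λ s 1≤s s<t → subst (_< R) (≡.sym (ℓ≡ s s<t)) (letter<R s 1≤s s<t)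
    ; row<L = λ s 1≤s s<t → subst (_< L) (≡.sym (self s s<t)) (row<L s 1≤s s<t)
    ; E-child = λ s 1≤s s<t → ≡.trans (E≡ s s<t) (≡.trans (E-child s 1≤s s<t)
        (≡.sym (≡.cong₂ _⊞_ (≡.trans (cong E′ (self s s<t)) (E≡ _ (ℕₚ.<-trans (parent<self s 1≤s s<t) s<t))) (cong ĉ (ℓ≡ s s<t)))))
    ; least = λ s 1≤s s<t j j<R cnt<L → ≡.subst₂ _≼_ (≡.sym (E≡ s s<t))
        (cong (_⊞ ĉ j) (≡.sym (≡.trans (cong E′ (cnt j s s<t)) (E≡ _ (ℕₚ.<-trans (count<self j s j<R 1≤s) s<t)))))
        (least s 1≤s s<t j j<R (subst (_< L) (cnt j s s<t) cnt<L)) }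
    where
    open Good good
    open GoodLemmas good
    cnt : ∀ j s → s < t → count ℓ′ j s ≡ count ℓ j s
    cnt j s s<t = count-cong j s (λ s′ s′<s → ℓ≡ s′ (ℕₚ.<-trans s′<s s<t))
    self : ∀ s → s < t → count ℓ′ (ℓ′ s) s ≡ count ℓ (ℓ s) s
    self s s<t = ≡.trans (cong (λ j → count ℓ′ j s) (ℓ≡ s s<t)) (cnt (ℓ s) s s<t)

  good-snoc : ∀ {L t ℓ E} → Good L t ℓ E → ℓ t < R → count ℓ (ℓ t) t < L → E t ≡ E (count ℓ (ℓ t) t) ⊞ ĉ (ℓ t) →
    (∀ j → j < R → count ℓ j t < L → E t ≼ E (count ℓ j t) ⊞ ĉ j) → Good L (suc t) ℓ E
  good-snoc {L} {t} {ℓ} {E} good ℓt<R par<L Et le = record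
    { letter-root = letter-root ; E-root = E-root
    ; letter<R = λ s 1≤s s≤t → last (λ s → ℓ s < R) (letter<R s 1≤s) ℓt<R s≤t
    ; row<L = λ s 1≤s s≤t → last (λ s → count ℓ (ℓ s) s < L) (row<L s 1≤s) par<L s≤t
    ; E-child = λ s 1≤s s≤t → last (λ s → E s ≡ E (count ℓ (ℓ s) s) ⊞ ĉ (ℓ s)) (E-child s 1≤s) Et s≤t
    ; least = λ s 1≤s s≤t → last (λ s → ∀ j → j < R → count ℓ j s < L → E s ≼ E (count ℓ j s) ⊞ ĉ j) (least s 1≤s) le s≤t }
    where
    open Good good
    last : ∀ {p} (P : ℕ → Set p) {s} → (s < t → P s) → P t → s < suc t → P s
    last P {s} before now s≤t with s ℕₚ.≟ t
    ... | yes refl = now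
    ... | no s≢t = before (below s≤t s≢t)

  -- Parents precede their children, so the first `m` nodes have all their parents below `m`. This
  -- allows the second enumeration to resume from an initial part of the first under a smaller bound
  -- on the parents.
  good-restrict : ∀ {t m ℓ E} → m ≤ t → Good t t ℓ E → Good m m ℓ E
  good-restrict m≤t good = record
    { letter-root = letter-root ; E-root = E-root
    ; letter<R = λ s 1≤s s<m → letter<R s 1≤s (ℕₚ.<-≤-trans s<m m≤t)
    ; row<L = λ s 1≤s s<m → ℕₚ.<-trans (parent<self s 1≤s (ℕₚ.<-≤-trans s<m m≤t)) s<m
    ; E-child = λ s 1≤s s<m → E-child s 1≤s (ℕₚ.<-≤-trans s<m m≤t)
    ; least = λ s 1≤s s<m j j<R cnt<m → least s 1≤s (ℕₚ.<-≤-trans s<m m≤t) j j<R (ℕₚ.<-≤-trans cnt<m m≤t) }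
    where
    open Good good
    open GoodLemmas good

  record Env (σ : Store) : Set a where
    field
      n≡ : nats σ 0 0 ≡ n
      R≡ : nats σ Rᵛ 0 ≡ R
      c≡ : ∀ j → lens σ lengthᵃ j ≡ ĉ j
  open Env public

  frame-env : ∀ {xs ys σ τ} → T (not (elem 0 xs)) → T (not (elem Rᵛ xs)) → T (not (elem 0 ys)) → Frame xs ys σ τ → Env σ → Env τ
  frame-env p q o fr env = record
    { n≡ = ≡.trans (same-nats fr 0 0 p) (n≡ env)
    ; R≡ = ≡.trans (same-nats fr Rᵛ 0 q) (R≡ env)
    ; c≡ = λ j → ≡.trans (same-lens fr 0 j o) (c≡ env j) }

  record Cleared (σ τ : Store) : Set a where
    field
      frame  : Frame (winnerᵃ ∷ countᵃ ∷ jᵛ ∷ []) (keyᵃ ∷ []) σ τ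
      zeroes : ∀ j → j < R → nats τ countᵃ j ≡ 0
      ones   : ∀ j → j < R → lens τ keyᵃ j ≡ fromℕ 1
      leaves : Leaves (nats τ winnerᵃ)

  private
    upto : ∀ {p} (P : ℕ → Set p) j k {i} → k ≡ j → i < suc j → (∀ i → i < j → i ≢ k → P i) → P k → P i
    upto P j k {i} k≡j i≤j before now with i ℕₚ.≟ k
    ... | yes refl = now
    ... | no i≢k = before i (below i≤j (λ e → i≢k (≡.trans e (≡.sym k≡j)))) i≢k

  clear-exec : ∀ σ → Env σ → Exec u clear σ (R * 50) (Cleared σ)
  clear-exec σ env = weaken (linear-cost {b = 7} {3} 1≤R ℕₚ.≤-refl (ℕₚ.≤ᵇ⇒≤ _ _ _)) (sequence (assignᴺ (consequence finish
      (count-up jᵛ (var Rᵛ) J R 25 (λ inv → J.j≡ inv) Rρ (λ j ρ _ → step j ρ) 0 R refl _ start))))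
    where
    record J (j : ℕ) (τ : Store) : Set a where
      field
        j≡     : nats τ jᵛ 0 ≡ j
        frame  : Frame (winnerᵃ ∷ countᵃ ∷ jᵛ ∷ []) (keyᵃ ∷ []) σ τ
        zeroes : ∀ i → i < j → nats τ countᵃ i ≡ 0
        ones   : ∀ i → i < j → lens τ keyᵃ i ≡ fromℕ 1
        leaves : ∀ i → i < j → nats τ winnerᵃ (R + i) ≡ i
    start : J 0 (store (update (nats σ) jᵛ 0 0) (lens σ))
    start = record { j≡ = refl ; frame = frame-updateᴺ jᵛ 0 0 _ frame-refl ; zeroes = λ _ () ; ones = λ _ () ; leaves = λ _ () }
    Rρ : ∀ {j ρ} → J j ρ → nats ρ Rᵛ 0 ≡ R
    Rρ inv = ≡.trans (same-nats (J.frame inv) Rᵛ 0 _) (R≡ env)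
    step : ∀ j ρ → J j ρ → Exec u _ ρ 25 (J (suc j))
    step j ρ inv = weaken (ℕₚ.≤ᵇ⇒≤ _ _ _) (sequence (assignᴺ (sequence (assignᴸ (sequence (assignᴺ (assignᴺ (record
        { j≡ = cong suc j≡
        ; frame = frame-updateᴺ jᵛ 0 _ _ (frame-updateᴺ winnerᵃ _ _ _ (frame-updateᴸ keyᵃ _ _ _ (frame-updateᴺ countᵃ _ _ _ frame)))
        ; zeroes = λ i i≤j → upto (λ i → nats′ countᵃ i ≡ 0) j k j≡ i≤j
            (λ i i<j i≢k → ≡.trans (update-off (nats ρ) countᵃ k 0 i≢k) (zeroes i i<j)) (update-at (nats ρ) countᵃ k 0)
        ; ones = λ i i≤j → upto (λ i → update (lens ρ) keyᵃ k (fromℕ 1) keyᵃ i ≡ fromℕ 1) j k j≡ i≤j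
            (λ i i<j i≢k → ≡.trans (update-off (lens ρ) keyᵃ k _ i≢k) (ones i i<j)) (update-at (lens ρ) keyᵃ k _)
        ; leaves = λ i i≤j → upto (λ i → update nats′ winnerᵃ (nats ρ Rᵛ 0 + k) k winnerᵃ (R + i) ≡ i) j k j≡ i≤j
            (λ i i<j i≢k → ≡.trans (update-off nats′ winnerᵃ _ k (λ e → i≢k (ℕₚ.+-cancelˡ-≡ R _ _ (≡.trans e (cong (_+ k) (Rρ inv)))))) (leaves i i<j))
            (≡.trans (cong (λ z → update nats′ winnerᵃ (z + k) k winnerᵃ (R + k)) (Rρ inv)) (update-at nats′ winnerᵃ (R + k) k)) }))))))))
      where
      open J inv
      k = nats ρ jᵛ 0
      nats′ = update (nats ρ) countᵃ k 0
    finish : ∀ {τ} → J R τ → Cleared σ τ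
    finish inv = record { frame = frame ; zeroes = zeroes ; ones = ones ; leaves = leaves }
      where open J inv

  NextKey : ℕ → (ℕ → ℕ) → (ℕ → Carrier) → (ℕ → Carrier) → ℕ → Set a
  NextKey L cnt E K j = (cnt j < L → K j ≡ E (cnt j) ⊞ ĉ j) × (L ≤ cnt j → K j ≡ E (L ∸ 1) ⊞ ĉ (R ∸ 1) ⊞ fromℕ 1)

  record Keyed (L j : ℕ) (σ τ : Store) : Set a where
    field
      same-ns : nats τ ≡ nats σ
      frame   : Frame [] (keyᵃ ∷ []) σ τ
      key-off : ∀ i → i ≢ j → lens τ keyᵃ i ≡ lens σ keyᵃ i
      key-at  : NextKey L (nats σ countᵃ) (lens σ depthᵃ) (lens τ keyᵃ) j

  nextKey-exec : ∀ x L σ → Env σ → nats σ Lᵛ 0 ≡ L → Exec u (nextKey x) σ 30 (Keyed L (nats σ x 0) σ)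
  nextKey-exec x L σ env L≡ = weaken (ℕₚ.≤ᵇ⇒≤ _ _ _) (branch
      (λ (Level.lift <L) → assignᴸ (record
        { same-ns = refl ; frame = frame-updateᴸ keyᵃ _ _ _ frame-refl ; key-off = λ i i≢j → update-off (lens σ) keyᵃ j _ i≢j
        ; key-at = (λ _ → ≡.trans (update-at (lens σ) keyᵃ j _) (cong (lens σ depthᵃ (nats σ countᵃ j) ⊞_) (c≡ env j)))
                 , (λ L≤ → ⊥-elim (ℕₚ.<⇒≱ (subst (nats σ countᵃ j <_) L≡ <L) L≤)) }))
      (λ ≮L → assignᴸ (record
        { same-ns = refl ; frame = frame-updateᴸ keyᵃ _ _ _ frame-refl ; key-off = λ i i≢j → update-off (lens σ) keyᵃ j _ i≢j
        ; key-at = (λ <L → ⊥-elim (≮L (Level.lift (subst (nats σ countᵃ j <_) (≡.sym L≡) <L))))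
                 , (λ _ → ≡.trans (update-at (lens σ) keyᵃ j _) (cong (_⊞ fromℕ 1) (≡.cong₂ _⊞_ (cong (λ k → lens σ depthᵃ (k ∸ 1)) L≡)
                      (≡.trans (cong (λ k → lens σ 0 (k ∸ 1)) (R≡ env)) (c≡ env (R ∸ 1)))))) })))
    where j = nats σ x 0

  refill-exec : ∀ L σ → Env σ → nats σ Lᵛ 0 ≡ L → Exec u refill σ (R * 60)
    (λ τ → Frame (jᵛ ∷ []) (keyᵃ ∷ []) σ τ × (∀ j → j < R → NextKey L (nats σ countᵃ) (lens σ depthᵃ) (lens τ keyᵃ) j))
  refill-exec L σ env L≡ = weaken (linear-cost {b = 7} {3} 1≤R ℕₚ.≤-refl (ℕₚ.≤ᵇ⇒≤ _ _ _)) (sequence (assignᴺ (consequence (λ inv → J.frame inv , J.keys inv)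
      (count-up jᵛ (var Rᵛ) J R 36 (λ inv → J.j≡ inv) (λ inv → R≡ (J.env′ inv)) (λ j ρ _ → step j ρ) 0 R refl _
        (record { j≡ = refl ; frame = frame-updateᴺ jᵛ 0 0 _ frame-refl ; keys = λ _ () })))))
    where
    record J (j : ℕ) (τ : Store) : Set a where
      field
        j≡    : nats τ jᵛ 0 ≡ j
        frame : Frame (jᵛ ∷ []) (keyᵃ ∷ []) σ τ
        keys  : ∀ i → i < j → NextKey L (nats σ countᵃ) (lens σ depthᵃ) (lens τ keyᵃ) i
      env′ : Env τ
      env′ = frame-env _ _ _ frame env
    step : ∀ j ρ → J j ρ → Exec u _ ρ 36 (J (suc j))
    step j ρ inv = sequence (consequence after (nextKey-exec jᵛ L ρ env′ (≡.trans (same-nats frame Lᵛ 0 _) L≡)))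
      where
      open J inv
      k = nats ρ jᵛ 0
      after : ∀ {τ} → Keyed L k ρ τ → Exec u (jᵛ ≔ lit 1 ⊕ var jᵛ) τ 6 (J (suc j))
      after {τ} record { same-ns = refl ; frame = fr ; key-off = key-off ; key-at = key-at } = assignᴺ (record
        { j≡ = cong suc j≡
        ; frame = frame-updateᴺ jᵛ 0 _ _ (frame-trans frame (frame-weaken _ _ fr))
        ; keys = λ i i≤j → upto (NextKey L (nats σ countᵃ) (lens σ depthᵃ) (lens τ keyᵃ)) j k j≡ i≤j
            (λ i i<j i≢k → (λ lt → ≡.trans (key-off i i≢k) (proj₁ (keys i i<j) lt)) , (λ le → ≡.trans (key-off i i≢k) (proj₂ (keys i i<j) le)))
            ( (λ lt → ≡.trans (proj₁ key-at (subst (_< L) (≡.sym cnt≡) lt)) (cong (_⊞ ĉ k) (≡.trans (cong (lens ρ depthᵃ) cnt≡) (depth≡ _))))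
            , (λ le → ≡.trans (proj₂ key-at (subst (L ≤_) (≡.sym cnt≡) le)) (cong (λ e → e ⊞ ĉ (R ∸ 1) ⊞ fromℕ 1) (depth≡ _)))) })
        where
        cnt≡ : nats ρ countᵃ k ≡ nats σ countᵃ k
        cnt≡ = same-nats frame countᵃ k _
        depth≡ : ∀ s → lens ρ depthᵃ s ≡ lens σ depthᵃ s
        depth≡ s = same-lens frame depthᵃ s _

  tally-exec : ∀ t σ → 1 ≤ t → nats σ tᵛ 0 ≡ t → (∀ j → j < R → nats σ countᵃ j ≡ 0) → Exec u tally σ (t * 50)
    (λ τ → Frame (countᵃ ∷ jᵛ ∷ []) [] σ τ × (∀ j → j < R → nats τ countᵃ j ≡ count (nats σ letterᵃ) j t))
  tally-exec t σ 1≤t t≡ zeroes = weaken (linear-cost {b = 7} {3} 1≤t ℕₚ.≤-refl (ℕₚ.≤ᵇ⇒≤ _ _ _)) (sequence (assignᴺ (consequence (λ inv → J.frame inv , J.counts inv)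
      (count-up jᵛ (var tᵛ) J t 25 (λ inv → J.s≡ inv) (λ inv → ≡.trans (same-nats (J.frame inv) tᵛ 0 _) t≡) (λ s ρ _ → step s ρ) 0 t refl _
        (record { s≡ = refl ; frame = frame-updateᴺ jᵛ 0 0 _ frame-refl ; counts = zeroes })))))
    where
    ℓ = nats σ letterᵃ
    record J (s : ℕ) (τ : Store) : Set a where
      field
        s≡     : nats τ jᵛ 0 ≡ s
        frame  : Frame (countᵃ ∷ jᵛ ∷ []) [] σ τ
        counts : ∀ j → j < R → nats τ countᵃ j ≡ count ℓ j s
    step : ∀ s ρ → J s ρ → Exec u _ ρ 25 (J (suc s))
    step s ρ inv = weaken (ℕₚ.≤ᵇ⇒≤ _ _ _) (sequence (assignᴺ (assignᴺ (record
        { s≡ = cong suc s≡ ; frame = frame-updateᴺ jᵛ 0 _ _ (frame-updateᴺ countᵃ _ _ _ frame) ; counts = counts′ }))))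
      where
      open J inv
      x = nats ρ letterᵃ (nats ρ jᵛ 0)
      x≡ : x ≡ ℓ s
      x≡ = ≡.trans (same-nats frame letterᵃ _ _) (cong ℓ s≡)
      counts′ : ∀ j → j < R → update (nats ρ) countᵃ x (suc (nats ρ countᵃ x)) countᵃ j ≡ count ℓ j (suc s)
      counts′ j j<R with j ℕₚ.≟ x
      ... | yes refl = ≡.trans (cong suc (counts x j<R)) (≡.sym (count-hit ℓ s (≡.sym x≡)))
      ... | no j≢x = ≡.trans (counts j j<R) (≡.sym (count-miss ℓ s (λ e → j≢x (≡.trans (≡.sym e) (≡.sym x≡)))))

  record NewNode (t w : ℕ) (σ τ : Store) : Set a where
    field
      frame      : Frame (parentᵃ ∷ letterᵃ ∷ flagᵃ ∷ countᵃ ∷ wᵛ ∷ []) (depthᵃ ∷ []) σ τ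
      w≡         : nats τ wᵛ 0 ≡ w
      depth-at   : lens τ depthᵃ t ≡ lens σ keyᵃ w
      depth-off  : ∀ s → s ≢ t → lens τ depthᵃ s ≡ lens σ depthᵃ s
      parent-at  : nats τ parentᵃ t ≡ nats σ countᵃ w
      parent-off : ∀ s → s ≢ t → nats τ parentᵃ s ≡ nats σ parentᵃ s
      letter-at  : nats τ letterᵃ t ≡ w
      letter-off : ∀ s → s ≢ t → nats τ letterᵃ s ≡ nats σ letterᵃ s
      flag-at    : nats τ flagᵃ t ≡ 1 ∸ (nats σ Lᵛ 0 ∸ t)
      flag-off   : ∀ s → s ≢ t → nats τ flagᵃ s ≡ nats σ flagᵃ s
      count-at   : nats τ countᵃ w ≡ suc (nats σ countᵃ w)
      count-off  : ∀ j → j ≢ w → nats τ countᵃ j ≡ nats σ countᵃ j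

  newNode-exec : ∀ σ → Exec u newNode σ 60 (NewNode (nats σ tᵛ 0) (nats σ winnerᵃ 1) σ)
  newNode-exec σ = weaken (ℕₚ.≤ᵇ⇒≤ _ _ _)
    (sequence (assignᴺ (sequence (assignᴸ (sequence (assignᴺ (sequence (assignᴺ (sequence (assignᴺ (assignᴺ (record
      { frame = frame-updateᴺ countᵃ _ _ _ (frame-updateᴺ flagᵃ _ _ _ (frame-updateᴺ letterᵃ _ _ _ (frame-updateᴺ parentᵃ _ _ _
                  (frame-updateᴸ depthᵃ _ _ _ (frame-updateᴺ wᵛ _ _ _ frame-refl)))))
      ; w≡ = refl
      ; depth-at = update-at _ depthᵃ t _
      ; depth-off = λ s s≢t → update-off _ depthᵃ t _ s≢t
      ; parent-at = update-at _ parentᵃ t _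
      ; parent-off = λ s s≢t → update-off _ parentᵃ t _ s≢t
      ; letter-at = update-at _ letterᵃ t _
      ; letter-off = λ s s≢t → update-off _ letterᵃ t _ s≢t
      ; flag-at = update-at _ flagᵃ t _
      ; flag-off = λ s s≢t → update-off _ flagᵃ t _ s≢t
      ; count-at = update-at _ countᵃ w _
      ; count-off = λ j j≢w → update-off _ countᵃ w _ j≢w
      }))))))))))))
    where
    t = nats σ tᵛ 0
    w = nats σ winnerᵃ 1

  tree-cong : ∀ {win win′ K K′} → (∀ i → win′ i ≡ win i) → (∀ j → K′ j ≡ K j) → Tree win K → Tree win′ K′
  tree-cong {win} {win′} {K} {K′} win≡ K≡ tree = record
    { leaves = λ j j<R → ≡.trans (win≡ (R + j)) (leaves j j<R)
    ; winner = λ i 1≤i i<R → let (lt , ab) = winner i 1≤i i<R in subst (_< R) (≡.sym (win≡ i)) lt , subst (λ w → Above (R + w) i) (≡.sym (win≡ i)) ab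
    ; best = λ i 1≤i i<R → let (b₁ , b₂) = best i 1≤i i<R in ≡.subst₂ _≼_ (eq i) (eq (i * 2)) b₁ , ≡.subst₂ _≼_ (eq i) (eq (i * 2 + 1)) b₂ }
    where
    open Tree tree
    eq : ∀ i → K (win i) ≡ K′ (win′ i)
    eq i = ≡.sym (≡.trans (K≡ (win′ i)) (cong K (win≡ i)))

  nextKey-cong : ∀ {L} cnt cnt′ E E′ K K′ {j} → cnt′ j ≡ cnt j → (cnt j < L → E′ (cnt j) ≡ E (cnt j)) →
    (L ≤ cnt j → E′ (L ∸ 1) ≡ E (L ∸ 1)) → K′ j ≡ K j → NextKey L cnt E K j → NextKey L cnt′ E′ K′ j
  nextKey-cong {L} cnt cnt′ E E′ K K′ {j} cnt≡ E≡ E≡′ K≡ (lo , hi) =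
      (λ lt′ → let lt = subst (_< L) cnt≡ lt′ in ≡.trans K≡ (≡.trans (lo lt) (cong (_⊞ ĉ j) (≡.trans (≡.sym (E≡ lt)) (cong E′ (≡.sym cnt≡))))))
    , (λ le′ → let le = subst (L ≤_) cnt≡ le′ in ≡.trans K≡ (≡.trans (hi le) (cong (λ e → e ⊞ ĉ (R ∸ 1) ⊞ fromℕ 1) (≡.sym (E≡′ le)))))

  enumᴺ enumᴸ : List ℕ
  enumᴺ = parentᵃ ∷ letterᵃ ∷ flagᵃ ∷ winnerᵃ ∷ countᵃ ∷ tᵛ ∷ iᵛ ∷ jᵛ ∷ wᵛ ∷ []
  enumᴸ = depthᵃ ∷ keyᵃ ∷ []

  module _ (σ₀ : Store) (env₀ : Env σ₀) (t₀ L N : ℕ) (1≤t₀ : 1 ≤ t₀) (L≡ : nats σ₀ Lᵛ 0 ≡ L) (N≡ : nats σ₀ Nᵛ 0 ≡ N)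
    -- The first `L` nodes have `R * L` children along `R` letters, and the root comes in addition;
    -- so there are `N` nodes to be found.
    (N≤ : N ≤ suc (R * L)) where

    record Enumerated (t : ℕ) (σ : Store) : Set (a Level.⊔ ℓ₂) where
      field
        frame      : Frame enumᴺ enumᴸ σ₀ σ
        t₀≤t       : t₀ ≤ t
        good       : Good L t (nats σ letterᵃ) (lens σ depthᵃ)
        old-parent : ∀ s → s < t₀ → nats σ parentᵃ s ≡ nats σ₀ parentᵃ s
        old-letter : ∀ s → s < t₀ → nats σ letterᵃ s ≡ nats σ₀ letterᵃ s
        old-flag   : ∀ s → s < t₀ → nats σ flagᵃ s ≡ nats σ₀ flagᵃ s
        old-depth  : ∀ s → s < t₀ → lens σ depthᵃ s ≡ lens σ₀ depthᵃ s
        new-parent : ∀ s → t₀ ≤ s → s < t → nats σ parentᵃ s ≡ count (nats σ letterᵃ) (nats σ letterᵃ s) s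
        new-flag   : ∀ s → t₀ ≤ s → s < t → nats σ flagᵃ s ≡ 1 ∸ (L ∸ s)
      env : Env σ
      env = frame-env _ _ _ frame env₀
      1≤t : 1 ≤ t
      1≤t = ℕₚ.≤-trans 1≤t₀ t₀≤t

    record Popping (t : ℕ) (σ : Store) : Set (a Level.⊔ ℓ₂) where
      field
        enumerated : Enumerated t σ
        t≡         : nats σ tᵛ 0 ≡ t
        counts     : ∀ j → j < R → nats σ countᵃ j ≡ count (nats σ letterᵃ) j t
        keys       : ∀ j → j < R → NextKey L (nats σ countᵃ) (lens σ depthᵃ) (lens σ keyᵃ) j
        tree       : Tree (nats σ winnerᵃ) (lens σ keyᵃ)

    module Champion {t σ} (popping : Popping t σ) (t<N : t < N) where
      open Popping popping
      open Enumerated enumerated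
      open GoodLemmas good

      w = nats σ winnerᵃ 1
      E = lens σ depthᵃ
      K = lens σ keyᵃ
      cnt = nats σ countᵃ

      w<R : w < R
      w<R = champion<R tree 1≤R

      cnt<t : ∀ j → j < R → cnt j < t
      cnt<t j j<R = subst (_< t) (≡.sym (counts j j<R)) (count<self j t j<R 1≤t)

      -- Only t - 1 children have been taken, fewer than the `R * L` that exist.
      some-open : ∃[ j ] j < R × cnt j < L
      some-open = let (j , j<R , lt) = sumℕ-pigeonhole R (λ j → count (nats σ letterᵃ) j t) L (few t 1≤t ℕₚ.≤-refl t<N)
                  in j , j<R , subst (_< L) (≡.sym (counts j j<R)) lt
        where
        few : ∀ t′ → 1 ≤ t′ → t′ ≤ t → t′ < N → sumℕ R (λ j → count (nats σ letterᵃ) j t′) < R * L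
        few (suc t′) _ t′≤t t′<N = subst (_< R * L) (≡.sym (count-sum t′ t′≤t)) (ℕₚ.≤-pred (ℕₚ.<-≤-trans t′<N N≤))

      -- An exhausted letter cannot win: its key exceeds that of any letter still available.
      w-open : cnt w < L
      w-open with cnt w ℕₚ.<? L
      ... | yes lt = lt
      ... | no ≮L = ⊥-elim (x≺x+1 (E (L ∸ 1) ⊞ ĉ (R ∸ 1)) (≼-trans
              (≼-respˡ (+-congˡ (+-identityʳ 1#)) (≼-trans (≼-reflexive (≈-reflexive (≡.sym (proj₂ (keys w w<R) L≤)))) (champion tree j j<R)))
              (≼-trans (≼-reflexive (≈-reflexive (proj₁ (keys j j<R) open-j)))
                (⊞-mono (E-mono (ℕₚ.≤-pred (ℕₚ.≤-trans open-j (ℕₚ.≤-reflexive (≡.sym (ℕₚ.m+[n∸m]≡n 1≤L))))) L∸1<t)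
                        (ĉ-sorted (ℕₚ.≤-pred (ℕₚ.≤-trans j<R (ℕₚ.≤-reflexive (≡.sym (ℕₚ.m+[n∸m]≡n 1≤R))))) (ℕₚ.<-≤-trans (ℕₚ.≤-reflexive (ℕₚ.m+[n∸m]≡n 1≤R)) R≤r))))))
        where
        L≤ = ℕₚ.≮⇒≥ ≮L
        j = proj₁ some-open
        j<R = proj₁ (proj₂ some-open)
        open-j = proj₂ (proj₂ some-open)
        1≤L : 1 ≤ L
        1≤L = ℕₚ.≤-trans (s≤s z≤n) open-j
        L∸1<t : L ∸ 1 < t
        L∸1<t = ℕₚ.≤-<-trans (ℕₚ.≤-trans (ℕₚ.m∸n≤m L 1) L≤) (cnt<t w w<R)

    -- The champion is a candidate of least depth, as `good-snoc` demands of the next node. Only its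
    -- letter passes to a new parent and gets a new key, so a single path has to be mended.
    pop-exec : ∀ t σ → t < N → Popping t σ → Exec u pop σ 200 (Popping (suc t))
    pop-exec t σ t<N popping = weaken (ℕₚ.≤ᵇ⇒≤ _ _ _) (sequence (consequence after-newNode (newNode-exec σ)))
      where
      open Popping popping
      open Enumerated enumerated
      open Champion popping t<N
      after-newNode : ∀ {τ₁} → NewNode (nats σ tᵛ 0) w σ τ₁ → Exec u _ τ₁ 140 (Popping (suc t))
      after-newNode {τ₁} nn₀ = weaken (ℕₚ.≤ᵇ⇒≤ _ _ _) (sequence (consequence after-key
          (nextKey-exec wᵛ L τ₁ (frame-env _ _ _ (NewNode.frame nn₀) env) (≡.trans (same-nats (NewNode.frame nn₀) Lᵛ 0 _) (≡.trans (same-nats frame Lᵛ 0 _) L≡)))))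
        where
        nn : NewNode t w σ τ₁
        nn = subst (λ t → NewNode t w σ τ₁) t≡ nn₀
        module NN = NewNode nn
        after-key : ∀ {τ₂} → Keyed L (nats τ₁ wᵛ 0) τ₁ τ₂ → Exec u _ τ₂ 100 (Popping (suc t))
        after-key {τ₂} record { same-ns = refl ; frame = key-frame ; key-off = key-off₀ ; key-at = key-at₀ } =
            weaken (ℕₚ.≤ᵇ⇒≤ _ _ _) (sequence (assignᴺ (sequence (consequence after-mend (mend-exec u 1≤u R≤2^1+u _ mending)))))
          where
          key-off : ∀ j → j ≢ w → lens τ₂ keyᵃ j ≡ lens τ₁ keyᵃ j
          key-off j j≢w = key-off₀ j (λ e → j≢w (≡.trans e NN.w≡))
          key-at : NextKey L (nats τ₁ countᵃ) (lens τ₁ depthᵃ) (lens τ₂ keyᵃ) w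
          key-at = subst (NextKey L (nats τ₁ countᵃ) (lens τ₁ depthᵃ) (lens τ₂ keyᵃ)) NN.w≡ key-at₀
          i₀≡ : (nats τ₁ Rᵛ 0 + nats τ₁ wᵛ 0) / 2 ≡ (R + w) / 2
          i₀≡ = ≡.cong₂ (λ x y → (x + y) / 2) (≡.trans (same-nats NN.frame Rᵛ 0 _) (R≡ env)) NN.w≡
          mending : Mending ((nats τ₁ Rᵛ 0 + nats τ₁ wᵛ 0) / 2) (nats τ₁ winnerᵃ) (lens τ₂ keyᵃ)
          mending = subst (λ i → Mending i (nats τ₁ winnerᵃ) (lens τ₂ keyᵃ)) (≡.sym i₀≡)
            (mending-start w w<R (tree-cong (λ i → same-nats NN.frame winnerᵃ i _) (λ j → same-lens NN.frame keyᵃ j _) tree) (λ j _ j≢w → key-off j j≢w))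
          τ₃ = store (update (nats τ₁) iᵛ 0 ((nats τ₁ Rᵛ 0 + nats τ₁ wᵛ 0) / 2)) (lens τ₂)
          after-mend : ∀ {τ₄} → OnlyWinners τ₃ τ₄ × Tree (nats τ₄ winnerᵃ) (lens τ₂ keyᵃ) → Exec u (tᵛ ≔ lit 1 ⊕ var tᵛ) τ₄ 6 (Popping (suc t))
          after-mend {τ₄} (only , tree′) = assignᴺ (record
            { enumerated = record
              { frame = frame-trans frame (frame-trans (frame-weaken _ _ NN.frame) (frame-weaken _ _ φ))
              ; t₀≤t = ℕₚ.m≤n⇒m≤1+n t₀≤t
              ; good = good-snoc (good-cong 1≤t good ℓ-old E-old)
                  (subst (_< R) (≡.sym ℓ-new) w<R)
                  (subst (_< L) (≡.sym self-count) w-open)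
                  (≡.trans E-new (≡.trans (proj₁ (keys w w<R) w-open) (≡.sym (≡.cong₂ _⊞_ (≡.trans (cong E₅ self-count) (E-old _ (cnt<t w w<R))) (cong ĉ ℓ-new)))))
                  (λ j j<R cnt<L → let cj = ≡.trans (count₅ j) (≡.sym (counts j j<R)) in
                    ≡.subst₂ _≼_ (≡.sym E-new)
                      (≡.trans (proj₁ (keys j j<R) (subst (_< L) cj cnt<L)) (cong (_⊞ ĉ j) (≡.sym (≡.trans (cong E₅ cj) (E-old _ (cnt<t j j<R))))))
                      (champion tree j j<R))
              ; old-parent = λ s s<t₀ → ≡.trans (parent₅ s) (≡.trans (NN.parent-off s (<t₀⇒≢ s<t₀)) (old-parent s s<t₀))
              ; old-letter = λ s s<t₀ → ≡.trans (letter₅ s) (≡.trans (NN.letter-off s (<t₀⇒≢ s<t₀)) (old-letter s s<t₀))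
              ; old-flag = λ s s<t₀ → ≡.trans (flag₅ s) (≡.trans (NN.flag-off s (<t₀⇒≢ s<t₀)) (old-flag s s<t₀))
              ; old-depth = λ s s<t₀ → ≡.trans (E₁ s) (≡.trans (NN.depth-off s (<t₀⇒≢ s<t₀)) (old-depth s s<t₀))
              ; new-parent = λ s t₀≤s s≤t → last (λ s → nats τ₅ parentᵃ s ≡ count ℓ₅ (ℓ₅ s) s) s≤t
                  (λ s<t → ≡.trans (parent₅ s) (≡.trans (NN.parent-off s (ℕₚ.<⇒≢ s<t)) (≡.trans (new-parent s t₀≤s s<t)
                    (≡.sym (≡.trans (cong (λ j → count ℓ₅ j s) (ℓ-old s s<t)) (count-cong _ s (λ s′ s′<s → ℓ-old s′ (ℕₚ.<-trans s′<s s<t))))))))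
                  (≡.trans (parent₅ t) (≡.trans NN.parent-at (≡.sym self-count)))
              ; new-flag = λ s t₀≤s s≤t → last (λ s → nats τ₅ flagᵃ s ≡ 1 ∸ (L ∸ s)) s≤t
                  (λ s<t → ≡.trans (flag₅ s) (≡.trans (NN.flag-off s (ℕₚ.<⇒≢ s<t)) (new-flag s t₀≤s s<t)))
                  (≡.trans (flag₅ t) (≡.trans NN.flag-at (cong (λ l → 1 ∸ (l ∸ t)) (≡.trans (same-nats frame Lᵛ 0 _) L≡))))
              }
            ; t≡ = cong suc (≡.trans (same-nats (frame-winners only) tᵛ 0 _) (≡.trans (same-nats NN.frame tᵛ 0 _) t≡))
            ; counts = counts₅
            ; keys = keys₅
            ; tree = subst (λ l → Tree (nats τ₄ winnerᵃ) (l keyᵃ)) (≡.sym (OnlyWinners.same-lens only)) tree′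
            })
            where
            τ₅ = store (update (nats τ₄) tᵛ 0 (suc (nats τ₄ tᵛ 0))) (lens τ₄)
            φ : Frame (winnerᵃ ∷ tᵛ ∷ iᵛ ∷ []) (keyᵃ ∷ []) τ₁ τ₅
            φ = frame-updateᴺ tᵛ 0 _ _ (frame-trans (frame-updateᴺ iᵛ 0 _ _ (frame-weaken _ _ key-frame)) (frame-weaken _ _ (frame-winners only)))
            ℓ₅ = nats τ₅ letterᵃ
            E₅ = lens τ₅ depthᵃ
            K₅ : ∀ j → lens τ₅ keyᵃ j ≡ lens τ₂ keyᵃ j
            K₅ j = cong (λ l → l keyᵃ j) (OnlyWinners.same-lens only)
            parent₅ : ∀ s → nats τ₅ parentᵃ s ≡ nats τ₁ parentᵃ s
            parent₅ s = same-nats φ parentᵃ s _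
            flag₅ : ∀ s → nats τ₅ flagᵃ s ≡ nats τ₁ flagᵃ s
            flag₅ s = same-nats φ flagᵃ s _
            cnt₅ : ∀ j → nats τ₅ countᵃ j ≡ nats τ₁ countᵃ j
            cnt₅ j = same-nats φ countᵃ j _
            letter₅ : ∀ s → ℓ₅ s ≡ nats τ₁ letterᵃ s
            letter₅ s = same-nats φ letterᵃ s _
            E₁ : ∀ s → E₅ s ≡ lens τ₁ depthᵃ s
            E₁ s = same-lens φ depthᵃ s _
            <t₀⇒≢ : ∀ {s} → s < t₀ → s ≢ t
            <t₀⇒≢ s<t₀ = ℕₚ.<⇒≢ (ℕₚ.<-≤-trans s<t₀ t₀≤t)
            last : ∀ {p} (P : ℕ → Set p) {s} → s < suc t → (s < t → P s) → P t → P s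
            last P {s} s≤t before now with s ℕₚ.≟ t
            ... | yes refl = now
            ... | no s≢t = before (below s≤t s≢t)
            ℓ-old : ∀ s → s < t → ℓ₅ s ≡ nats σ letterᵃ s
            ℓ-old s s<t = ≡.trans (letter₅ s) (NN.letter-off s (ℕₚ.<⇒≢ s<t))
            E-old : ∀ s → s < t → E₅ s ≡ E s
            E-old s s<t = ≡.trans (E₁ s) (NN.depth-off s (ℕₚ.<⇒≢ s<t))
            ℓ-new : ℓ₅ t ≡ w
            ℓ-new = ≡.trans (letter₅ t) NN.letter-at
            E-new : E₅ t ≡ K w
            E-new = ≡.trans (E₁ t) NN.depth-at
            count₅ : ∀ j → count ℓ₅ j t ≡ count (nats σ letterᵃ) j t
            count₅ j = count-cong j t ℓ-old
            self-count : count ℓ₅ (ℓ₅ t) t ≡ cnt w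
            self-count = ≡.trans (cong (λ j → count ℓ₅ j t) ℓ-new) (≡.trans (count₅ w) (≡.sym (counts w w<R)))
            counts₅ : ∀ j → j < R → nats τ₅ countᵃ j ≡ count ℓ₅ j (suc t)
            counts₅ j j<R with j ℕₚ.≟ w
            ... | yes refl = ≡.trans (cnt₅ w) (≡.trans NN.count-at (≡.trans (cong suc (≡.trans (counts w j<R) (≡.sym (count₅ w)))) (≡.sym (count-hit ℓ₅ t ℓ-new))))
            ... | no j≢w = ≡.trans (cnt₅ j) (≡.trans (NN.count-off j j≢w) (≡.trans (≡.trans (counts j j<R) (≡.sym (count₅ j)))
                             (≡.sym (count-miss ℓ₅ t (λ e → j≢w (≡.trans (≡.sym e) ℓ-new))))))
            keys₅ : ∀ j → j < R → NextKey L (nats τ₅ countᵃ) E₅ (lens τ₅ keyᵃ) j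
            keys₅ j j<R with j ℕₚ.≟ w
            ... | yes refl = nextKey-cong (nats τ₁ countᵃ) (nats τ₅ countᵃ) (lens τ₁ depthᵃ) E₅ (lens τ₂ keyᵃ) (lens τ₅ keyᵃ) (cnt₅ j) (λ _ → E₁ _) (λ _ → E₁ _) (K₅ j) key-at
            ... | no j≢w = nextKey-cong cnt (nats τ₅ countᵃ) E E₅ K (lens τ₅ keyᵃ) (≡.trans (cnt₅ j) (NN.count-off j j≢w)) (λ _ → E-old _ (cnt<t j j<R))
                    (λ L≤ → E-old _ (ℕₚ.≤-<-trans (ℕₚ.≤-trans (ℕₚ.m∸n≤m L 1) L≤) (cnt<t j j<R)))
                    (≡.trans (K₅ j) (≡.trans (key-off j j≢w) (same-lens NN.frame keyᵃ j _))) (keys j j<R)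

    -- The counts are rebuilt from the letters of the nodes taken over, so the same program serves
    -- for starting and for resuming. Apart from the pops, the work is linear in the numbers of
    -- letters and of old nodes; together with the pops this makes at most 460 units for each of
    -- `M`.
    enumerate-exec : ∀ M → t₀ ≤ N → R ≤ M → t₀ ≤ M → N ∸ t₀ ≤ M → nats σ₀ tᵛ 0 ≡ t₀ → Good L t₀ (nats σ₀ letterᵃ) (lens σ₀ depthᵃ) →
      Exec u enumerate σ₀ (M * 500) (Enumerated N)
    enumerate-exec M t₀≤N R≤M t₀≤M N∸t₀≤M t≡ good =
      weaken cost (sequence (consequence after-clear (clear-exec σ₀ env₀)))
      where
      after-clear : ∀ {τ₁} → Cleared σ₀ τ₁ → Exec u _ τ₁ _ (Enumerated N)
      after-clear {τ₁} cleared = sequence (consequence after-tally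
          (tally-exec t₀ τ₁ 1≤t₀ (≡.trans (same-nats C.frame tᵛ 0 _) t≡) C.zeroes))
        where
        module C = Cleared cleared
        after-tally : ∀ {τ₂} → Frame (countᵃ ∷ jᵛ ∷ []) [] τ₁ τ₂ × (∀ j → j < R → nats τ₂ countᵃ j ≡ count (nats τ₁ letterᵃ) j t₀) → Exec u _ τ₂ _ (Enumerated N)
        after-tally {τ₂} (frame₂ , counts) = sequence (consequence after-refill
            (refill-exec L τ₂ (frame-env _ _ _ φ₂ env₀) (≡.trans (same-nats φ₂ Lᵛ 0 _) L≡)))
          where
          φ₂ : Frame enumᴺ enumᴸ σ₀ τ₂
          φ₂ = frame-trans (frame-weaken _ _ C.frame) (frame-weaken _ _ frame₂)
          after-refill : ∀ {τ₃} → Frame (jᵛ ∷ []) (keyᵃ ∷ []) τ₂ τ₃ × (∀ j → j < R → NextKey L (nats τ₂ countᵃ) (lens τ₂ depthᵃ) (lens τ₃ keyᵃ) j) →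
            Exec u _ τ₃ _ (Enumerated N)
          after-refill {τ₃} (frame₃ , keys) = sequence (consequence after-build
              (build-exec u 1≤u 1≤R τ₃ (R≡ (frame-env _ _ _ φ₃ env₀)) leaves₃))
            where
            φ₃ : Frame enumᴺ enumᴸ σ₀ τ₃
            φ₃ = frame-trans φ₂ (frame-weaken _ _ frame₃)
            leaves₃ : Leaves (nats τ₃ winnerᵃ)
            leaves₃ j j<R = ≡.trans (same-nats frame₃ winnerᵃ _ _) (≡.trans (same-nats frame₂ winnerᵃ _ _) (C.leaves j j<R))
            after-build : ∀ {τ₄} → OnlyWinners τ₃ τ₄ × Tree (nats τ₄ winnerᵃ) (lens τ₃ keyᵃ) → Exec u _ τ₄ (loopCost 7 (λ _ → 200) (N ∸ t₀)) (Enumerated N)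
            after-build {τ₄} (only , tree) = consequence Popping.enumerated
                (count-up tᵛ (var Nᵛ) Popping N 200 Popping.t≡ (λ p → ≡.trans (same-nats (Enumerated.frame (Popping.enumerated p)) Nᵛ 0 _) N≡)
                  pop-exec t₀ (N ∸ t₀) (ℕₚ.m+[n∸m]≡n t₀≤N) τ₄ (record
                    { enumerated = record
                      { frame = frame-trans φ₃ (frame-weaken _ _ (frame-winners only))
                      ; t₀≤t = ℕₚ.≤-refl
                      ; good = good-cong 1≤t₀ good (λ s _ → same-nats φ₄ letterᵃ s _) (λ s _ → same-lens φ₄ depthᵃ s _)
                      ; old-parent = λ s _ → same-nats φ₄ parentᵃ s _
                      ; old-letter = λ s _ → same-nats φ₄ letterᵃ s _
                      ; old-flag = λ s _ → same-nats φ₄ flagᵃ s _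
                      ; old-depth = λ s _ → same-lens φ₄ depthᵃ s _
                      ; new-parent = λ s t₀≤s s<t₀ → ⊥-elim (ℕₚ.<⇒≱ s<t₀ t₀≤s)
                      ; new-flag = λ s t₀≤s s<t₀ → ⊥-elim (ℕₚ.<⇒≱ s<t₀ t₀≤s) }
                    ; t≡ = ≡.trans (same-nats φ₄ tᵛ 0 _) t≡
                    ; counts = λ j j<R → ≡.trans (same-nats φ₂₄ countᵃ j _) (≡.trans (counts j j<R)
                        (count-cong j t₀ (λ s _ → ≡.sym (≡.trans (same-nats φ₂₄ letterᵃ s _) (same-nats frame₂ letterᵃ s _)))))
                    ; keys = λ j j<R → nextKey-cong (nats τ₂ countᵃ) (nats τ₄ countᵃ) (lens τ₂ depthᵃ) (lens τ₄ depthᵃ) (lens τ₃ keyᵃ) (lens τ₄ keyᵃ) (same-nats φ₂₄ countᵃ j _) (λ _ → same-lens φ₂₄ depthᵃ _ _) (λ _ → same-lens φ₂₄ depthᵃ _ _)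
                        (cong (λ l → l keyᵃ j) (OnlyWinners.same-lens only)) (keys j j<R)
                    ; tree = subst (λ l → Tree (nats τ₄ winnerᵃ) (l keyᵃ)) (≡.sym (OnlyWinners.same-lens only)) tree }))
              where
              φ₂₄ : Frame (winnerᵃ ∷ iᵛ ∷ jᵛ ∷ []) (keyᵃ ∷ []) τ₂ τ₄
              φ₂₄ = frame-trans (frame-weaken _ _ frame₃) (frame-weaken _ _ (frame-winners only))
              φ₄ : Frame (winnerᵃ ∷ countᵃ ∷ iᵛ ∷ jᵛ ∷ []) (keyᵃ ∷ []) σ₀ τ₄
              φ₄ = frame-trans (frame-weaken _ _ C.frame) (frame-trans (frame-weaken _ _ frame₂) (frame-weaken _ _ φ₂₄))
      1≤M : 1 ≤ M
      1≤M = ℕₚ.≤-trans 1≤R R≤M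
      cost : R * 50 + (t₀ * 50 + (R * 60 + (R * 50 + loopCost 7 (λ _ → 200) (N ∸ t₀)))) ≤ M * 500
      cost = begin
        R * 50 + (t₀ * 50 + (R * 60 + (R * 50 + loopCost 7 (λ _ → 200) (N ∸ t₀))))
          ≤⟨ ℕₚ.+-mono-≤ (ℕₚ.*-monoˡ-≤ 50 R≤M) (ℕₚ.+-mono-≤ (ℕₚ.*-monoˡ-≤ 50 t₀≤M) (ℕₚ.+-mono-≤ (ℕₚ.*-monoˡ-≤ 60 R≤M) (ℕₚ.+-mono-≤ (ℕₚ.*-monoˡ-≤ 50 R≤M)
               (linear-cost {b = 7} {0} {200} {m = M} {C = 250} 1≤M N∸t₀≤M (ℕₚ.≤ᵇ⇒≤ _ _ _))))) ⟩
        M * 50 + (M * 50 + (M * 60 + (M * 50 + M * 250))) ≡⟨ collect M ⟩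
        M * 460 ≤⟨ ℕₚ.*-monoʳ-≤ M (ℕₚ.≤ᵇ⇒≤ 460 500 _) ⟩
        M * 500 ∎
        where
        open ℕₚ.≤-Reasoning
        collect : ∀ M → M * 50 + (M * 50 + (M * 60 + (M * 50 + M * 250))) ≡ M * 460
        collect M = ≡.sym (≡.trans (ℕₚ.*-distribˡ-+ M 50 410) (cong (M * 50 +_) (≡.trans (ℕₚ.*-distribˡ-+ M 50 360) (cong (M * 50 +_)
          (≡.trans (ℕₚ.*-distribˡ-+ M 60 300) (cong (M * 60 +_) (ℕₚ.*-distribˡ-+ M 50 250)))))))

-- The search for the best number of inner nodes.

rekey : ℕ → Program
rekey x =
  (if lit 1 ≤ᴺ load countᵃ (var x)
   -- Negated depths let the minimum tournament find the deepest selected child. Along one letter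
   -- this is the child of the last parent counted, whose number is the count minus one.
   then storeᴸ keyᵃ (var x) (nat (lit 0) ⊖ (load depthᵃ (load countᵃ (var x) ⊖ lit 1) ⊕ load lengthᵃ (var x)))
   else storeᴸ keyᵃ (var x) (nat (lit 1)))
  ⨾ iᵛ ≔ (var Rᵛ ⊕ var x) ⊘ lit 2 ⨾ mend

remove : Program
remove = wᵛ ≔ load winnerᵃ (lit 1)
  ⨾ storeᴸ Sᵛ (lit 0) (load Sᵛ (lit 0) ⊕ load keyᵃ (var wᵛ))
  ⨾ storeᴺ countᵃ (var wᵛ) (load countᵃ (var wᵛ) ⊖ lit 1)
  ⨾ totalᵛ ≔ var totalᵛ ⊖ lit 1
  ⨾ rekey wᵛ

add : Program
add = storeᴺ countᵃ (var jᵛ) (lit 1 ⊕ load countᵃ (var jᵛ))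
  ⨾ storeᴸ Sᵛ (lit 0) (load Sᵛ (lit 0) ⊕ (load depthᵃ (var mᵛ ⊖ lit 1) ⊕ load lengthᵃ (var jᵛ)))
  ⨾ totalᵛ ≔ lit 1 ⊕ var totalᵛ
  ⨾ rekey jᵛ

-- A tree with m inner nodes and n leaves has n + m - 1 nodes besides the root, so this is the quota
-- of selected children.
fullᵀ : Test
fullᵀ = load 0 (lit 0) ⊕ var mᵛ ≤ᴺ lit 1 ⊕ var totalᵛ

-- Below the quota every child is welcome; at the quota it has to beat the deepest selected one.
uselessᵀ : NatExp → NatExp → Test
uselessᵀ i j = and fullᵀ (nat (lit 0) ⊖ load keyᵃ (load winnerᵃ (lit 1)) ≤ᴸ load depthᵃ i ⊕ load lengthᵃ j)

moreᵀ : Test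
moreᵀ = and (lit 1 ⊕ var jᵛ ≤ᴺ var Rᵛ) (neg (uselessᵀ (var mᵛ ⊖ lit 1) (var jᵛ)))

exchange : Program
exchange = (if fullᵀ then remove else skip) ⨾ add ⨾ jᵛ ≔ lit 1 ⊕ var jᵛ

keepBest : Program
keepBest = if fullᵀ
  then (if and (lit 1 ≤ᴺ var bestᵛ) (load bestCostᵛ (lit 0) ≤ᴸ load Sᵛ (lit 0))
        then skip
        else (bestᵛ ≔ var mᵛ ⨾ storeᴸ bestCostᵛ (lit 0) (load Sᵛ (lit 0))))
  else skip

-- Turning node m into an inner node takes its depth out of the cost and raises the quota by one.
-- Hence the first child enters without a removal, and only the others have to be exchanged.
addRow : Program
addRow = storeᴸ Sᵛ (lit 0) (load Sᵛ (lit 0) ⊖ load depthᵃ (var mᵛ))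
  ⨾ mᵛ ≔ lit 1 ⊕ var mᵛ
  ⨾ jᵛ ≔ lit 0
  ⨾ (add ⨾ jᵛ ≔ lit 1)
  ⨾ (while moreᵀ loop exchange)
  ⨾ keepBest

search : Program
search = clear ⨾ build ⨾ mᵛ ≔ lit 0 ⨾ totalᵛ ≔ lit 0 ⨾ storeᴸ Sᵛ (lit 0) (nat (lit 0)) ⨾ bestᵛ ≔ lit 0
  ⨾ while neg (uselessᵀ (var mᵛ) (lit 1)) loop addRow

zero-or-positive : ∀ n (f : ℕ → ℕ) → (∃[ j ] j < n × f j ≡ 0) ⊎ (∀ j → j < n → 1 ≤ f j)
zero-or-positive zero f = inj₂ (λ _ ())
zero-or-positive (suc n) f with f n ℕₚ.≟ 0 | zero-or-positive n f
... | yes e | _ = inj₁ (n , ℕₚ.≤-refl , e)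
... | no _ | inj₁ (j , j<n , e) = inj₁ (j , ℕₚ.m<n⇒m<1+n j<n , e)
... | no ≢0 | inj₂ pos = inj₂ (λ j j≤n → case j j≤n (j ℕₚ.≟ n))
  where
  case : ∀ j → j < suc n → Dec (j ≡ n) → 1 ≤ f j
  case j _ (yes refl) = ℕₚ.n≢0⇒n>0 ≢0
  case j j≤n (no j≢n) = pos j (below j≤n j≢n)

sumℕ-shift : ∀ n f → sumℕ (suc n) f ≡ f 0 + sumℕ n (λ i → f (suc i))
sumℕ-shift zero f = refl
sumℕ-shift (suc n) f = ≡.trans (cong (f (suc n) +_) (sumℕ-shift n f)) (x∙yz≈y∙xz (f (suc n)) (f 0) _)
  where open import Algebra.Properties.CommutativeSemigroup ℕₚ.+-commutativeSemigroup using (x∙yz≈y∙xz)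

sumℕ-reverse : ∀ n (g : ℕ → ℕ) → sumℕ n (λ f → g (n ∸ f)) ≡ sumℕ n (λ i → g (suc i))
sumℕ-reverse zero g = refl
sumℕ-reverse (suc n) g = ≡.trans (sumℕ-shift n (λ f → g (suc n ∸ f))) (cong (g (suc n) +_) (sumℕ-reverse n g))

-- Take the last non-zero term: all terms up to it are at most `p`, and their number times `p` is at
-- most `X`.
sumℕ-indicator : ∀ N p X (f : ℕ → ℕ) → (∀ i → i < N → f i ≡ 0 ⊎ f i ≡ p) → (∀ i → i < N → f i * suc i ≤ X) → sumℕ N f ≤ X
sumℕ-indicator zero p X f two le = z≤n
sumℕ-indicator (suc N) p X f two le with two N ℕₚ.≤-refl
... | inj₁ e = ℕₚ.≤-trans (ℕₚ.≤-reflexive (cong (_+ sumℕ N f) e)) (sumℕ-indicator N p X f (λ i i<N → two i (ℕₚ.m<n⇒m<1+n i<N)) (λ i i<N → le i (ℕₚ.m<n⇒m<1+n i<N)))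
... | inj₂ e = begin
  f N + sumℕ N f           ≤⟨ ℕₚ.+-mono-≤ (ℕₚ.≤-reflexive e) (sumℕ-mono N (λ i i<N → at-most i (two i (ℕₚ.m<n⇒m<1+n i<N)))) ⟩
  p + sumℕ N (λ _ → p)     ≡⟨ cong (p +_) (sumℕ-const N p) ⟩
  suc N * p                ≡⟨ ≡.trans (ℕₚ.*-comm (suc N) p) (cong (_* suc N) (≡.sym e)) ⟩
  f N * suc N              ≤⟨ le N ℕₚ.≤-refl ⟩
  X                        ∎
  where
  open ℕₚ.≤-Reasoning
  at-most : ∀ i → f i ≡ 0 ⊎ f i ≡ p → f i ≤ p
  at-most i (inj₁ e) = ℕₚ.≤-trans (ℕₚ.≤-reflexive e) z≤n
  at-most i (inj₂ e) = ℕₚ.≤-reflexive e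

-- The binary digits of the terms are summed separately: the terms with digit k
-- set are at least 2 ^ k, so there are at most X / 2 ^ k of them.
sumℕ-harmonic : ∀ k N X (g : ℕ → ℕ) → (∀ i → i < N → g i * suc i ≤ X) → (∀ i → i < N → g i < 2 ^ k) → sumℕ N g ≤ k * X
sumℕ-harmonic zero N X g le lt = ℕₚ.≤-reflexive (≡.trans (sumℕ-cong N (λ i i<N → ℕₚ.n<1⇒n≡0 (lt i i<N))) (≡.trans (sumℕ-const N 0) (ℕₚ.*-zeroʳ N)))
sumℕ-harmonic (suc k) N X g le lt = begin
  sumℕ N g                           ≡⟨ sumℕ-cong N (λ i _ → split-+ (g i)) ⟩
  sumℕ N (λ i → hi (g i) + lo (g i)) ≡⟨ sumℕ-+ N (λ i → hi (g i)) (λ i → lo (g i)) ⟩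
  sumℕ N (λ i → hi (g i)) + sumℕ N (λ i → lo (g i))
    ≤⟨ ℕₚ.+-mono-≤ (sumℕ-indicator N (2 ^ k) X _ (λ i _ → hi-two (g i)) (λ i i<N → ℕₚ.≤-trans (ℕₚ.*-monoˡ-≤ (suc i) (hi≤ (g i))) (le i i<N)))
                   (sumℕ-harmonic k N X _ (λ i i<N → ℕₚ.≤-trans (ℕₚ.*-monoˡ-≤ (suc i) (lo≤ (g i))) (le i i<N)) (λ i i<N → lo< (g i) (lt i i<N))) ⟩
  X + k * X                          ∎
  where
  open ℕₚ.≤-Reasoning
  hi lo : ℕ → ℕ
  hi x with 2 ^ k ℕₚ.≤? x
  ... | yes _ = 2 ^ k
  ... | no _ = 0
  lo x with 2 ^ k ℕₚ.≤? x
  ... | yes _ = x ∸ 2 ^ k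
  ... | no _ = x
  split-+ : ∀ x → x ≡ hi x + lo x
  split-+ x with 2 ^ k ℕₚ.≤? x
  ... | yes le = ≡.sym (ℕₚ.m+[n∸m]≡n le)
  ... | no _ = refl
  hi-two : ∀ x → hi x ≡ 0 ⊎ hi x ≡ 2 ^ k
  hi-two x with 2 ^ k ℕₚ.≤? x
  ... | yes _ = inj₂ refl
  ... | no _ = inj₁ refl
  hi≤ : ∀ x → hi x ≤ x
  hi≤ x with 2 ^ k ℕₚ.≤? x
  ... | yes le = le
  ... | no _ = z≤n
  lo≤ : ∀ x → lo x ≤ x
  lo≤ x with 2 ^ k ℕₚ.≤? x
  ... | yes _ = ℕₚ.m∸n≤m x (2 ^ k)
  ... | no _ = ℕₚ.≤-refl
  lo< : ∀ x → x < 2 ^ suc k → lo x < 2 ^ k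
  lo< x lt with 2 ^ k ℕₚ.≤? x
  ... | yes le = ℕₚ.+-cancelˡ-< (2 ^ k) _ _ (≡.subst₂ _<_ (≡.sym (ℕₚ.m+[n∸m]≡n le)) (cong (2 ^ k +_) (ℕₚ.+-identityʳ (2 ^ k))) lt)
  ... | no ≰ = ℕₚ.≰⇒> ≰

private
  rearrange : ∀ u n → (u + (u + u)) * (n + n) * 470 ≡ n * u * 2820
  rearrange = solve-∀

  collect : ∀ N → N * 50 + (N * 50 + (N * 13 + (N * 50 + (N * 550 + N * 2820)))) ≡ N * 3533
  collect = solve-∀

loopCost-sum : ∀ b k f → loopCost b k f ≡ b + sumℕ f (λ i → b + k i)
loopCost-sum b k zero = ≡.sym (ℕₚ.+-identityʳ b)
loopCost-sum b k (suc f) = cong (b +_) (≡.trans (cong (k f +_) (loopCost-sum b k f)) (≡.trans (≡.sym (ℕₚ.+-assoc (k f) b _)) (cong (_+ sumℕ f (λ i → b + k i)) (ℕₚ.+-comm (k f) b))))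

sumℕ-*ʳ : ∀ n f k → sumℕ n (λ i → f i * k) ≡ sumℕ n f * k
sumℕ-*ʳ zero f k = refl
sumℕ-*ʳ (suc n) f k = ≡.trans (cong (f n * k +_) (sumℕ-*ʳ n f k)) (≡.sym (ℕₚ.*-distribʳ-+ k (f n) (sumℕ n f)))

module Search {a ℓ₁ ℓ₂} (F : OrderedField a ℓ₁ ℓ₂) {r : ℕ} (R : ℕ) (R≤r : R ≤ r) (0<r : 0 < r)
  (c : Fin r → OrderedField.Carrier F) (ĉ : ℕ → OrderedField.Carrier F) (ĉ-toℕ : ∀ i → ĉ (toℕ i) ≡ c i)
  (ĉ-nonNeg : ∀ {j} → j < r → OrderedField._≤_ F (OrderedField.0# F) (ĉ j))
  (ĉ-sorted : ∀ {i j} → i ≤ j → j < r → OrderedField._≤_ F (ĉ i) (ĉ j))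
  (n′ u : ℕ) (2≤R : 2 ≤ R) (1≤u : 1 ≤ u) (R≤2^1+u : R ≤ 2 ^ suc u) (R-min : R ≡ r ⊎ R ≡ suc n′) (n-large : 2 ≤ suc n′) where
  n : ℕ
  n = suc n′
  1≤R : 1 ≤ R
  1≤R = ℕₚ.<⇒≤ 2≤R
  open OrderedFieldLemmas F
  open Sums F
  open Decomposition F c ĉ ĉ-toℕ
  open Enumeration F R R≤r 0<r c ĉ ĉ-toℕ ĉ-nonNeg ĉ-sorted
  open LowerBound F R R≤r 0<r c ĉ ĉ-toℕ ĉ-nonNeg ĉ-sorted
  open Execution F
  open Rules u 1≤u
  open Frames F
  open Tournament F R
  open Enumerate F R R≤r 0<r c ĉ ĉ-toℕ ĉ-nonNeg ĉ-sorted n u 1≤R 1≤u R≤2^1+u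

  -- The bound on row m in a form that can be summed: for m at most n the quota n + m - 1 is below 2
  -- n, and a row is no longer than the alphabet.
  κ : ℕ → ℕ
  κ zero    = 0
  κ (suc ρ) = R ⊓ ((n + n) / suc ρ)

  ≤κ : ∀ {j} ρ → j ≤ R → j * suc ρ ≤ n + n → j ≤ κ (suc ρ)
  ≤κ {j} ρ j≤R le = ℕₚ.⊓-glb j≤R (ℕₚ.≤-trans (ℕₚ.≤-reflexive (≡.sym (DivMod.m*n/n≡m j (suc ρ)))) (DivMod./-monoˡ-≤ (suc ρ) le))

  rowCount : ∀ {ws} → IsPrefixCode n ws → ℕ
  rowCount code = length (Decomposed.rows (code-decomposition (s≤s z≤n) code))

  searchᴺ searchᴸ : List ℕ
  searchᴺ = winnerᵃ ∷ countᵃ ∷ iᵛ ∷ jᵛ ∷ wᵛ ∷ mᵛ ∷ totalᵛ ∷ bestᵛ ∷ []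
  searchᴸ = keyᵃ ∷ Sᵛ ∷ bestCostᵛ ∷ []

  module _ (σ₀ : Store) (env₀ : Env σ₀) {ℓ} (good₀ : Good n n ℓ (lens σ₀ depthᵃ)) where
    open GoodLemmas good₀

    E : ℕ → Carrier
    E = lens σ₀ depthᵃ

    key : ℕ → ℕ → Carrier
    key i j = E i ⊞ ĉ j

    key-mono : ∀ {i i′ j j′} → i ≤ i′ → i′ < n → j ≤ j′ → j′ < r → key i j ≼ key i′ j′
    key-mono i≤i′ i′<n j≤j′ j′<r = ⊞-mono (E-mono i≤i′ i′<n) (ĉ-sorted j≤j′ j′<r)

    LastKey : (ℕ → ℕ) → (ℕ → Carrier) → ℕ → Set a
    LastKey q K j = (1 ≤ q j → K j ≡ 0# ⊞ ⊟ key (q j ∸ 1) j) × (q j ≡ 0 → K j ≡ fromℕ 1)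

    lastKey-cong : ∀ q q′ K K′ {j} → q′ j ≡ q j → K′ j ≡ K j → LastKey q K j → LastKey q′ K′ j
    lastKey-cong q q′ K K′ {j} q≡ K≡ (lo , hi) =
        (λ 1≤ → ≡.trans K≡ (≡.trans (lo (subst (1 ≤_) q≡ 1≤)) (cong (λ k → 0# ⊞ ⊟ key (k ∸ 1) j) (≡.sym q≡))))
      , (λ e → ≡.trans K≡ (hi (≡.trans (≡.sym q≡) e)))

    record Rekeyed (x : ℕ) (σ τ : Store) : Set (a Level.⊔ ℓ₂) where
      field
        frame   : Frame (winnerᵃ ∷ iᵛ ∷ []) (keyᵃ ∷ []) σ τ
        tree    : Tree (nats τ winnerᵃ) (lens τ keyᵃ)
        key-off : ∀ j → j ≢ x → lens τ keyᵃ j ≡ lens σ keyᵃ j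
        key-at  : LastKey (nats τ countᵃ) (lens τ keyᵃ) x

    rekey-exec : ∀ v σ x → nats σ v 0 ≡ x → T (not (elem v (iᵛ ∷ []))) → Env σ → (∀ s → lens σ depthᵃ s ≡ E s) → x < R →
      ∀ {win K} → Tree win K → (∀ i → nats σ winnerᵃ i ≡ win i) → (∀ j → j ≢ x → lens σ keyᵃ j ≡ K j) →
      Exec u (rekey v) σ 130 (Rekeyed x σ)
    rekey-exec v σ x v≡ v≢i env E≡ x<R {win} {K} tree win≡ K≡ = weaken (ℕₚ.≤ᵇ⇒≤ _ _ _) (sequence (branch
        (λ (Level.lift 1≤) → assignᴸ (step _
          ( (λ _ → ≡.trans (cong (update (lens σ) keyᵃ k _ keyᵃ) (≡.sym v≡)) (≡.trans (update-at (lens σ) keyᵃ k _)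
              (cong (λ z → 0# ⊞ ⊟ z) (≡.trans (≡.cong₂ (λ s z → lens σ depthᵃ s ⊞ z) (cong (λ x → nats σ countᵃ x ∸ 1) v≡) (≡.trans (c≡ env k) (cong ĉ v≡))) (cong (_⊞ ĉ x) (E≡ _))))))
          , (λ e → ⊥-elim (ℕₚ.<⇒≢ 1≤ (≡.sym (≡.trans (cong (nats σ countᵃ) v≡) e)))) )))
        (λ ≱1 → assignᴸ (step _
          ( (λ 1≤ → ⊥-elim (≱1 (Level.lift (subst (λ x → 1 ≤ nats σ countᵃ x) (≡.sym v≡) 1≤))))
          , (λ _ → ≡.trans (cong (update (lens σ) keyᵃ k _ keyᵃ) (≡.sym v≡)) (update-at (lens σ) keyᵃ k _)) )))))
      where
      k = nats σ v 0
      step : ∀ val → LastKey (nats σ countᵃ) (update (lens σ) keyᵃ k val keyᵃ) x →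
        Exec u (iᵛ ≔ (var Rᵛ ⊕ var v) ⊘ lit 2 ⨾ mend) (store (nats σ) (update (lens σ) keyᵃ k val)) 100 (Rekeyed x σ)
      step val at-x = weaken (ℕₚ.≤ᵇ⇒≤ _ _ _) (sequence (assignᴺ (consequence finish (mend-exec u 1≤u R≤2^1+u _ mending))))
        where
        off : ∀ j → j ≢ x → update (lens σ) keyᵃ k val keyᵃ j ≡ lens σ keyᵃ j
        off j j≢x = update-off (lens σ) keyᵃ k val (λ e → j≢x (≡.trans e v≡))
        mending : Mending ((nats σ Rᵛ 0 + k) / 2) (nats σ winnerᵃ) (update (lens σ) keyᵃ k val keyᵃ)
        mending = subst (λ i → Mending i (nats σ winnerᵃ) (update (lens σ) keyᵃ k val keyᵃ)) (≡.sym (≡.cong₂ (λ R x → (R + x) / 2) (R≡ env) v≡))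
          (mending-start x x<R (tree-cong win≡ (λ _ → refl) tree) (λ j _ j≢x → ≡.trans (off j j≢x) (K≡ j j≢x)))
        finish : ∀ {τ} → OnlyWinners (store (update (nats σ) iᵛ 0 ((nats σ Rᵛ 0 + k) / 2)) (update (lens σ) keyᵃ k val)) τ × Tree (nats τ winnerᵃ) (update (lens σ) keyᵃ k val keyᵃ) → Rekeyed x σ τ
        finish {τ} (only , tree′) = record
          { frame = frame-trans (frame-updateᴺ iᵛ 0 _ _ (frame-updateᴸ keyᵃ _ _ _ frame-refl)) (frame-weaken _ _ (frame-winners only))
          ; tree = subst (λ l → Tree (nats τ winnerᵃ) (l keyᵃ)) (≡.sym (OnlyWinners.same-lens only)) tree′
          ; key-off = λ j j≢x → ≡.trans (K′ j) (off j j≢x)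
          ; key-at = lastKey-cong (nats σ countᵃ) (nats τ countᵃ) (update (lens σ) keyᵃ k val keyᵃ) (lens τ keyᵃ) (same-nats (frame-winners only) countᵃ x _) (K′ x) at-x }
          where
          K′ : ∀ j → lens τ keyᵃ j ≡ update (lens σ) keyᵃ k val keyᵃ j
          K′ j = cong (λ l → l keyᵃ j) (OnlyWinners.same-lens only)

    -- The state common to all of the search; m is the number of rows whose depth was subtracted from the cost.
    record Base (m : ℕ) (σ : Store) : Set (a Level.⊔ ℓ₁ Level.⊔ ℓ₂) where
      field
        frame  : Frame searchᴺ searchᴸ σ₀ σ
        q≤n    : ∀ j → j < R → nats σ countᵃ j ≤ n
        total≡ : nats σ totalᵛ 0 ≡ sumℕ R (nats σ countᵃ)
        cost≈  : lens σ Sᵛ 0 ⊞ ∑ m E ≈ ∑ R (λ j → ∑ (nats σ countᵃ j) (λ i → key i j))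
        keys   : ∀ j → j < R → LastKey (nats σ countᵃ) (lens σ keyᵃ) j
        tree   : Tree (nats σ winnerᵃ) (lens σ keyᵃ)
      env : Env σ
      env = frame-env _ _ _ frame env₀
      q : ℕ → ℕ
      q = nats σ countᵃ
      w : ℕ
      w = nats σ winnerᵃ 1
      w<R : w < R
      w<R = champion<R tree 1≤R
      D : Carrier
      D = key (q w ∸ 1) w
      q∸1<n : ∀ j → j < R → 1 ≤ q j → q j ∸ 1 < n
      q∸1<n j j<R 1≤q = ℕₚ.≤-trans (ℕₚ.≤-reflexive (ℕₚ.m+[n∸m]≡n 1≤q)) (q≤n j j<R)

    module BaseLemmas {m σ} (base : Base m σ) (some : 1 ≤ sumℕ R (nats σ countᵃ)) where
      open Base base

      private
        top-key : ∀ {j} → j < R → 1 ≤ q j → lens σ keyᵃ j ≼ 0#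
        top-key {j} j<R 1≤q = ≼-respˡ (≈-reflexive (≡.sym (proj₁ (keys j j<R) 1≤q)))
          (≼-linear {l = 0#} (≼-respˡ (+-identityʳ 0#) (⊞-mono (E-nonNeg _ (q∸1<n j j<R 1≤q)) (ĉ-nonNeg (ℕₚ.<-≤-trans j<R R≤r))))
            (solve 1 (λ k → :0 :+ :- k :+ k ⊜ :0 :+ :0) ≈-refl (key (q j ∸ 1) j)))

        nonempty : ∀ n → 1 ≤ sumℕ n q → ∃[ j ] j < n × 1 ≤ q j
        nonempty (suc n) 1≤ with q n ℕₚ.≟ 0
        ... | no ≢0 = n , ℕₚ.≤-refl , ℕₚ.n≢0⇒n>0 ≢0
        ... | yes e = let (j , j<n , 1≤q) = nonempty n (subst (λ z → 1 ≤ z + sumℕ n q) e 1≤) in j , ℕₚ.m<n⇒m<1+n j<n , 1≤q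

      -- A letter without selected children has key 1, one with selected children a key of at most
      -- 0. So the champion does have a child to discard.
      1≤qw : 1 ≤ q w
      1≤qw with q w ℕₚ.≟ 0
      ... | no ≢0 = ℕₚ.n≢0⇒n>0 ≢0
      ... | yes e = let (j , j<R , 1≤q) = nonempty R some in
            ⊥-elim (0≺1 (≼-respˡ (≈-trans (≈-reflexive (proj₂ (keys w w<R) e)) (+-identityʳ 1#)) (≼-trans (champion tree j j<R) (top-key j<R 1≤q))))

      top≼D : ∀ {j} → j < R → 1 ≤ q j → key (q j ∸ 1) j ≼ D
      top≼D {j} j<R 1≤q = ⊟-anti⁻¹ (≡.subst₂ _≼_ refl refl (≼-respˡ (+-identityˡ _) (≼-respʳ (+-identityˡ _)
        (≡.subst₂ _≼_ (proj₁ (keys w w<R) 1≤qw) (proj₁ (keys j j<R) 1≤q) (champion tree j j<R)))))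

      D-value : 0# ⊞ ⊟ lens σ keyᵃ w ≈ D
      D-value = ≈-trans (+-congˡ (-‿cong (≈-reflexive (proj₁ (keys w w<R) 1≤qw)))) (solve 1 (λ d → :0 :+ :- (:0 :+ :- d) ⊜ d) ≈-refl D)

    adjustᴺ adjustᴸ : List ℕ
    adjustᴺ = winnerᵃ ∷ countᵃ ∷ iᵛ ∷ wᵛ ∷ totalᵛ ∷ []
    adjustᴸ = keyᵃ ∷ Sᵛ ∷ []

    -- Serves for both directions: the count of one letter is set to `x`, be it higher or lower than
    -- before.
    record Added (m x j : ℕ) (σ τ : Store) : Set (a Level.⊔ ℓ₁ Level.⊔ ℓ₂) where
      field
        base    : Base m τ
        frame   : Frame adjustᴺ adjustᴸ σ τ
        q-at    : nats τ countᵃ j ≡ x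
        q-off   : ∀ i → i ≢ j → nats τ countᵃ i ≡ nats σ countᵃ i

    add-exec : ∀ m ρ j σ → Base m σ → nats σ mᵛ 0 ≡ suc ρ → nats σ jᵛ 0 ≡ j → j < R → ρ < n → nats σ countᵃ j ≡ ρ →
      Exec u add σ 180 (Added m (suc ρ) j σ)
    add-exec m ρ j σ base m≡ j≡ j<R ρ<n qj≡ρ = weaken (ℕₚ.≤ᵇ⇒≤ _ _ _) (sequence (assignᴺ (sequence (assignᴸ (sequence (assignᴺ (consequence finish
        (rekey-exec jᵛ σ₁ j j≡ _ env₁ (λ s → same-lens frame depthᵃ s _) j<R tree (λ _ → refl) (λ _ _ → refl)))))))))
      where
      open Base base
      x = nats σ jᵛ 0
      σ₁ = store (update (update (nats σ) countᵃ x (suc (q x))) totalᵛ 0 (suc (nats σ totalᵛ 0)))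
                 (update (lens σ) Sᵛ 0 (lens σ Sᵛ 0 ⊞ (lens σ depthᵃ (nats σ mᵛ 0 ∸ 1) ⊞ lens σ lengthᵃ x)))
      φ₁ : Frame adjustᴺ adjustᴸ σ σ₁
      φ₁ = frame-updateᴺ totalᵛ 0 _ _ (frame-updateᴸ Sᵛ 0 _ _ (frame-updateᴺ countᵃ _ _ _ frame-refl))
      env₁ : Env σ₁
      env₁ = frame-env _ _ _ φ₁ env
      finish : ∀ {τ} → Rekeyed j σ₁ τ → Added m (suc ρ) j σ τ
      finish {τ} rekeyed = record
        { base = record
          { frame = frame-trans frame (frame-weaken _ _ φ)
          ; q≤n = λ i i<R → by-case (λ i k → k ≤ n) i ρ<n (q≤n i i<R)
          ; total≡ = ≡.trans (same-nats K.frame totalᵛ 0 _) (≡.trans (cong suc total≡) (≡.sym (sumℕ-suc R j j<R (≡.trans q-at (cong suc (≡.sym qj≡ρ))) (λ i _ i≢j → q-off i i≢j))))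
          ; cost≈ = ≈-trans (+-congʳ (≈-reflexive (≡.trans (same-lens K.frame Sᵛ 0 _) (cong (lens σ Sᵛ 0 ⊞_) key≡))))
              (≈-trans (solve 3 (λ s k e → s :+ k :+ e ⊜ s :+ e :+ k) ≈-refl _ _ _)
                (≈-trans (+-congʳ cost≈) (≈-sym (∑-change R j j<R
                  (≈-trans (≈-reflexive (cong (λ k → ∑ k (λ i → key i j)) q-at)) (≈-trans (+-comm _ _) (+-congʳ (≈-reflexive (cong (λ k → ∑ k (λ i → key i j)) (≡.sym qj≡ρ))))))
                  (λ i _ i≢j → ≈-reflexive (cong (λ k → ∑ k (λ i′ → key i′ i)) (q-off i i≢j)))))))
          ; keys = keys′
          ; tree = K.tree }
        ; frame = φ ; q-at = q-at ; q-off = q-off }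
        where
        module K = Rekeyed rekeyed
        φ : Frame adjustᴺ adjustᴸ σ τ
        φ = frame-trans φ₁ (frame-weaken _ _ K.frame)
        key≡ : lens σ depthᵃ (nats σ mᵛ 0 ∸ 1) ⊞ lens σ lengthᵃ x ≡ key ρ j
        key≡ = ≡.cong₂ _⊞_ (≡.trans (same-lens frame depthᵃ _ _) (cong (λ k → E (k ∸ 1)) m≡)) (≡.trans (c≡ env x) (cong ĉ j≡))
        q-at : nats τ countᵃ j ≡ suc ρ
        q-at = ≡.trans (same-nats K.frame countᵃ j _) (≡.trans (cong (update (nats σ) countᵃ x (suc (q x)) countᵃ) (≡.sym j≡))
          (≡.trans (update-at (nats σ) countᵃ x _) (cong suc (≡.trans (cong q j≡) qj≡ρ))))
        q-off : ∀ i → i ≢ j → nats τ countᵃ i ≡ q i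
        q-off i i≢j = ≡.trans (same-nats K.frame countᵃ i _) (update-off (nats σ) countᵃ x _ (λ e → i≢j (≡.trans e j≡)))
        by-case : ∀ {p} (P : ℕ → ℕ → Set p) i → P j (suc ρ) → P i (q i) → P i (nats τ countᵃ i)
        by-case P i at off with i ℕₚ.≟ j
        ... | yes refl = subst (P i) (≡.sym q-at) at
        ... | no i≢j = subst (P i) (≡.sym (q-off i i≢j)) off
        keys′ : ∀ i → i < R → LastKey (nats τ countᵃ) (lens τ keyᵃ) i
        keys′ i i<R with i ℕₚ.≟ j
        ... | yes refl = K.key-at
        ... | no i≢j = lastKey-cong q (nats τ countᵃ) (lens σ keyᵃ) (lens τ keyᵃ) (q-off i i≢j) (K.key-off i i≢j) (keys i i<R)

    remove-exec : ∀ m σ (base : Base m σ) → 1 ≤ sumℕ R (nats σ countᵃ) →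
      Exec u remove σ 180 (Added m (nats σ countᵃ (nats σ winnerᵃ 1) ∸ 1) (nats σ winnerᵃ 1) σ)
    remove-exec m σ base some = weaken (ℕₚ.≤ᵇ⇒≤ _ _ _) (sequence (assignᴺ (sequence (assignᴸ (sequence (assignᴺ (sequence (assignᴺ (consequence finish
        (rekey-exec wᵛ σ₁ w refl _ env₁ (λ s → same-lens frame depthᵃ s _) w<R tree (λ _ → refl) (λ _ _ → refl)))))))))))
      where
      open Base base
      open BaseLemmas base some
      σ₁ = store (update (update (update (nats σ) wᵛ 0 w) countᵃ w (q w ∸ 1)) totalᵛ 0 (nats σ totalᵛ 0 ∸ 1))
                 (update (lens σ) Sᵛ 0 (lens σ Sᵛ 0 ⊞ lens σ keyᵃ w))
      φ₁ : Frame adjustᴺ adjustᴸ σ σ₁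
      φ₁ = frame-updateᴺ totalᵛ 0 _ _ (frame-updateᴺ countᵃ _ _ _ (frame-updateᴸ Sᵛ 0 _ _ (frame-updateᴺ wᵛ _ _ _ frame-refl)))
      env₁ : Env σ₁
      env₁ = frame-env _ _ _ φ₁ env
      finish : ∀ {τ} → Rekeyed w σ₁ τ → Added m (q w ∸ 1) w σ τ
      finish {τ} rekeyed = record
        { base = record
          { frame = frame-trans frame (frame-weaken _ _ φ)
          ; q≤n = q≤n′
          ; total≡ = ≡.trans (same-nats K.frame totalᵛ 0 _) (≡.trans (cong (_∸ 1) total≡) (cong (_∸ 1) sum≡))
          ; cost≈ = ⊞-cancelʳ (key (q w ∸ 1) w) (≈-trans (+-congʳ (+-congʳ (≈-reflexive (≡.trans (same-lens K.frame Sᵛ 0 _) (cong (lens σ Sᵛ 0 ⊞_) (proj₁ (keys w w<R) 1≤qw))))))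
              (≈-trans (solve 3 (λ s k e → s :+ (:0 :+ :- k) :+ e :+ k ⊜ s :+ e) ≈-refl _ (key (q w ∸ 1) w) _)
                (≈-trans cost≈ (∑-change R w w<R
                  (≈-trans (≈-reflexive (cong (λ k → ∑ k (λ i → key i w)) (≡.sym (ℕₚ.m+[n∸m]≡n 1≤qw)))) (≈-trans (+-comm _ _) (+-congʳ (≈-reflexive (cong (λ k → ∑ k (λ i → key i w)) (≡.sym q-at))))))
                  (λ i _ i≢w → ≈-reflexive (cong (λ k → ∑ k (λ i′ → key i′ i)) (≡.sym (q-off i i≢w))))))))
          ; keys = keys′
          ; tree = K.tree }
        ; frame = φ ; q-at = q-at ; q-off = q-off }
        where
        module K = Rekeyed rekeyed
        φ : Frame adjustᴺ adjustᴸ σ τ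
        φ = frame-trans φ₁ (frame-weaken _ _ K.frame)
        q-at : nats τ countᵃ w ≡ q w ∸ 1
        q-at = ≡.trans (same-nats K.frame countᵃ w _) (update-at _ countᵃ w _)
        q-off : ∀ i → i ≢ w → nats τ countᵃ i ≡ q i
        q-off i i≢w = ≡.trans (same-nats K.frame countᵃ i _) (update-off _ countᵃ w _ i≢w)
        sum≡ : sumℕ R q ≡ suc (sumℕ R (nats τ countᵃ))
        sum≡ = sumℕ-suc R w w<R (≡.trans (≡.sym (ℕₚ.m+[n∸m]≡n 1≤qw)) (cong suc (≡.sym q-at))) (λ i _ i≢w → ≡.sym (q-off i i≢w))
        q≤n′ : ∀ i → i < R → nats τ countᵃ i ≤ n
        q≤n′ i i<R with i ℕₚ.≟ w
        ... | yes refl = ℕₚ.≤-trans (ℕₚ.≤-reflexive q-at) (ℕₚ.≤-trans (ℕₚ.m∸n≤m (q w) 1) (q≤n w w<R))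
        ... | no i≢w = subst (_≤ n) (≡.sym (q-off i i≢w)) (q≤n i i<R)
        keys′ : ∀ i → i < R → LastKey (nats τ countᵃ) (lens τ keyᵃ) i
        keys′ i i<R with i ℕₚ.≟ w
        ... | yes refl = K.key-at
        ... | no i≢w = lastKey-cong q (nats τ countᵃ) (lens σ keyᵃ) (lens τ keyᵃ) (q-off i i≢w) (K.key-off i i≢w) (keys i i<R)

    -- The state within row `ρ`, after its first `j` letters. In `order` only children of earlier
    -- nodes count as rejected, since the current row may still have better ones to offer.
    record Selection (ρ j : ℕ) (q : ℕ → ℕ) : Set ℓ₂ where
      field
        done  : ∀ i → i < j → q i ≡ suc ρ
        todo  : ∀ i → j ≤ i → i < R → q i ≤ ρ
        order : ∀ i j₁ j₂ → i < ρ → j₁ < R → q j₁ ≤ i → j₂ < R → 1 ≤ q j₂ → key (q j₂ ∸ 1) j₂ ≼ key i j₁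

    -- `D` separates the two sides: the selected children, including the new one, are no deeper, and
    -- the rejected children of earlier nodes are no shallower.
    selection-add : ∀ {ρ j} {q′ : ℕ → ℕ} (q : ℕ → ℕ) D → (∀ i → i < j → q i ≡ suc ρ) → (∀ i → j ≤ i → i < R → q i ≤ ρ) → key ρ j ≼ D →
      (∀ i → i < R → 1 ≤ q i → key (q i ∸ 1) i ≼ D) → (∀ i j₁ → i < ρ → j₁ < R → q j₁ ≤ i → D ≼ key i j₁) →
      q′ j ≡ suc ρ → (∀ i → i ≢ j → q′ i ≡ q i) → Selection ρ (suc j) q′
    selection-add {ρ} {j} {q′} q D done todo key≼D tops outs at off = record
      { done = done′
      ; todo = λ i j<i i<R → subst (_≤ ρ) (≡.sym (off i (λ e → ℕₚ.<⇒≢ j<i (≡.sym e)))) (todo i (ℕₚ.<⇒≤ j<i) i<R)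
      ; order = λ i j₁ j₂ i<ρ j₁<R q≤i j₂<R 1≤q → ≼-trans (tops′ j₂ j₂<R 1≤q) (outs′ i j₁ i<ρ j₁<R q≤i) }
      where
      done′ : ∀ i → i < suc j → q′ i ≡ suc ρ
      done′ i i≤j with i ℕₚ.≟ j
      ... | yes refl = at
      ... | no i≢j = ≡.trans (off i i≢j) (done i (below i≤j i≢j))
      tops′ : ∀ i → i < R → 1 ≤ q′ i → key (q′ i ∸ 1) i ≼ D
      tops′ i i<R 1≤q with i ℕₚ.≟ j
      ... | yes refl = subst (λ k → key (k ∸ 1) i ≼ D) (≡.sym at) key≼D
      ... | no i≢j = subst (λ k → key (k ∸ 1) i ≼ D) (≡.sym (off i i≢j)) (tops i i<R (subst (1 ≤_) (off i i≢j) 1≤q))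
      outs′ : ∀ i j₁ → i < ρ → j₁ < R → q′ j₁ ≤ i → D ≼ key i j₁
      outs′ i j₁ i<ρ j₁<R q≤i with j₁ ℕₚ.≟ j
      ... | yes refl = ⊥-elim (ℕₚ.<⇒≱ i<ρ (ℕₚ.≤-trans (ℕₚ.n≤1+n ρ) (ℕₚ.≤-trans (ℕₚ.≤-reflexive (≡.sym at)) q≤i)))
      ... | no ≢j = outs i j₁ i<ρ j₁<R (subst (_≤ i) (off j₁ ≢j) q≤i)

    selection-all : ∀ {ρ j} {q′ : ℕ → ℕ} (q : ℕ → ℕ) → (∀ i → i < j → q i ≡ suc ρ) → (∀ i → j ≤ i → i < R → q i ≡ ρ) →
      q′ j ≡ suc ρ → (∀ i → i ≢ j → q′ i ≡ q i) → Selection ρ (suc j) q′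
    selection-all {ρ} {j} {q′} q done rest at off = record
      { done = done′
      ; todo = λ i j<i i<R → ℕₚ.≤-reflexive (≡.trans (off i (λ e → ℕₚ.<⇒≢ j<i (≡.sym e))) (rest i (ℕₚ.<⇒≤ j<i) i<R))
      ; order = λ i j₁ _ i<ρ j₁<R q≤i _ _ → ⊥-elim (ℕₚ.<⇒≱ i<ρ (ℕₚ.≤-trans (large j₁ j₁<R) q≤i)) }
      where
      done′ : ∀ i → i < suc j → q′ i ≡ suc ρ
      done′ i i≤j with i ℕₚ.≟ j
      ... | yes refl = at
      ... | no i≢j = ≡.trans (off i i≢j) (done i (below i≤j i≢j))
      large : ∀ i → i < R → ρ ≤ q′ i
      large i i<R with i ℕₚ.<? suc j
      ... | yes i≤j = ℕₚ.≤-trans (ℕₚ.n≤1+n ρ) (ℕₚ.≤-reflexive (≡.sym (done′ i i≤j)))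
      ... | no i≰j = ℕₚ.≤-reflexive (≡.sym (≡.trans (off i (λ e → ℕₚ.<⇒≢ (ℕₚ.≮⇒≥ i≰j) (≡.sym e))) (rest i (ℕₚ.<⇒≤ (ℕₚ.≮⇒≥ i≰j)) i<R)))

    rowᴺ rowᴸ : List ℕ
    rowᴺ = winnerᵃ ∷ countᵃ ∷ iᵛ ∷ jᵛ ∷ wᵛ ∷ mᵛ ∷ totalᵛ ∷ []
    rowᴸ = keyᵃ ∷ Sᵛ ∷ []

    record Inner (σ₁ : Store) (ρ j : ℕ) (σ : Store) : Set (a Level.⊔ ℓ₁ Level.⊔ ℓ₂) where
      field
        base   : Base (suc ρ) σ
        frame  : Frame rowᴺ rowᴸ σ₁ σ
        m≡     : nats σ mᵛ 0 ≡ suc ρ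
        j≡     : nats σ jᵛ 0 ≡ j
        1≤j    : 1 ≤ j
        j≤R    : j ≤ R
        sel    : Selection ρ j (nats σ countᵃ)
        total≤ : sumℕ R (nats σ countᵃ) ≤ n′ + suc ρ
        room   : n′ + suc ρ ≤ sumℕ R (nats σ countᵃ) ⊎ (∀ i → j ≤ i → i < R → nats σ countᵃ i ≡ ρ)

    full⇒ : ∀ {m M σ} (base : Base m σ) → nats σ mᵛ 0 ≡ M → Holds fullᵀ σ → n′ + M ≤ sumℕ R (nats σ countᵃ)
    full⇒ base m≡ (Level.lift le) = ℕₚ.≤-pred (≡.subst₂ _≤_ (≡.cong₂ _+_ (n≡ env) m≡) (cong suc total≡) le)
      where open Base base

    ⇒full : ∀ {m M σ} (base : Base m σ) → nats σ mᵛ 0 ≡ M → n′ + M ≤ sumℕ R (nats σ countᵃ) → Holds fullᵀ σ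
    ⇒full base m≡ le = Level.lift (≡.subst₂ _≤_ (≡.sym (≡.cong₂ _+_ (n≡ env) m≡)) (cong suc (≡.sym total≡)) (s≤s le))
      where open Base base

    key-eval : ∀ {m σ i i′ j j′} (base : Base m σ) → i ≡ i′ → j ≡ j′ → lens σ depthᵃ i ⊞ lens σ lengthᵃ j ≡ key i′ j′
    key-eval {i = i} {j = j} base refl refl = ≡.cong₂ _⊞_ (same-lens frame depthᵃ i _) (c≡ env j)
      where open Base base

    module _ {m σ} (base : Base m σ) where
      open Base base

      -- Otherwise the child of node `q j` along `j` is rejected and thus has depth at least `D`,
      -- although it is no deeper than the child of `ρ`. So a child enters only after those of all
      -- earlier nodes along its letter, and counts continue to describe the selection.
      cheaper⇒q≡ρ : ∀ {ρ j} → 1 ≤ sumℕ R q → ρ < n → j < R → q j ≤ ρ →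
        (∀ i j₁ → i < ρ → j₁ < R → q j₁ ≤ i → D ≼ key i j₁) → key ρ j ≺ D → q j ≡ ρ
      cheaper⇒q≡ρ {ρ} {j} some ρ<n j<R q≤ρ outs ≺D with q j ℕₚ.≟ ρ
      ... | yes e = e
      ... | no ≢ρ = ⊥-elim (≺D (≼-trans (outs (q j) j (ℕₚ.≤∧≢⇒< q≤ρ ≢ρ) j<R ℕₚ.≤-refl) (key-mono q≤ρ ρ<n ℕₚ.≤-refl (ℕₚ.<-≤-trans j<R R≤r))))

    add-step : ∀ {σ₁ ρ j σ} → Base (suc ρ) σ → Frame rowᴺ rowᴸ σ₁ σ → nats σ mᵛ 0 ≡ suc ρ → nats σ jᵛ 0 ≡ j → j < R → ρ < n →
      nats σ countᵃ j ≡ ρ → suc (sumℕ R (nats σ countᵃ)) ≤ n′ + suc ρ →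
      n′ + suc ρ ≤ suc (sumℕ R (nats σ countᵃ)) ⊎ (∀ i → suc j ≤ i → i < R → nats σ countᵃ i ≡ ρ) →
      (∀ {q′ : ℕ → ℕ} → q′ j ≡ suc ρ → (∀ i → i ≢ j → q′ i ≡ nats σ countᵃ i) → Selection ρ (suc j) q′) →
      ∀ e → timeᴺ e ≤ 10 → (∀ τ → nats τ jᵛ 0 ≡ j → evalᴺ e τ ≡ suc j) →
      Exec u (add ⨾ jᵛ ≔ e) σ 200 (λ τ → Inner σ₁ ρ (suc j) τ × (∀ i → i ≢ j → nats τ countᵃ i ≡ nats σ countᵃ i) × sumℕ R (nats τ countᵃ) ≡ suc (sumℕ R (nats σ countᵃ)))
    add-step {σ₁} {ρ} {j} {σ} base frame m≡ j≡ j<R ρ<n q≡ total room sel e cheap eval =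
        weaken (ℕₚ.+-monoʳ-≤ 180 (ℕₚ.≤-trans (s≤s (s≤s cheap)) (ℕₚ.≤ᵇ⇒≤ 12 20 _))) (sequence (consequence finish (add-exec (suc ρ) ρ j σ base m≡ j≡ j<R ρ<n q≡)))
      where
      finish : ∀ {τ} → Added (suc ρ) (suc ρ) j σ τ → Exec u (jᵛ ≔ e) τ _ _
      finish {τ} added = assignᴺ (record
          { base = record { frame = frame-updateᴺ jᵛ 0 _ _ (Base.frame A.base) ; q≤n = Base.q≤n A.base ; total≡ = Base.total≡ A.base ; cost≈ = Base.cost≈ A.base ; keys = Base.keys A.base ; tree = Base.tree A.base }
          ; frame = frame-updateᴺ jᵛ 0 _ _ (frame-trans frame (frame-weaken _ _ A.frame))
          ; m≡ = ≡.trans (same-nats A.frame mᵛ 0 _) m≡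
          ; j≡ = eval τ (≡.trans (same-nats A.frame jᵛ 0 _) j≡)
          ; 1≤j = s≤s z≤n
          ; j≤R = j<R
          ; sel = sel A.q-at A.q-off
          ; total≤ = subst (_≤ n′ + suc ρ) (≡.sym sum≡) total
          ; room = room′ room }
          , A.q-off , sum≡)
        where
        module A = Added added
        sum≡ : sumℕ R (nats τ countᵃ) ≡ suc (sumℕ R (nats σ countᵃ))
        sum≡ = sumℕ-suc R j j<R (≡.trans A.q-at (cong suc (≡.sym q≡))) (λ i _ i≢j → A.q-off i i≢j)
        room′ : n′ + suc ρ ≤ suc (sumℕ R (nats σ countᵃ)) ⊎ (∀ i → suc j ≤ i → i < R → nats σ countᵃ i ≡ ρ) →
          n′ + suc ρ ≤ sumℕ R (nats τ countᵃ) ⊎ (∀ i → suc j ≤ i → i < R → nats τ countᵃ i ≡ ρ)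
        room′ (inj₁ le) = inj₁ (subst (n′ + suc ρ ≤_) (≡.sym sum≡) le)
        room′ (inj₂ rest) = inj₂ (λ i j<i i<R → ≡.trans (A.q-off i (λ e → ℕₚ.<⇒≢ j<i (≡.sym e))) (rest i j<i i<R))

    exchange-exec : ∀ {σ₁ ρ j σ} → ρ < n → Inner σ₁ ρ j σ → Holds moreᵀ σ → Exec u exchange σ 420 (Inner σ₁ ρ (suc j))
    exchange-exec {σ₁} {ρ} {j} {σ} ρ<n inner (Level.lift j<R₀ , useful) = weaken (ℕₚ.≤ᵇ⇒≤ _ _ _) (sequence {l = 200} (branch with-removal without))
      where
      open Inner inner
      open Base base hiding (frame)
      open Selection sel
      j<R : j < R
      j<R = ≡.subst₂ _<_ j≡ (R≡ env) j<R₀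
      j<r = ℕₚ.<-≤-trans j<R R≤r
      suc-j : ∀ τ → nats τ jᵛ 0 ≡ j → evalᴺ (lit 1 ⊕ var jᵛ) τ ≡ suc j
      suc-j τ e = cong suc e
      without : ¬ Holds fullᵀ σ → Exec u skip σ 1 (λ τ → Exec u (add ⨾ jᵛ ≔ lit 1 ⊕ var jᵛ) τ 200 (Inner σ₁ ρ (suc j)))
      without ¬full = skipˣ (consequence proj₁ (add-step base frame m≡ j≡ j<R ρ<n (rest j ℕₚ.≤-refl j<R) room-left
          (inj₂ (λ i j<i → rest i (ℕₚ.<⇒≤ j<i))) (selection-all q done rest) _ (ℕₚ.≤ᵇ⇒≤ _ _ _) suc-j))
        where
        room-left : suc (sumℕ R q) ≤ n′ + suc ρ
        room-left = ℕₚ.≰⇒> (λ le → ¬full (⇒full base m≡ le))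
        rest : ∀ i → j ≤ i → i < R → q i ≡ ρ
        rest with room
        ... | inj₁ le = ⊥-elim (ℕₚ.<⇒≱ room-left le)
        ... | inj₂ all = all
      with-removal : Holds fullᵀ σ → Exec u remove σ 180 (λ τ → Exec u (add ⨾ jᵛ ≔ lit 1 ⊕ var jᵛ) τ 200 (Inner σ₁ ρ (suc j)))
      with-removal full = consequence finish (remove-exec (suc ρ) σ base some)
        where
        cap = full⇒ base m≡ full
        some : 1 ≤ sumℕ R q
        some = ℕₚ.≤-trans (ℕₚ.≤-trans (s≤s z≤n) (ℕₚ.m≤n+m (suc ρ) n′)) cap
        open BaseLemmas base some
        cheaper : key ρ j ≺ D
        cheaper D≼ = useful (full , ≼-respˡ (≈-sym D-value) (≼-respʳ (≈-reflexive (≡.sym (key-eval base (cong (_∸ 1) m≡) j≡))) D≼))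
        outs : ∀ i j₁ → i < ρ → j₁ < R → q j₁ ≤ i → D ≼ key i j₁
        outs i j₁ i<ρ j₁<R q≤i = order i j₁ w i<ρ j₁<R q≤i w<R 1≤qw
        q≡ρ : q j ≡ ρ
        q≡ρ = cheaper⇒q≡ρ base some ρ<n j<R (todo j ℕₚ.≤-refl j<R) outs cheaper
        -- The discarded child is strictly deeper than the one about to enter, whereas the children
        -- of node `ρ` or earlier ones along letters up to `j` are not. So no removal undoes the
        -- current row.
        w≢ : ∀ i → i ≤ j → q i ∸ 1 ≤ ρ → i ≢ w
        w≢ i i≤j q≤ refl = cheaper (key-mono q≤ ρ<n i≤j j<r)
        w≢j : j ≢ w
        w≢j = w≢ j ℕₚ.≤-refl (ℕₚ.≤-trans (ℕₚ.m∸n≤m (q j) 1) (ℕₚ.≤-reflexive q≡ρ))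
        w≢i : ∀ i → i < j → i ≢ w
        w≢i i i<j = w≢ i (ℕₚ.<⇒≤ i<j) (ℕₚ.≤-reflexive (cong (_∸ 1) (done i i<j)))
        finish : ∀ {τ} → Added (suc ρ) (q w ∸ 1) w σ τ → Exec u (add ⨾ jᵛ ≔ lit 1 ⊕ var jᵛ) τ 200 (Inner σ₁ ρ (suc j))
        finish {τ} removed = consequence proj₁ (add-step A.base (frame-trans frame (frame-weaken _ _ A.frame)) (≡.trans (same-nats A.frame mᵛ 0 _) m≡)
            (≡.trans (same-nats A.frame jᵛ 0 _) j≡) j<R ρ<n (≡.trans (A.q-off j w≢j) q≡ρ)
            (ℕₚ.≤-trans (ℕₚ.≤-reflexive (≡.sym sum≡)) total≤) (inj₁ (ℕₚ.≤-trans cap (ℕₚ.≤-reflexive sum≡)))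
            (selection-add (nats τ countᵃ) D (λ i i<j → ≡.trans (A.q-off i (w≢i i i<j)) (done i i<j)) todo′ (≺⇒≼ cheaper) tops outs′)
            _ (ℕₚ.≤ᵇ⇒≤ _ _ _) suc-j)
          where
          module A = Added removed
          sum≡ : sumℕ R q ≡ suc (sumℕ R (nats τ countᵃ))
          sum≡ = sumℕ-suc R w w<R (≡.trans (≡.sym (ℕₚ.m+[n∸m]≡n 1≤qw)) (cong suc (≡.sym A.q-at))) (λ i _ i≢w → ≡.sym (A.q-off i i≢w))
          todo′ : ∀ i → j ≤ i → i < R → nats τ countᵃ i ≤ ρ
          todo′ i j≤i i<R with i ℕₚ.≟ w
          ... | yes refl = ℕₚ.≤-trans (ℕₚ.≤-reflexive A.q-at) (ℕₚ.≤-trans (ℕₚ.m∸n≤m (q w) 1) (todo w j≤i i<R))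
          ... | no i≢w = subst (_≤ ρ) (≡.sym (A.q-off i i≢w)) (todo i j≤i i<R)
          tops : ∀ i → i < R → 1 ≤ nats τ countᵃ i → key (nats τ countᵃ i ∸ 1) i ≼ D
          tops i i<R 1≤q with i ℕₚ.≟ w
          ... | yes refl = key-mono (ℕₚ.≤-trans (ℕₚ.m∸n≤m _ 1) (ℕₚ.≤-reflexive A.q-at)) (q∸1<n w w<R 1≤qw) ℕₚ.≤-refl (ℕₚ.<-≤-trans w<R R≤r)
          ... | no i≢w = subst (λ k → key (k ∸ 1) i ≼ D) (≡.sym (A.q-off i i≢w)) (top≼D i<R (subst (1 ≤_) (A.q-off i i≢w) 1≤q))
          outs′ : ∀ i j₁ → i < ρ → j₁ < R → nats τ countᵃ j₁ ≤ i → D ≼ key i j₁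
          outs′ i j₁ i<ρ j₁<R q≤i with j₁ ℕₚ.≟ w
          ... | yes refl = key-mono (ℕₚ.≤-trans (ℕₚ.≤-reflexive (≡.sym A.q-at)) q≤i) (ℕₚ.<-trans i<ρ ρ<n) ℕₚ.≤-refl (ℕₚ.<-≤-trans j₁<R R≤r)
          ... | no ≢w = outs i j₁ i<ρ j₁<R (subst (_≤ i) (A.q-off j₁ ≢w) q≤i)

    -- `two` says that each node turned into an inner node has its first two children selected. This
    -- keeps the number of rows below `n` and also settles the letters beyond `R`.
    record Core (m : ℕ) (σ : Store) : Set (a Level.⊔ ℓ₁ Level.⊔ ℓ₂) where
      field
        base   : Base m σ
        m≡     : nats σ mᵛ 0 ≡ m
        m<n    : m < n
        q≤m    : ∀ j → j < R → nats σ countᵃ j ≤ m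
        order  : ∀ i j₁ j₂ → i < m → j₁ < R → nats σ countᵃ j₁ ≤ i → j₂ < R → 1 ≤ nats σ countᵃ j₂ → key (nats σ countᵃ j₂ ∸ 1) j₂ ≼ key i j₁
        total≤ : sumℕ R (nats σ countᵃ) ≤ n′ + m
        room   : n′ + m ≤ sumℕ R (nats σ countᵃ) ⊎ (∀ j → j < R → nats σ countᵃ j ≡ m)
        two    : m ≡ 0 ⊎ (∀ j → j < 2 → nats σ countᵃ j ≡ m)

    module Full {m σ} (core : Core m σ) (full : n′ + m ≤ sumℕ R (nats σ countᵃ)) (1≤m : 1 ≤ m) where
      open Core core
      open Base base hiding (frame)
      private
        some : 1 ≤ sumℕ R q
        some = ℕₚ.≤-trans (ℕₚ.≤-trans 1≤m (ℕₚ.m≤n+m m n′)) full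
      open BaseLemmas base some public
      private
        1<r : 1 < r
        1<r = ℕₚ.≤-trans 2≤R R≤r

        two′ : ∀ j → j < 2 → q j ≡ m
        two′ with two
        ... | inj₁ m≡0 = ⊥-elim (ℕₚ.<⇒≢ 1≤m (≡.sym m≡0))
        ... | inj₂ eq = eq

        selected : ∀ i j → j < R → i < q j → key i j ≼ D
        selected i j j<R i<q = ≼-trans
          (key-mono (ℕₚ.≤-pred (ℕₚ.≤-trans i<q (ℕₚ.≤-reflexive (≡.sym (ℕₚ.m+[n∸m]≡n 1≤q))))) (q∸1<n j j<R 1≤q) ℕₚ.≤-refl (ℕₚ.<-≤-trans j<R R≤r))
          (top≼D j<R 1≤q)
          where 1≤q = ℕₚ.≤-trans (s≤s z≤n) i<q

        -- Letters beyond the first n are never needed: either some enumerated letter is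
        -- unused as well, or the selection consists of the n children of the root.
        beyond : R ≡ r ⊎ R ≡ n → ∀ i j → i < m → j < r → R ≤ j → D ≼ key i j
        beyond (inj₁ R≡r) i j i<m j<r R≤j = ⊥-elim (ℕₚ.<⇒≱ j<r (ℕₚ.≤-trans (ℕₚ.≤-reflexive (≡.sym R≡r)) R≤j))
        beyond (inj₂ R≡n) i j i<m j<r R≤j with zero-or-positive R q
        ... | inj₁ (j₀ , j₀<R , q≡0) = ≼-trans (order 0 j₀ w (ℕₚ.≤-trans (s≤s z≤n) i<m) j₀<R (ℕₚ.≤-reflexive q≡0) w<R 1≤qw)
                (key-mono z≤n (ℕₚ.<-trans i<m m<n) (ℕₚ.≤-trans (ℕₚ.<⇒≤ j₀<R) R≤j) j<r)
        ... | inj₂ positive = key-mono (ℕₚ.≤-trans (ℕₚ.∸-monoˡ-≤ 1 (ℕₚ.≤-trans (q≤m w w<R) m≤1)) z≤n) (ℕₚ.<-trans i<m m<n) (ℕₚ.≤-trans (ℕₚ.<⇒≤ w<R) R≤j) j<r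
          where
          k = R ∸ 2
          k+2 : k + 2 ≡ R
          k+2 = ℕₚ.m∸n+n≡m 2≤R
          -- Two letters have all `m` children selected and each of the `k` others has at least one;
          -- since `n′` is `k + 1`, this forces `m` to be at most 1.
          large : k + 2 * m ≤ n′ + m
          large = ℕₚ.≤-trans (sumℕ-prefix-positive k q 2 m two′ (λ i lt → positive i (subst (i <_) k+2 lt)))
                    (ℕₚ.≤-trans (ℕₚ.≤-reflexive (cong (λ z → sumℕ z q) k+2)) total≤)
          k+1 : n′ ≡ k + 1
          k+1 = ℕₚ.suc-injective (≡.trans (≡.sym R≡n) (≡.trans (≡.sym k+2) (ℕₚ.+-suc k 1)))
          m≤1 : m ≤ 1
          m≤1 = ℕₚ.+-cancelˡ-≤ (k + m) m 1 (begin
            k + m + m ≡⟨ ℕₚ.+-assoc k m m ⟩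
            k + (m + m) ≡⟨ cong (λ z → k + (m + z)) (≡.sym (ℕₚ.+-identityʳ m)) ⟩
            k + 2 * m ≤⟨ large ⟩
            n′ + m ≡⟨ cong (_+ m) k+1 ⟩
            k + 1 + m ≡⟨ ℕₚ.+-assoc k 1 m ⟩
            k + (1 + m) ≡⟨ cong (k +_) (ℕₚ.+-comm 1 m) ⟩
            k + (m + 1) ≡⟨ ≡.sym (ℕₚ.+-assoc k m 1) ⟩
            k + m + 1 ∎)
            where open ℕₚ.≤-Reasoning

        unselected : ∀ i j → i < m → j < r → R ≤ j ⊎ q j ≤ i → D ≼ key i j
        unselected i j i<m j<r (inj₁ R≤j) = beyond R-min i j i<m j<r R≤j
        unselected i j i<m j<r (inj₂ q≤i) with j ℕₚ.<? R
        ... | yes j<R = order i j w i<m j<R q≤i w<R 1≤qw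
        ... | no j≮R = beyond R-min i j i<m j<r (ℕₚ.≮⇒≥ j≮R)

        letters : R ≡ r ⊎ R ≡ n → R ≡ r ⊎ m ≤ R
        letters (inj₁ e) = inj₁ e
        letters (inj₂ e) = inj₂ (ℕₚ.≤-trans (ℕₚ.<⇒≤ m<n) (ℕₚ.≤-reflexive (≡.sym e)))

      total-eq : sumℕ R q ≡ n′ + m
      total-eq = ℕₚ.≤-antisym total≤ full

      code-bound : ∀ {ws} (code : IsPrefixCode n ws) → rowCount code ≡ m ⊎ (m < rowCount code × D ≼ key m 1) → lens σ Sᵛ 0 ≼ ∑ᴸ depth ws
      code-bound code = cost-bound good₀ m n′ 1≤m m<n (letters R-min) q D (lens σ Sᵛ 0) q≤m selected unselected total-eq cost≈
        1<r (IsPrefixCode.size code) (code-decomposition (s≤s z≤n) code)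

    -- A selection below the quota contains all children of `m` nodes along `R` letters. If `R` is
    -- `r`, no tree with `m` inner nodes has more; if `R` is `n`, already one node has `n` children,
    -- and the quota would have been met.
    no-small-code : ∀ {m σ} → Core m σ → 1 ≤ m → sumℕ R (nats σ countᵃ) < n′ + m → ∀ {ws} (code : IsPrefixCode n ws) → rowCount code ≢ m
    no-small-code {m} {σ} core 1≤m lt {ws} code e = case room R-min
      where
      open Core core
      open Decomposed (code-decomposition (s≤s z≤n) code) using (size)
      size′ : n + m ≤ suc (m * r)
      size′ = subst (λ k → n + k ≤ suc (k * r)) e (subst (λ l → l + rowCount code ≤ suc (rowCount code * r)) (IsPrefixCode.size code) size)
      case : n′ + m ≤ sumℕ R (nats σ countᵃ) ⊎ (∀ j → j < R → nats σ countᵃ j ≡ m) → R ≡ r ⊎ R ≡ n → ⊥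
      case (inj₁ full) _ = ℕₚ.<⇒≱ lt full
      case (inj₂ all) R-min = by-R R-min
        where
        Rm< : R * m < n′ + m
        Rm< = subst (_< n′ + m) (≡.trans (sumℕ-cong R all) (sumℕ-const R m)) lt
        by-R : R ≡ r ⊎ R ≡ n → ⊥
        by-R (inj₁ refl) = ℕₚ.<⇒≱ Rm< (ℕₚ.≤-trans (ℕₚ.≤-pred size′) (ℕₚ.≤-reflexive (ℕₚ.*-comm m r)))
        by-R (inj₂ R≡n) = ℕₚ.<⇒≱ (subst (λ z → z * m < n′ + m) R≡n Rm<)
          (ℕₚ.≤-trans (ℕₚ.+-monoˡ-≤ m (ℕₚ.≤-trans (ℕₚ.≤-reflexive (≡.sym (ℕₚ.*-identityʳ n′))) (ℕₚ.*-monoʳ-≤ n′ 1≤m))) (ℕₚ.≤-reflexive (ℕₚ.+-comm (n′ * m) m)))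

    -- The memory retains only `b` and `x`. The counts `q*` of the selection survive in the proof,
    -- for the comparison with the tree that is built at the end.
    record Solution (b : ℕ) (x : Carrier) : Set ℓ₁ where
      field
        b<n    : b < n
        q*     : ℕ → ℕ
        q*≤b   : ∀ j → j < R → q* j ≤ b
        q*-sum : sumℕ R q* ≡ n′ + b
        value  : x ⊞ ∑ b E ≈ ∑ R (λ j → ∑ (q* j) (λ i → key i j))

    record BestSoFar (m : ℕ) (σ : Store) : Set (a Level.⊔ ℓ₁ Level.⊔ ℓ₂) where
      field
        solution : 1 ≤ nats σ bestᵛ 0 → Solution (nats σ bestᵛ 0) (lens σ bestCostᵛ 0)
        covered  : ∀ {ws} (code : IsPrefixCode n ws) → rowCount code ≤ m → 1 ≤ nats σ bestᵛ 0 × lens σ bestCostᵛ 0 ≼ ∑ᴸ depth ws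

    -- When the search stops, the selection at hand bounds all codes with more rows; through this
    -- invariant the recorded cost does so too.
    Current : ℕ → Store → Set ℓ₂
    Current m σ = 1 ≤ m → n′ + m ≤ sumℕ R (nats σ countᵃ) → 1 ≤ nats σ bestᵛ 0 × lens σ bestCostᵛ 0 ≼ lens σ Sᵛ 0

    record Outer (m : ℕ) (σ : Store) : Set (a Level.⊔ ℓ₁ Level.⊔ ℓ₂) where
      field
        core    : Core m σ
        best    : BestSoFar m σ
        current : Current m σ

    keepBest-exec : ∀ m σ → Core (suc m) σ → BestSoFar m σ → Exec u keepBest σ 60 (Outer (suc m))
    keepBest-exec m σ core best = weaken (ℕₚ.≤ᵇ⇒≤ _ _ _) (branch
        (λ full → branch (λ (Level.lift 1≤b , b≼S) → skipˣ (keep full 1≤b b≼S)) (λ worse → sequence (assignᴺ (assignᴸ (replace full worse)))))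
        (λ ¬full → skipˣ (notFull (ℕₚ.≰⇒> (λ le → ¬full (⇒full base m≡ le))))))
      where
      open Core core
      open BestSoFar best
      split : ∀ {k} → k ≤ suc m → k ≤ m ⊎ k ≡ suc m
      split {k} le with k ℕₚ.≟ suc m
      ... | yes e = inj₂ e
      ... | no ≢ = inj₁ (ℕₚ.≤-pred (ℕₚ.≤∧≢⇒< le ≢))
      notFull : sumℕ R (nats σ countᵃ) < n′ + suc m → Outer (suc m) σ
      notFull lt = record
        { core = core
        ; best = record { solution = solution ; covered = λ code le → case code (split le) }
        ; current = λ _ full → ⊥-elim (ℕₚ.<⇒≱ lt full) }
        where
        case : ∀ {ws} (code : IsPrefixCode n ws) → rowCount code ≤ m ⊎ rowCount code ≡ suc m → 1 ≤ nats σ bestᵛ 0 × lens σ bestCostᵛ 0 ≼ ∑ᴸ depth ws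
        case code (inj₁ le) = covered code le
        case code (inj₂ e) = ⊥-elim (no-small-code core (s≤s z≤n) lt code e)
      keep : Holds fullᵀ σ → 1 ≤ nats σ bestᵛ 0 → lens σ bestCostᵛ 0 ≼ lens σ Sᵛ 0 → Outer (suc m) σ
      keep full 1≤b b≼S = record
        { core = core
        ; best = record { solution = solution ; covered = λ code le → case code (split le) }
        ; current = λ _ _ → 1≤b , b≼S }
        where
        open Full core (full⇒ base m≡ full) (s≤s z≤n)
        case : ∀ {ws} (code : IsPrefixCode n ws) → rowCount code ≤ m ⊎ rowCount code ≡ suc m → 1 ≤ nats σ bestᵛ 0 × lens σ bestCostᵛ 0 ≼ ∑ᴸ depth ws
        case code (inj₁ le) = covered code le
        case code (inj₂ e) = 1≤b , ≼-trans b≼S (code-bound code (inj₁ e))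
      replace : Holds fullᵀ σ → ¬ Holds (and (lit 1 ≤ᴺ var bestᵛ) (load bestCostᵛ (lit 0) ≤ᴸ load Sᵛ (lit 0))) σ →
        Outer (suc m) (store (update (nats σ) bestᵛ 0 (nats σ mᵛ 0)) (update (lens σ) bestCostᵛ 0 (lens σ Sᵛ 0)))
      replace full worse = record
        { core = record
          { base = record { frame = frame-updateᴸ bestCostᵛ 0 _ _ (frame-updateᴺ bestᵛ 0 _ _ B.frame) ; q≤n = B.q≤n ; total≡ = B.total≡ ; cost≈ = B.cost≈ ; keys = B.keys ; tree = B.tree }
          ; m≡ = m≡ ; m<n = m<n ; q≤m = q≤m ; order = order ; total≤ = total≤ ; room = room ; two = two }
        ; best = record
          { solution = λ _ → subst (λ b → Solution b (lens σ Sᵛ 0)) (≡.sym m≡)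
              (record { b<n = m<n ; q* = nats σ countᵃ ; q*≤b = q≤m ; q*-sum = total-eq ; value = B.cost≈ })
          ; covered = λ code le → 1≤m′ , case code (split le) }
        ; current = λ _ _ → 1≤m′ , ≼-refl }
        where
        module B = Base base
        open Full core (full⇒ base m≡ full) (s≤s z≤n)
        1≤m′ : 1 ≤ nats σ mᵛ 0
        1≤m′ = ℕₚ.≤-trans (s≤s z≤n) (ℕₚ.≤-reflexive (≡.sym m≡))
        case : ∀ {ws} (code : IsPrefixCode n ws) → rowCount code ≤ m ⊎ rowCount code ≡ suc m → lens σ Sᵛ 0 ≼ ∑ᴸ depth ws
        case code (inj₁ le) = let (1≤b , b≼) = covered code le in ≼-trans (≺⇒≼ (λ b≼S → worse (Level.lift 1≤b , b≼S))) b≼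
        case code (inj₂ e) = code-bound code (inj₁ e)

    inner-≤κ : ∀ {σ₁ ρ j σ} → ρ < n → Inner σ₁ ρ j σ → j ≤ κ (suc ρ)
    inner-≤κ {ρ = ρ} {j} ρ<n inner = ≤κ ρ j≤R (ℕₚ.≤-trans (sumℕ-prefix R _ j (suc ρ) j≤R (Selection.done sel))
      (ℕₚ.≤-trans total≤ (ℕₚ.+-mono-≤ (ℕₚ.n≤1+n n′) ρ<n)))
      where open Inner inner

    -- The first test is known to succeed, so at least two children of the row end up selected. The
    -- fuel is one less than the length of the row because the first child precedes the loop.
    row-loop : ∀ {σ₁ ρ σ} → ρ < n → Inner σ₁ ρ 1 σ → Holds moreᵀ σ →
      Exec u (while moreᵀ loop exchange) σ (loopCost (timeᵀ moreᵀ) (λ _ → 420) (κ (suc ρ))) (λ τ → ∃[ j ] 2 ≤ j × Inner σ₁ ρ j τ × ¬ Holds moreᵀ τ)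
    row-loop {σ₁} {ρ} {σ} ρ<n inner more = consequence finish (iterate I (λ _ → 420) body (κ (suc ρ)) σ (1 , refl , inner , inj₂ more))
      where
      I : ℕ → Store → Set _
      I f τ = ∃[ j ] j + f ≡ suc (κ (suc ρ)) × Inner σ₁ ρ j τ × (2 ≤ j ⊎ Holds moreᵀ τ)
      body : ∀ f τ → I f τ → Holds moreᵀ τ → ∃[ f′ ] f ≡ suc f′ × Exec u exchange τ 420 (I f′)
      body zero τ (j , j+f , inner , _) more = ⊥-elim (ℕₚ.<⇒≱ (s≤s (inner-≤κ ρ<n inner)) (ℕₚ.≤-reflexive (≡.trans (≡.sym j+f) (ℕₚ.+-identityʳ j))))
      body (suc f) τ (j , j+f , inner , _) more = f , refl ,
        consequence (λ inner′ → suc j , ≡.trans (≡.sym (ℕₚ.+-suc j f)) j+f , inner′ , inj₁ (s≤s (Inner.1≤j inner))) (exchange-exec ρ<n inner more)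
      finish : ∀ {τ} → (∃[ f ] I f τ × ¬ Holds moreᵀ τ) → ∃[ j ] 2 ≤ j × Inner σ₁ ρ j τ × ¬ Holds moreᵀ τ
      finish (f , (j , _ , inner , inj₁ 2≤j) , stop) = j , 2≤j , inner , stop
      finish (f , (j , _ , inner , inj₂ more) , stop) = ⊥-elim (stop more)

    inner⇒core : ∀ {σ₁ ρ j σ} → ρ < n → 2 ≤ j → Inner σ₁ ρ j σ → ¬ Holds moreᵀ σ → Core (suc ρ) σ
    inner⇒core {σ₁} {ρ} {j} {σ} ρ<n 2≤j inner stop = record
      { base = base ; m≡ = m≡
      -- The first two letters contribute twice the number of rows to a selection of at most
      -- `n′ + suc ρ` children.
      ; m<n = s≤s (ℕₚ.+-cancelʳ-≤ (suc ρ) (suc ρ) n′ (ℕₚ.≤-trans (ℕₚ.≤-reflexive (cong (suc ρ +_) (≡.sym (ℕₚ.+-identityʳ (suc ρ)))))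
                (ℕₚ.≤-trans (sumℕ-prefix R q 2 (suc ρ) 2≤R two′) total≤)))
      ; q≤m = q≤m ; order = order′ ; total≤ = total≤ ; room = room′ exit ; two = inj₂ two′ }
      where
      open Inner inner
      open Base base hiding (frame)
      open Selection sel
      two′ : ∀ i → i < 2 → q i ≡ suc ρ
      two′ i i<2 = done i (ℕₚ.<-≤-trans i<2 2≤j)
      q≤m : ∀ i → i < R → q i ≤ suc ρ
      q≤m i i<R with i ℕₚ.<? j
      ... | yes i<j = ℕₚ.≤-reflexive (done i i<j)
      ... | no i≮j = ℕₚ.m≤n⇒m≤1+n (todo i (ℕₚ.≮⇒≥ i≮j) i<R)
      some : 1 ≤ sumℕ R q
      some = ℕₚ.≤-trans (s≤s z≤n) (sumℕ-prefix R q 2 (suc ρ) 2≤R two′)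
      open BaseLemmas base some
      exit : j ≡ R ⊎ (n′ + suc ρ ≤ sumℕ R q × D ≼ key ρ j)
      exit with j ℕₚ.<? R
      ... | no j≮R = inj₁ (ℕₚ.≤-antisym j≤R (ℕₚ.≮⇒≥ j≮R))
      ... | yes j<R with decideᵀ (uselessᵀ (var mᵛ ⊖ lit 1) (var jᵛ)) σ
      ...   | inj₁ (_ , full , le) = inj₂ (full⇒ base m≡ full , ≼-respˡ D-value (≼-respʳ (≈-reflexive (key-eval base (cong (_∸ 1) m≡) j≡)) le))
      ...   | inj₂ (_ , useful) = ⊥-elim (stop (Level.lift (≡.subst₂ _<_ (≡.sym j≡) (≡.sym (R≡ env)) j<R) , useful))
      room′ : j ≡ R ⊎ (n′ + suc ρ ≤ sumℕ R q × D ≼ key ρ j) → n′ + suc ρ ≤ sumℕ R q ⊎ (∀ i → i < R → q i ≡ suc ρ)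
      room′ (inj₁ refl) = inj₂ done
      room′ (inj₂ (full , _)) = inj₁ full
      order′ : ∀ i j₁ j₂ → i < suc ρ → j₁ < R → q j₁ ≤ i → j₂ < R → 1 ≤ q j₂ → key (q j₂ ∸ 1) j₂ ≼ key i j₁
      order′ i j₁ j₂ i≤ρ j₁<R q≤i j₂<R 1≤q with i ℕₚ.≟ ρ
      ... | no i≢ρ = order i j₁ j₂ (below i≤ρ i≢ρ) j₁<R q≤i j₂<R 1≤q
      ... | yes refl = last exit (ℕₚ.≮⇒≥ (λ j₁<j → ℕₚ.<⇒≱ (ℕₚ.≤-reflexive (≡.sym (done j₁ j₁<j))) q≤i))
        where
        last : j ≡ R ⊎ (n′ + suc ρ ≤ sumℕ R q × D ≼ key ρ j) → j ≤ j₁ → key (q j₂ ∸ 1) j₂ ≼ key ρ j₁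
        last (inj₁ refl) j≤j₁ = ⊥-elim (ℕₚ.<⇒≱ j₁<R j≤j₁)
        last (inj₂ (_ , D≼)) j≤j₁ = ≼-trans (top≼D j₂<R 1≤q) (≼-trans D≼ (key-mono ℕₚ.≤-refl ρ<n j≤j₁ (ℕₚ.<-≤-trans j₁<R R≤r)))

    addRow-exec : ∀ m σ → Outer m σ → ¬ Holds (uselessᵀ (var mᵛ) (lit 1)) σ → Exec u addRow σ (500 + κ (suc m) * 470) (Outer (suc m))
    addRow-exec m σ outer useful = weaken cost (sequence (assignᴸ (sequence (assignᴺ (sequence (assignᴺ (sequence {k = 200} {l = loopCost (timeᵀ moreᵀ) (λ _ → 420) (κ (suc m)) + 60} (consequence after-add first))))))))
      where
      open Outer outer
      open Core core
      open Base base hiding (frame)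
      σ₁ = store (update (update (nats σ) mᵛ 0 (suc (nats σ mᵛ 0))) jᵛ 0 0) (update (lens σ) Sᵛ 0 (lens σ Sᵛ 0 ⊞ ⊟ lens σ depthᵃ (nats σ mᵛ 0)))
      φ : Frame rowᴺ rowᴸ σ σ₁
      φ = frame-updateᴺ jᵛ 0 _ _ (frame-updateᴺ mᵛ 0 _ _ (frame-updateᴸ Sᵛ 0 _ _ frame-refl))
      base₁ : Base (suc m) σ₁
      base₁ = record
        { frame = frame-trans (Base.frame base) (frame-weaken _ _ φ) ; q≤n = q≤n ; total≡ = total≡
        ; cost≈ = ≈-trans (+-congʳ (+-congˡ (-‿cong (≈-reflexive (≡.trans (same-lens (Base.frame base) depthᵃ _ _) (cong E m≡))))))
            (≈-trans (solve 3 (λ s e t → s :+ :- e :+ (e :+ t) ⊜ s :+ t) ≈-refl _ _ _) cost≈)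
        ; keys = keys ; tree = tree }
      0<R = 1≤R
      status : (sumℕ R q < n′ + m × (∀ j → j < R → q j ≡ m)) ⊎ (Σ[ full ∈ n′ + m ≤ sumℕ R q ] key m 1 ≺ D × 1 ≤ sumℕ R q)
      status with sumℕ R q ℕₚ.<? n′ + m
      ... | yes lt = inj₁ (lt , all room)
        where
        all : n′ + m ≤ sumℕ R q ⊎ (∀ j → j < R → q j ≡ m) → ∀ j → j < R → q j ≡ m
        all (inj₁ le) = ⊥-elim (ℕₚ.<⇒≱ lt le)
        all (inj₂ eq) = eq
      ... | no ≮ = inj₂ (full , (λ D≼ → useful (⇒full base m≡ full , ≼-respˡ (≈-sym D-value) (≼-respʳ (≈-reflexive (≡.sym (key-eval base m≡ refl))) D≼))) , some)
        where
        full = ℕₚ.≮⇒≥ ≮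
        some : 1 ≤ sumℕ R q
        some = ℕₚ.≤-trans (ℕₚ.≤-trans (ℕₚ.≤-pred n-large) (ℕₚ.m≤m+n n′ m)) full
        open BaseLemmas base some
      After : Store → Set _
      After τ = Inner σ m 1 τ × (∀ i → i ≢ 0 → nats τ countᵃ i ≡ q i) × sumℕ R (nats τ countᵃ) ≡ suc (sumℕ R q)
      total-left : suc (sumℕ R q) ≤ n′ + suc m
      total-left = ℕₚ.≤-trans (s≤s total≤) (ℕₚ.≤-reflexive (≡.sym (ℕₚ.+-suc n′ m)))
      0+1 : ∀ τ → nats τ jᵛ 0 ≡ 0 → evalᴺ (lit 1) τ ≡ 1
      0+1 _ _ = refl
      first : Exec u (add ⨾ jᵛ ≔ lit 1) σ₁ 200 After
      first with status
      ... | inj₁ (lt , all) = add-step base₁ φ (cong suc m≡) refl 0<R m<n (all 0 0<R) total-left (inj₂ (λ i _ i<R → all i i<R))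
              (selection-all q (λ _ ()) (λ i _ i<R → all i i<R)) _ (ℕₚ.≤ᵇ⇒≤ _ _ _) 0+1
      ... | inj₂ (full , cheaper , some) = add-step base₁ φ (cong suc m≡) refl 0<R m<n
              (cheaper⇒q≡ρ base some m<n 0<R (q≤m 0 0<R) outs cheaper₀) total-left
              (inj₁ (ℕₚ.≤-trans (ℕₚ.≤-reflexive (ℕₚ.+-suc n′ m)) (s≤s full)))
              (selection-add q D (λ _ ()) (λ i _ → q≤m i) (≺⇒≼ cheaper₀) (λ i i<R → top≼D i<R) outs) _ (ℕₚ.≤ᵇ⇒≤ _ _ _) 0+1
        where
        open BaseLemmas base some
        outs : ∀ i j₁ → i < m → j₁ < R → q j₁ ≤ i → D ≼ key i j₁
        outs i j₁ i<m j₁<R q≤i = order i j₁ w i<m j₁<R q≤i w<R 1≤qw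
        cheaper₀ : key m 0 ≺ D
        cheaper₀ = ≼-≺-trans (key-mono ℕₚ.≤-refl m<n z≤n (ℕₚ.≤-trans 2≤R R≤r)) cheaper
      -- If there was room before the row, there still is, as the quota grew by one and one child
      -- entered. Otherwise the deepest selected child is still at depth at least `D`, because its
      -- letter is not 0 and nothing was removed; so the second child still beats it, as the outer
      -- test had found.
      more : ∀ {τ} → After τ → Holds moreᵀ τ
      more {τ} (inner , off , sum≡) = Level.lift (≡.subst₂ _<_ (≡.sym I.j≡) (≡.sym (R≡ (Base.env I.base))) 2≤R) , λ (full′ , le) → absurd (full⇒ I.base I.m≡ full′) le status
        where
        module I = Inner inner
        absurd : n′ + suc m ≤ sumℕ R (nats τ countᵃ) → 0# ⊞ ⊟ lens τ keyᵃ (nats τ winnerᵃ 1) ≼ lens τ depthᵃ (nats τ mᵛ 0 ∸ 1) ⊞ lens τ lengthᵃ (nats τ jᵛ 0) →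
          (sumℕ R q < n′ + m × (∀ j → j < R → q j ≡ m)) ⊎ (Σ[ full ∈ n′ + m ≤ sumℕ R q ] key m 1 ≺ D × 1 ≤ sumℕ R q) → ⊥
        absurd full′ le (inj₁ (lt , _)) = ℕₚ.<⇒≱ (ℕₚ.≤-trans (s≤s lt) (ℕₚ.≤-reflexive (≡.sym (ℕₚ.+-suc n′ m)))) (ℕₚ.≤-trans full′ (ℕₚ.≤-reflexive sum≡))
        absurd full′ le (inj₂ (full , cheaper , some)) = cheaper (≼-trans D≼D′ (≼-respˡ (BL.D-value) (≼-respʳ (≈-reflexive (key-eval I.base (cong (_∸ 1) I.m≡) I.j≡)) le)))
          where
          open BaseLemmas base some
          module BL = BaseLemmas I.base (ℕₚ.≤-trans (ℕₚ.≤-trans (s≤s z≤n) (ℕₚ.m≤n+m (suc m) n′)) full′)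
          w≢0 : w ≢ 0
          w≢0 e = cheaper (key-mono (ℕₚ.≤-trans (ℕₚ.m∸n≤m (q w) 1) (q≤m w w<R)) m<n (ℕₚ.≤-trans (ℕₚ.≤-reflexive e) z≤n) (ℕₚ.≤-trans 2≤R R≤r))
          D≼D′ : D ≼ Base.D I.base
          D≼D′ = subst (λ k → key (k ∸ 1) w ≼ Base.D I.base) (off w w≢0) (BL.top≼D w<R (ℕₚ.≤-trans 1≤qw (ℕₚ.≤-reflexive (≡.sym (off w w≢0)))))
      after-add : ∀ {τ} → After τ → Exec u ((while moreᵀ loop exchange) ⨾ keepBest) τ (loopCost (timeᵀ moreᵀ) (λ _ → 420) (κ (suc m)) + 60) (Outer (suc m))
      after-add after@(inner , _) = sequence (consequence (λ {τ} (j , 2≤j , inner′ , stop) →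
        keepBest-exec m τ (inner⇒core m<n 2≤j inner′ stop) (transport (Inner.frame inner′))) (row-loop m<n inner (more after)))
        where
        transport : ∀ {τ} → Frame rowᴺ rowᴸ σ τ → BestSoFar m τ
        transport {τ} fr = record
          { solution = λ 1≤b → ≡.subst₂ Solution (≡.sym b≡) (≡.sym x≡) (BestSoFar.solution best (subst (1 ≤_) b≡ 1≤b))
          ; covered = λ code le → let (1≤b , b≼) = BestSoFar.covered best code le in subst (1 ≤_) (≡.sym b≡) 1≤b , subst (_≼ _) (≡.sym x≡) b≼ }
          where
          b≡ = same-nats fr bestᵛ 0 _
          x≡ = same-lens fr bestCostᵛ 0 _
      cost : 8 + (6 + (3 + (200 + (loopCost (timeᵀ moreᵀ) (λ _ → 420) (κ (suc m)) + 60)))) ≤ 500 + κ (suc m) * 470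
      cost = ℕₚ.≤-trans (ℕₚ.≤-reflexive (cong (217 +_) (≡.trans (cong (_+ 60) (loopCost-const (timeᵀ moreᵀ) 420 k)) (ℕₚ.+-comm (timeᵀ moreᵀ + k * (timeᵀ moreᵀ + 420)) 60))))
        (ℕₚ.+-mono-≤ (ℕₚ.≤ᵇ⇒≤ (277 + timeᵀ moreᵀ) 500 _) (ℕₚ.*-monoʳ-≤ k (ℕₚ.≤ᵇ⇒≤ (timeᵀ moreᵀ + 420) 470 _)))
        where k = κ (suc m)

    record Found (τ : Store) : Set (a Level.⊔ ℓ₁ Level.⊔ ℓ₂) where
      field
        frame    : Frame searchᴺ searchᴸ σ₀ τ
        1≤b      : 1 ≤ nats τ bestᵛ 0
        solution : Solution (nats τ bestᵛ 0) (lens τ bestCostᵛ 0)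
        optimal  : ∀ ws → IsPrefixCode n ws → lens τ bestCostᵛ 0 ≼ ∑ᴸ depth ws

    -- The terms are at most 2 ^ suc u and so have `suc (suc u)` binary digits. The rows are counted
    -- backwards, as fuel.
    κ-sum : sumℕ n (λ f → κ (n ∸ f)) ≤ suc (suc u) * (n + n)
    κ-sum = ℕₚ.≤-trans (ℕₚ.≤-reflexive (sumℕ-reverse n κ)) (sumℕ-harmonic (suc (suc u)) n (n + n) (λ i → κ (suc i))
      (λ i _ → ℕₚ.≤-trans (ℕₚ.*-monoˡ-≤ (suc i) (ℕₚ.m⊓n≤n R ((n + n) / suc i))) (DivMod.m/n*n≤m (n + n) (suc i)))
      (λ i _ → ℕₚ.≤-<-trans (ℕₚ.≤-trans (ℕₚ.m⊓n≤m R ((n + n) / suc i)) R≤2^1+u) (ℕₚ.^-monoʳ-< 2 (s≤s (s≤s z≤n)) (ℕₚ.n<1+n (suc u)))))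

    -- Fuel `n` suffices since `Core` keeps the number of rows below `n`. At the end, codes with at
    -- most `m` rows are covered by the record; those with more are bounded by the current
    -- selection, because the failed test places the second child of node `m` at depth at least D.
    search-exec : R ≤ n → Exec u search σ₀ (n * u * 4000) Found
    search-exec R≤n = weaken cost (sequence (consequence after-clear (clear-exec σ₀ env₀)))
      where
      continueᵀ = neg (uselessᵀ (var mᵛ) (lit 1))
      k : ℕ → ℕ
      k f = 500 + κ (n ∸ f) * 470
      I : ℕ → Store → Set _
      I f σ = ∃[ m ] m + f ≡ n × Outer m σ
      body : ∀ f σ → I f σ → Holds continueᵀ σ → ∃[ f′ ] f ≡ suc f′ × Exec u addRow σ (k f′) (I f′)
      body zero σ (m , m+0 , outer) _ = ⊥-elim (ℕₚ.<⇒≢ (Core.m<n (Outer.core outer)) (≡.trans (≡.sym (ℕₚ.+-identityʳ m)) m+0))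
      body (suc f) σ (m , m+f , outer) useful = f , refl , subst (λ z → Exec u addRow σ (500 + κ z * 470) (I f)) (≡.sym row≡)
          (consequence {k = 500 + κ (suc m) * 470} (λ outer′ → suc m , m+f′ , outer′) (addRow-exec m σ outer useful))
        where
        m+f′ : suc m + f ≡ n
        m+f′ = ≡.trans (≡.sym (ℕₚ.+-suc m f)) m+f
        row≡ : n ∸ f ≡ suc m
        row≡ = ≡.trans (cong (_∸ f) (≡.sym m+f′)) (ℕₚ.m+n∸n≡m (suc m) f)
      finish : ∀ {τ} → (∃[ f ] I f τ × ¬ Holds continueᵀ τ) → Found τ
      finish {τ} (_ , (m , _ , outer) , stop) with decideᵀ (uselessᵀ (var mᵛ) (lit 1)) τ
      ... | inj₂ (_ , useful) = ⊥-elim (stop useful)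
      ... | inj₁ (_ , fullᵗ , le) = record
            { frame = Base.frame base ; 1≤b = proj₁ now ; solution = BestSoFar.solution best (proj₁ now)
            ; optimal = λ ws code → by-rows code (rowCount code ℕₚ.≤? m) }
        where
        open Outer outer
        open Core core
        full : n′ + m ≤ sumℕ R (nats τ countᵃ)
        full = full⇒ base m≡ fullᵗ
        1≤m : 1 ≤ m
        1≤m with m ℕₚ.≟ 0
        ... | no ≢0 = ℕₚ.n≢0⇒n>0 ≢0
        -- Before the first row nothing is selected, while the quota is `n′`, which is positive.
        ... | yes m≡0 = ⊥-elim (ℕₚ.<⇒≱ (ℕₚ.≤-pred n-large) (ℕₚ.≤-trans (ℕₚ.≤-trans (ℕₚ.m≤m+n n′ m) full)
                (ℕₚ.≤-reflexive (≡.trans (sumℕ-cong R (λ j j<R → ℕₚ.n≤0⇒n≡0 (ℕₚ.≤-trans (q≤m j j<R) (ℕₚ.≤-reflexive m≡0)))) (≡.trans (sumℕ-const R 0) (ℕₚ.*-zeroʳ R))))))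
        open Full core full 1≤m
        now = current 1≤m full
        by-rows : ∀ {ws} (code : IsPrefixCode n ws) → Dec (rowCount code ≤ m) → lens τ bestCostᵛ 0 ≼ ∑ᴸ depth ws
        by-rows code (yes le) = proj₂ (BestSoFar.covered best code le)
        by-rows code (no gt) = ≼-trans (proj₂ now) (code-bound code (inj₂ (ℕₚ.≰⇒> gt , ≼-respˡ D-value (≼-respʳ (≈-reflexive (key-eval base m≡ refl)) le))))
      after-clear : ∀ {τ₁} → Cleared σ₀ τ₁ → Exec u _ τ₁ _ Found
      after-clear {τ₁} cleared = sequence (consequence after-build (build-exec u 1≤u 1≤R τ₁ (R≡ (frame-env _ _ _ C.frame env₀)) C.leaves))
        where
        module C = Cleared cleared
        after-build : ∀ {τ₂} → OnlyWinners τ₁ τ₂ × Tree (nats τ₂ winnerᵃ) (lens τ₁ keyᵃ) → Exec u _ τ₂ (3 + (3 + (4 + (3 + loopCost (timeᵀ continueᵀ) k n)))) Found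
        after-build {τ₂} (only , tree) = sequence (assignᴺ (sequence (assignᴺ (sequence (assignᴸ (sequence (assignᴺ
            (consequence finish (iterate I k body n _ (0 , refl , start))))))))))
          where
          q≡0 : ∀ j → j < R → nats τ₂ countᵃ j ≡ 0
          q≡0 j j<R = ≡.trans (same-nats (frame-winners only) countᵃ j _) (C.zeroes j j<R)
          sum≡0 : sumℕ R (nats τ₂ countᵃ) ≡ 0
          sum≡0 = ≡.trans (sumℕ-cong R q≡0) (≡.trans (sumℕ-const R 0) (ℕₚ.*-zeroʳ R))
          K≡ : ∀ j → lens τ₂ keyᵃ j ≡ lens τ₁ keyᵃ j
          K≡ j = cong (λ l → l keyᵃ j) (OnlyWinners.same-lens only)
          start : Outer 0 _
          start = record
            { core = record
              { base = record
                { frame = frame-updateᴺ bestᵛ 0 _ _ (frame-updateᴸ Sᵛ 0 _ _ (frame-updateᴺ totalᵛ 0 _ _ (frame-updateᴺ mᵛ 0 _ _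
                    (frame-trans (frame-weaken _ _ C.frame) (frame-weaken _ _ (frame-winners only))))))
                ; q≤n = λ j j<R → ℕₚ.≤-trans (ℕₚ.≤-reflexive (q≡0 j j<R)) z≤n
                ; total≡ = ≡.sym sum≡0
                ; cost≈ = ≈-trans (+-identityʳ 0#) (≈-sym (≈-trans (∑-cong R (λ j j<R → ≈-reflexive (cong (λ z → ∑ z (λ i → key i j)) (q≡0 j j<R)))) (∑-zero R)))
                ; keys = λ j j<R → (λ 1≤q → ⊥-elim (ℕₚ.<⇒≢ 1≤q (≡.sym (q≡0 j j<R)))) , (λ _ → ≡.trans (K≡ j) (C.ones j j<R))
                ; tree = subst (λ l → Tree (nats τ₂ winnerᵃ) (l keyᵃ)) (≡.sym (OnlyWinners.same-lens only)) tree }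
              ; m≡ = refl ; m<n = s≤s z≤n ; q≤m = λ j j<R → ℕₚ.≤-reflexive (q≡0 j j<R)
              ; order = λ _ _ _ () ; total≤ = ℕₚ.≤-trans (ℕₚ.≤-reflexive sum≡0) z≤n ; room = inj₂ q≡0 ; two = inj₁ refl }
            ; best = record { solution = λ () ; covered = λ code le → ⊥-elim (none code le) }
            ; current = λ () }
            where
            none : ∀ {ws} (code : IsPrefixCode n ws) → ¬ rowCount code ≤ 0
            none {ws} code le = ℕₚ.<⇒≱ n-large (ℕₚ.≤-trans (ℕₚ.m≤m+n n 0)
              (subst (λ z → n + z ≤ suc (z * r)) (ℕₚ.n≤0⇒n≡0 le) (subst (λ l → l + rowCount code ≤ suc (rowCount code * r)) (IsPrefixCode.size code) (Decomposed.size (code-decomposition (s≤s z≤n) code)))))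
      tb = timeᵀ continueᵀ
      cost : R * 50 + (R * 50 + (3 + (3 + (4 + (3 + loopCost tb k n))))) ≤ n * u * 4000
      cost = begin
        R * 50 + (R * 50 + (13 + loopCost tb k n))
          ≤⟨ ℕₚ.+-mono-≤ (ℕₚ.*-monoˡ-≤ 50 R≤n) (ℕₚ.+-mono-≤ (ℕₚ.*-monoˡ-≤ 50 R≤n) (ℕₚ.+-monoʳ-≤ 13 loop≤)) ⟩
        n * 50 + (n * 50 + (13 + (50 + (n * 550 + suc (suc u) * (n + n) * 470))))
          ≤⟨ ℕₚ.+-mono-≤ (grow 50) (ℕₚ.+-mono-≤ (grow 50) (ℕₚ.+-mono-≤ (grow₁ 13) (ℕₚ.+-mono-≤ (grow₁ 50) (ℕₚ.+-mono-≤ (grow 550) levels)))) ⟩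
        N * 50 + (N * 50 + (N * 13 + (N * 50 + (N * 550 + N * 2820))))
          ≡⟨ collect N ⟩
        N * 3533 ≤⟨ ℕₚ.*-monoʳ-≤ N (ℕₚ.≤ᵇ⇒≤ 3533 4000 _) ⟩
        N * 4000 ∎
        where
        open ℕₚ.≤-Reasoning
        N = n * u
        n≤N : n ≤ N
        n≤N = ℕₚ.≤-trans (ℕₚ.≤-reflexive (≡.sym (ℕₚ.*-identityʳ n))) (ℕₚ.*-monoʳ-≤ n 1≤u)
        grow : ∀ z → n * z ≤ N * z
        grow z = ℕₚ.*-monoˡ-≤ z n≤N
        grow₁ : ∀ z → z ≤ N * z
        grow₁ z = ℕₚ.≤-trans (ℕₚ.≤-reflexive (≡.sym (ℕₚ.*-identityˡ z))) (ℕₚ.*-monoˡ-≤ z (ℕₚ.≤-trans (s≤s z≤n) n≤N))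
        levels : suc (suc u) * (n + n) * 470 ≤ N * 2820
        levels = begin
          suc (suc u) * (n + n) * 470 ≤⟨ ℕₚ.*-monoˡ-≤ 470 (ℕₚ.*-monoˡ-≤ (n + n) (ℕₚ.+-mono-≤ 1≤u (ℕₚ.+-mono-≤ 1≤u (ℕₚ.≤-refl {u})))) ⟩
          (u + (u + u)) * (n + n) * 470 ≡⟨ rearrange u n ⟩
          n * u * 2820 ∎
        loop≤ : loopCost tb k n ≤ 50 + (n * 550 + suc (suc u) * (n + n) * 470)
        loop≤ = begin
          loopCost tb k n ≡⟨ loopCost-sum tb k n ⟩
          tb + sumℕ n (λ f → (tb + 500) + κ (n ∸ f) * 470) ≡⟨ cong (tb +_) (≡.trans (sumℕ-+ n (λ _ → tb + 500) (λ f → κ (n ∸ f) * 470)) (≡.cong₂ _+_ (sumℕ-const n (tb + 500)) (sumℕ-*ʳ n (λ f → κ (n ∸ f)) 470))) ⟩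
          tb + (n * (tb + 500) + sumℕ n (λ f → κ (n ∸ f)) * 470)
            ≤⟨ ℕₚ.+-mono-≤ (ℕₚ.≤ᵇ⇒≤ tb 50 _) (ℕₚ.+-mono-≤ (ℕₚ.*-monoʳ-≤ n (ℕₚ.≤ᵇ⇒≤ (tb + 500) 550 _)) (ℕₚ.*-monoˡ-≤ 470 κ-sum)) ⟩
          50 + (n * 550 + suc (suc u) * (n + n) * 470) ∎

-- Code trees and their representation in memory.

module _ {r n : ℕ} (tree : CodeTree r n) where
  open CodeTree tree

  prefix∈nodes : ∀ v {u} → u ++ v ∈ nodes → u ∈ nodes
  prefix∈nodes [] {u} u∈ = subst (_∈ nodes) (Listₚ.++-identityʳ u) u∈
  prefix∈nodes (x ∷ v) {u} u∈ = parent∈nodes (prefix∈nodes v (subst (_∈ nodes) (≡.sym (Listₚ.∷ʳ-++ u x v)) u∈))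

  prefix-rest : ∀ {u v : Word r} → Prefix _≡_ u v → ∃[ w ] v ≡ u ++ w
  prefix-rest {v = v} [] = v , refl
  prefix-rest (refl ∷ p) = let (w , e) = prefix-rest p in w , cong (_ ∷_) e

  -- The nodes are closed under prefixes, so a longer codeword would put a child of the shorter one
  -- among the nodes, although terminals are leaves.
  terminals-prefixFree : PrefixFree terminals
  terminals-prefixFree {u} u∈ v∈ u≢v u≤v with prefix-rest u≤v
  ... | [] , refl = u≢v (≡.sym (Listₚ.++-identityʳ u))
  ... | x ∷ w , refl = terminals-leaves u∈ (prefix∈nodes w (subst (_∈ nodes) (≡.sym (Listₚ.∷ʳ-++ u x w)) (terminals⊆nodes v∈)))

  codewords-isPrefixCode : IsPrefixCode n codewords
  codewords-isPrefixCode = record { unique = terminals-unique ; size = terminals-size ; prefixFree = terminals-prefixFree }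

snoc≢[] : ∀ {A : Set} {w : List A} {x} → w ∷ʳ x ≢ []
snoc≢[] {w = []} ()
snoc≢[] {w = _ ∷ _} ()

-- Nodes 0, …, b - 1 are the inner nodes and b, …, b + n - 1 the terminals.
record Layout (r n b : ℕ) : Set where
  field
    path      : ℕ → Word r
    par       : ℕ → ℕ
    letter    : ℕ → Fin r
    path-root : path 0 ≡ []
    path-edge : ∀ s → 1 ≤ s → s < b + n → path s ≡ path (par s) ∷ʳ letter s
    par<self  : ∀ s → 1 ≤ s → s < b + n → par s < s
    par<b     : ∀ s → 1 ≤ s → s < b + n → par s < b
    injective : ∀ s s′ → s < b + n → s′ < b + n → path s ≡ path s′ → s ≡ s′

-- `N` is a parameter of its own because the node count read from memory equals `b + n` only
-- propositionally; nodes indexed by `Fin N` fit `Represents` without transport.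
module LayoutTree {r n b : ℕ} (1≤n : 1 ≤ n) (layout : Layout r n b) (N : ℕ) (N≡ : N ≡ b + n) where
  open Layout layout

  word : Fin N → Word r
  word v = path (toℕ v)

  terminal : Fin n → Word r
  terminal i = path (b + toℕ i)

  bound : (v : Fin N) → toℕ v < b + n
  bound v = ℕₚ.<-≤-trans (Finₚ.toℕ<n v) (ℕₚ.≤-reflexive N≡)

  terminal-bound : (i : Fin n) → b + toℕ i < b + n
  terminal-bound i = ℕₚ.+-monoʳ-< b (Finₚ.toℕ<n i)

  node∈ : ∀ s → s < b + n → path s ∈ tabulate word
  node∈ s s< = subst (_∈ tabulate word) (cong path (Finₚ.toℕ-fromℕ< s<N)) (∈ₚ.∈-tabulate⁺ (fromℕ< s<N))
    where s<N = ℕₚ.<-≤-trans s< (ℕₚ.≤-reflexive (≡.sym N≡))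

  ∈node : ∀ {w} → w ∈ tabulate word → ∃[ s ] s < b + n × w ≡ path s
  ∈node w∈ = let (v , e) = ∈ₚ.∈-tabulate⁻ w∈ in toℕ v , bound v , e

  parent-of : ∀ {w i} → w ∷ʳ i ∈ tabulate word → ∃[ s ] 1 ≤ s × s < b + n × w ≡ path (par s)
  parent-of {w} {i} w∈ with ∈node w∈
  ... | zero , _ , e = ⊥-elim (snoc≢[] (≡.trans e path-root))
  ... | suc s , s< , e = suc s , s≤s z≤n , s< , proj₁ (Listₚ.∷ʳ-injective w _ (≡.trans e (path-edge (suc s) (s≤s z≤n) s<)))

  codeTree : CodeTree r n
  codeTree = record
    { nodes = tabulate word
    ; nodes-unique = Uniqueₚ.tabulate⁺ (λ {v} {v′} e → Finₚ.toℕ-injective (injective _ _ (bound v) (bound v′) e))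
    ; root∈nodes = subst (_∈ tabulate word) path-root (node∈ 0 (ℕₚ.≤-trans 1≤n (ℕₚ.m≤n+m n b)))
    ; parent∈nodes = λ w∈ → let (s , 1≤s , s< , e) = parent-of w∈ in
        subst (_∈ tabulate word) (≡.sym e) (node∈ (par s) (ℕₚ.<-trans (par<self s 1≤s s<) s<))
    ; terminals = tabulate terminal
    ; terminals-unique = Uniqueₚ.tabulate⁺ (λ {i} {i′} e → Finₚ.toℕ-injective (ℕₚ.+-cancelˡ-≡ b _ _ (injective _ _ (terminal-bound i) (terminal-bound i′) e)))
    ; terminals-size = Listₚ.length-tabulate terminal
    ; terminals⊆nodes = λ w∈ → let (i , e) = ∈ₚ.∈-tabulate⁻ w∈ in subst (_∈ tabulate word) (≡.sym e) (node∈ (b + toℕ i) (terminal-bound i))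
    ; terminals-leaves = λ w∈ child∈ → let (i , e) = ∈ₚ.∈-tabulate⁻ w∈
                                           (s , 1≤s , s< , e′) = parent-of child∈ in
        ℕₚ.<⇒≱ (par<b s 1≤s s<) (ℕₚ.≤-trans (ℕₚ.m≤m+n b (toℕ i)) (ℕₚ.≤-reflexive
          (injective _ _ (terminal-bound i) (ℕₚ.<-trans (par<self s 1≤s s<) s<) (≡.trans (≡.sym e) e′))))
    }

  terminal∈ : ∀ s → b ≤ s → s < b + n → path s ∈ tabulate terminal
  terminal∈ s b≤s s< = subst (_∈ tabulate terminal) (cong path (≡.trans (cong (b +_) (Finₚ.toℕ-fromℕ< s∸b<n)) (ℕₚ.m+[n∸m]≡n b≤s))) (∈ₚ.∈-tabulate⁺ (fromℕ< s∸b<n))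
    where
    s∸b<n : s ∸ b < n
    s∸b<n = ℕₚ.+-cancelˡ-< b _ _ (ℕₚ.≤-<-trans (ℕₚ.≤-reflexive (ℕₚ.m+[n∸m]≡n b≤s)) s<)

  ∈terminal : ∀ s → s < b + n → path s ∈ tabulate terminal → b ≤ s
  ∈terminal s s< s∈ = let (i , e) = ∈ₚ.∈-tabulate⁻ s∈ in
    ℕₚ.≤-trans (ℕₚ.m≤m+n b (toℕ i)) (ℕₚ.≤-reflexive (≡.sym (injective _ _ s< (terminal-bound i) e)))

module TreeOutput {a ℓ₁ ℓ₂} (F : OrderedField a ℓ₁ ℓ₂) where
  open OrderedFieldLemmas F
  open Sums F
  open Cost F
  open Execution F

  layout-represents : ∀ {r n b} (1≤n : 1 ≤ n) (layout : Layout r n b) (σ : Store) (N≡ : nats σ 1 0 ≡ b + n) →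
    (∀ s → 1 ≤ s → s < b + n → nats σ parentᵃ s ≡ Layout.par layout s) →
    (∀ s → 1 ≤ s → s < b + n → nats σ letterᵃ s ≡ toℕ (Layout.letter layout s)) →
    (∀ s → s < b → nats σ flagᵃ s ≡ 0) → (∀ s → b ≤ s → s < b + n → nats σ flagᵃ s ≡ 1) →
    Represents σ (LayoutTree.codeTree 1≤n layout (nats σ 1 0) N≡)
  layout-represents {r} {n} {b} 1≤n layout σ N≡ parents letters flags₀ flags₁ = record
    { word = word
    ; root = λ v e → ≡.trans (cong path e) path-root
    ; edge = λ v v≢0 → let 1≤v = ℕₚ.n≢0⇒n>0 v≢0
                           par<N = ℕₚ.<-≤-trans (ℕₚ.<-trans (par<self (toℕ v) 1≤v (bound v)) (bound v)) (ℕₚ.≤-reflexive (≡.sym N≡)) in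
        fromℕ< par<N , letter (toℕ v) , ≡.trans (parents _ 1≤v (bound v)) (≡.sym (Finₚ.toℕ-fromℕ< par<N)) , letters _ 1≤v (bound v) ,
        ≡.trans (path-edge (toℕ v) 1≤v (bound v)) (cong (λ s → path s ∷ʳ letter (toℕ v)) (≡.sym (Finₚ.toℕ-fromℕ< par<N)))
    ; node = ↭-refl
    ; terminal = λ v → mk⇔ (λ v∈ → flags₁ (toℕ v) (∈terminal (toℕ v) (bound v) v∈) (bound v))
                           (λ flag≡1 → terminal∈ (toℕ v) (ℕₚ.≮⇒≥ (λ v<b → 0≢1 (≡.trans (≡.sym (flags₀ (toℕ v) v<b)) flag≡1))) (bound v)) }
    where
    open Layout layout
    open LayoutTree 1≤n layout (nats σ 1 0) N≡
    0≢1 : 0 ≢ 1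
    0≢1 ()

  average-mono : ∀ {r n} (c : Fin r → Carrier) → 1 ≤ n → ∀ ws ws′ → ∑ᴸ (wordLength c) ws ≼ ∑ᴸ (wordLength c) ws′ → averageLength c n ws ≼ averageLength c n ws′
  average-mono {n = suc n} c _ ws ws′ le = ⊠-monoʳ _ (⁻¹-nonNeg (fromℕ-positive n)) le

  ∑ᴸ-tabulate : ∀ {b} {B : Set b} (f : B → Carrier) n (g : ℕ → Carrier) (h : Fin n → B) → (∀ i → f (h i) ≈ g (toℕ i)) → ∑ᴸ f (tabulate h) ≈ ∑ n g
  ∑ᴸ-tabulate f zero g h eq = ≈-refl
  ∑ᴸ-tabulate f (suc n) g h eq = ≈-trans (+-cong (eq zero) (∑ᴸ-tabulate f n (λ i → g (suc i)) (λ i → h (suc i)) (λ i → eq (suc i)))) (≈-sym (∑-shift n g))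

  -- Exchanging terms above the threshold D for terms below it does not increase a sum.
  ∑-threshold : ∀ (x : ℕ → Carrier) D p q → (∀ i → i < p → x i ≼ D) → (∀ i → p ≤ i → i < q → D ≼ x i) →
    ∑ p x ⊞ ∑ q (λ _ → D) ≼ ∑ q x ⊞ ∑ p (λ _ → D)
  ∑-threshold x D p q below above with ℕₚ.≤-total p q
  ... | inj₁ p≤q = subst (λ k → ∑ p x ⊞ ∑ k (λ _ → D) ≼ ∑ k x ⊞ ∑ p (λ _ → D)) (ℕₚ.m+[n∸m]≡n p≤q)
        (≼-linear (∑-mono d (λ i i<d → above (p + i) (ℕₚ.m≤m+n p i) (ℕₚ.<-≤-trans (ℕₚ.+-monoʳ-< p i<d) (ℕₚ.≤-reflexive (ℕₚ.m+[n∸m]≡n p≤q)))))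
          (≈-trans (+-congʳ (+-congˡ (∑-const-+ p d D))) (≈-trans (solve 4 (λ X P Q Y → X :+ (P :+ Q) :+ Y ⊜ X :+ Y :+ P :+ Q) ≈-refl _ _ _ _) (+-congʳ (+-congʳ (≈-sym (∑-++ p d x)))))))
    where d = q ∸ p
  ... | inj₂ q≤p = subst (λ k → ∑ k x ⊞ ∑ q (λ _ → D) ≼ ∑ q x ⊞ ∑ k (λ _ → D)) (ℕₚ.m+[n∸m]≡n q≤p)
        (≼-linear (∑-mono d (λ i i<d → below (q + i) (ℕₚ.<-≤-trans (ℕₚ.+-monoʳ-< q i<d) (ℕₚ.≤-reflexive (ℕₚ.m+[n∸m]≡n q≤p)))))
          (≈-trans (+-congʳ (+-congʳ (∑-++ q d x))) (≈-trans (solve 4 (λ X Y P Q → X :+ Y :+ P :+ Q ⊜ X :+ (P :+ Q) :+ Y) ≈-refl _ _ _ _) (+-congʳ (+-congˡ (≈-sym (∑-const-+ q d D)))))))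
    where d = p ∸ q

-- The complete algorithm.

solveLarge : Program
solveLarge = storeᴺ letterᵃ (lit 0) (var Rᵛ)
  ⨾ storeᴸ depthᵃ (lit 0) (nat (lit 0))
  ⨾ tᵛ ≔ lit 1 ⨾ Lᵛ ≔ load 0 (lit 0) ⨾ Nᵛ ≔ load 0 (lit 0) ⨾ enumerate
  ⨾ search
  -- The first b nodes of the first enumeration are kept. From here on only they may have children,
  -- and the n nodes that follow are the leaves.
  ⨾ tᵛ ≔ var bestᵛ ⨾ Lᵛ ≔ var bestᵛ ⨾ Nᵛ ≔ var bestᵛ ⊕ load 0 (lit 0) ⨾ enumerate
  ⨾ storeᴺ 1 (lit 0) (var Nᵛ)

-- For a single codeword the root alone is the tree. Otherwise min (r, n) is at least 2, so that the
-- second child, on which the stopping rule rests, exists.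
optimalTree : Program
optimalTree = if load 0 (lit 0) ≤ᴺ lit 1
  then (storeᴺ 1 (lit 0) (lit 1) ⨾ storeᴺ flagᵃ (lit 0) (lit 1))
  else ((if load 0 (lit 0) ≤ᴺ load 0 (lit 1) then Rᵛ ≔ load 0 (lit 0) else Rᵛ ≔ load 0 (lit 1)) ⨾ solveLarge)

private
  collect-solve : ∀ N → N * 19 + (N * 500 + (N * 4000 + (N * 15 + (N * 500 + N * 4)))) ≡ N * 5038
  collect-solve = solve-∀

module Large {a ℓ₁ ℓ₂} (F : OrderedField a ℓ₁ ℓ₂) {r : ℕ} (R : ℕ) (R≤r : R ≤ r) (0<r : 0 < r)
  (c : Fin r → OrderedField.Carrier F) (ĉ : ℕ → OrderedField.Carrier F) (ĉ-toℕ : ∀ i → ĉ (toℕ i) ≡ c i)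
  (ĉ-nonNeg : ∀ {j} → j < r → OrderedField._≤_ F (OrderedField.0# F) (ĉ j))
  (ĉ-sorted : ∀ {i j} → i ≤ j → j < r → OrderedField._≤_ F (ĉ i) (ĉ j))
  (n′ u : ℕ) (2≤R : 2 ≤ R) (1≤u : 1 ≤ u) (R≤2^1+u : R ≤ 2 ^ suc u) (R-min : R ≡ r ⊎ R ≡ suc n′) (n-large : 2 ≤ suc n′) (R≤n : R ≤ suc n′) where
  open OrderedFieldLemmas F
  open Sums F
  open Decomposition F c ĉ ĉ-toℕ
  open Enumeration F R R≤r 0<r c ĉ ĉ-toℕ ĉ-nonNeg ĉ-sorted
  open Execution F
  open Rules u 1≤u
  open Frames F
  open Search F R R≤r 0<r c ĉ ĉ-toℕ ĉ-nonNeg ĉ-sorted n′ u 2≤R 1≤u R≤2^1+u R-min n-large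
  open Enumerate F R R≤r 0<r c ĉ ĉ-toℕ ĉ-nonNeg ĉ-sorted n u 1≤R 1≤u R≤2^1+u
  open TreeOutput F

  -- The enumeration takes n + b - 1 shallowest children of the first `b` nodes, and `q*` counts
  -- equally many children of the same nodes. Exchanging them letter by letter, with the last depth
  -- taken as threshold, shows that the former are no dearer; subtracting the depths of the first
  -- `b` nodes leaves the leaves.
  terminals-cost : ∀ {b ℓ E E₀ x} (q* : ℕ → ℕ) → Good b (b + n) ℓ E → (∀ i → i < b → E i ≡ E₀ i) →
    (∀ j → j < R → q* j ≤ b) → sumℕ R q* ≡ n′ + b → x ⊞ ∑ b E₀ ≈ ∑ R (λ j → ∑ (q* j) (λ i → E₀ i ⊞ ĉ j)) →
    ∑ n (λ i → E (b + i)) ≼ x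
  terminals-cost {b} {ℓ} {E} {E₀} {x} q* good₀ E≡ q*≤b q*-sum value = ≼-linear popped-min
      (≈-trans (+-congˡ selected-sum) (≈-trans (solve 3 (λ X x B → X :+ (x :+ B) ⊜ x :+ (B :+ X)) ≈-refl _ x _) (+-congˡ (≈-sym popped-sum))))
    where
    s = b + n′
    good : Good b (suc s) ℓ E
    good = subst (λ t → Good b t ℓ E) (ℕₚ.+-suc b n′) good₀
    open Good good
    open GoodLemmas good
    child-depth : ℕ → ℕ → Carrier
    child-depth j i = E i ⊞ ĉ j
    p : ℕ → ℕ
    p j = count ℓ j (suc s)
    D = E s
    1≤s : 1 ≤ s
    1≤s = ℕₚ.≤-trans (ℕₚ.≤-pred n-large) (ℕₚ.m≤n+m n′ b)
    selected-sum : ∑ R (λ j → ∑ (q* j) (child-depth j)) ≈ x ⊞ ∑ b E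
    selected-sum = ≈-trans (∑-cong R (λ j j<R → ∑-cong (q* j) (λ i i<q → +-congʳ (≈-reflexive (E≡ i (ℕₚ.<-≤-trans i<q (q*≤b j j<R)))))))
      (≈-trans (≈-sym value) (+-congˡ (∑-cong b (λ i i<b → ≈-reflexive (≡.sym (E≡ i i<b))))))
    popped-sum : ∑ R (λ j → ∑ (p j) (child-depth j)) ≈ ∑ b E ⊞ ∑ n (λ i → E (b + i))
    popped-sum = ≈-trans (E-sum s ℕₚ.≤-refl) (≈-trans (≈-sym (≈-trans (+-congʳ (≈-reflexive E-root)) (+-identityˡ _)))
      (≈-trans (≈-sym (∑-shift s E)) (≈-trans (≈-reflexive (cong (λ k → ∑ k E) (≡.sym (ℕₚ.+-suc b n′)))) (∑-++ b n E))))
    per-letter : ∀ j → j < R → ∑ (p j) (child-depth j) ⊞ ∑ (q* j) (λ _ → D) ≼ ∑ (q* j) (child-depth j) ⊞ ∑ (p j) (λ _ → D)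
    per-letter j j<R = ∑-threshold (child-depth j) D (p j) (q* j) (λ i i<p → popped ℕₚ.≤-refl i<p j<R) (λ i p≤i i<q →
      let cnt≤i = ℕₚ.≤-trans (count-suc ℓ j s) p≤i
          i<b = ℕₚ.<-≤-trans i<q (q*≤b j j<R) in
      ≼-trans (least s 1≤s ℕₚ.≤-refl j j<R (ℕₚ.≤-<-trans cnt≤i i<b)) (⊞-monoˡ (ĉ j) (E-mono cnt≤i (ℕₚ.<-≤-trans i<b (ℕₚ.m≤n⇒m≤1+n (ℕₚ.m≤m+n b n′))))))
    same-size : ∑ R (λ j → ∑ (q* j) (λ _ → D)) ≈ ∑ R (λ j → ∑ (p j) (λ _ → D))
    same-size = ≈-trans (∑-const-sumℕ R q* D) (≈-trans (≈-reflexive (cong (λ k → ∑ k (λ _ → D)) (≡.trans q*-sum (≡.trans (ℕₚ.+-comm n′ b) (≡.sym (count-sum s ℕₚ.≤-refl))))))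
      (≈-sym (∑-const-sumℕ R p D)))
    popped-min : ∑ R (λ j → ∑ (p j) (child-depth j)) ≼ ∑ R (λ j → ∑ (q* j) (child-depth j))
    popped-min = ≼-linear (≼-respˡ (∑-⊞ R _ _) (≼-respʳ (∑-⊞ R _ _) (∑-mono R per-letter)))
      (≈-trans (solve 3 (λ P Q C → P :+ (Q :+ C) ⊜ Q :+ (P :+ C)) ≈-refl _ _ _) (+-congˡ (+-congˡ (≈-sym same-size))))

  good-layout : ∀ {b ℓ E} → Good b (b + n) ℓ E → Layout r n b
  good-layout {b} {ℓ} {E} good = record
    { path = path ; par = λ s → count ℓ (ℓ s) s ; letter = λ s → toLetter (ℓ s) ; path-root = refl
    ; path-edge = path-child ; par<self = parent<self ; par<b = row<L ; injective = path-injective }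
    where
    open Good good
    open GoodLemmas good

  Solved : Store → Set ℓ₂
  Solved τ = Σ[ tree ∈ CodeTree r n ] Represents τ tree × (∀ ws → IsPrefixCode n ws → ∑ᴸ depth (CodeTree.codewords tree) ≼ ∑ᴸ depth ws)

  good-start : ∀ {ℓ E} → ℓ 0 ≡ R → E 0 ≡ 0# → Good n 1 ℓ E
  good-start ℓ0 E0 = record
    { letter-root = ℓ0 ; E-root = E0 ; letter<R = λ s 1≤s s<1 → absurd 1≤s s<1 ; row<L = λ s 1≤s s<1 → absurd 1≤s s<1
    ; E-child = λ s 1≤s s<1 → absurd 1≤s s<1 ; least = λ s 1≤s s<1 → absurd 1≤s s<1 }
    where
    absurd : ∀ {s p} {P : Set p} → 1 ≤ s → s < 1 → P
    absurd 1≤s s<1 = ⊥-elim (ℕₚ.<⇒≱ s<1 1≤s)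

  solveLarge-exec : ∀ σ → Env σ → nats σ flagᵃ 0 ≡ 0 → Exec u solveLarge σ (n * u * 5200) Solved
  solveLarge-exec σ env flag₀ = weaken cost (sequence (assignᴺ (sequence (assignᴸ (sequence (assignᴺ (sequence (assignᴺ (sequence (assignᴺ
      (sequence (consequence after-first (enumerate-exec σ₁ env₁ 1 n n ℕₚ.≤-refl (n≡ env) (n≡ env) n≤ n (s≤s z≤n) R≤n (s≤s z≤n) (ℕₚ.m∸n≤m n 1) refl
        (good-start (R≡ env) refl))))))))))))))
    where
    σ₁ = store (update (update (update (update (nats σ) letterᵃ 0 (nats σ Rᵛ 0)) tᵛ 0 1) Lᵛ 0 (nats σ 0 0)) Nᵛ 0 (nats σ 0 0)) (update (lens σ) depthᵃ 0 0#)
    env₁ : Env σ₁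
    env₁ = record { n≡ = n≡ env ; R≡ = R≡ env ; c≡ = c≡ env }
    n≤ : n ≤ suc (R * n)
    n≤ = ℕₚ.m≤n⇒m≤1+n (ℕₚ.≤-trans (ℕₚ.≤-reflexive (≡.sym (ℕₚ.*-identityˡ n))) (ℕₚ.*-monoˡ-≤ n 1≤R))
    after-first : ∀ {τ₁} → Enumerated σ₁ env₁ 1 n n ℕₚ.≤-refl (n≡ env) (n≡ env) n≤ n τ₁ → Exec u _ τ₁ (n * u * 4000 + (4 + (4 + (7 + (n * 500 + 4))))) Solved
    after-first {τ₁} first = sequence (consequence after-search (search-exec τ₁ A.env A.good R≤n))
      where
      module A = Enumerated first
      after-search : ∀ {τ₂} → Found τ₁ A.env A.good τ₂ → Exec u _ τ₂ (4 + (4 + (7 + (n * 500 + 4)))) Solved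
      after-search {τ₂} found = sequence (assignᴺ (sequence (assignᴺ (sequence (assignᴺ (sequence (consequence after-second
          (enumerate-exec σ₃ env₃ b b (b + n) 1≤b refl (cong (b +_) (n≡ env₂)) N≤ n (ℕₚ.m≤m+n b n) R≤n (ℕₚ.<⇒≤ S.b<n)
            (ℕₚ.≤-reflexive (ℕₚ.m+n∸m≡n b n)) refl good₃))))))))
        where
        open Found found
        module S = Solution solution
        b = nats τ₂ bestᵛ 0
        env₂ : Env τ₂
        env₂ = frame-env _ _ _ frame A.env
        σ₃ = store (update (update (update (nats τ₂) tᵛ 0 b) Lᵛ 0 b) Nᵛ 0 (b + nats τ₂ 0 0)) (lens τ₂)
        env₃ : Env σ₃
        env₃ = record { n≡ = n≡ env₂ ; R≡ = R≡ env₂ ; c≡ = c≡ env₂ }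
        N≤ : b + n ≤ suc (R * b)
        -- The recorded selection itself shows that the first `b` nodes have enough children along
        -- the `R` letters.
        N≤ = ℕₚ.≤-trans (ℕₚ.≤-reflexive (≡.trans (ℕₚ.+-suc b n′) (cong suc (≡.trans (ℕₚ.+-comm b n′) (≡.sym S.q*-sum)))))
          (s≤s (ℕₚ.≤-trans (sumℕ-mono R S.q*≤b) (ℕₚ.≤-reflexive (sumℕ-const R b))))
        good₃ : Good b b (nats σ₃ letterᵃ) (lens σ₃ depthᵃ)
        good₃ = good-cong 1≤b (good-restrict (ℕₚ.<⇒≤ S.b<n) A.good) (λ s _ → same-nats frame letterᵃ s _) (λ s _ → same-lens frame depthᵃ s _)
        after-second : ∀ {τ₄} → Enumerated σ₃ env₃ b b (b + n) 1≤b refl (cong (b +_) (n≡ env₂)) N≤ (b + n) τ₄ → Exec u (storeᴺ 1 (lit 0) (var Nᵛ)) τ₄ 4 Solved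
        after-second {τ₄} second = assignᴺ (codeTree , layout-represents (s≤s z≤n) layout _ N≡ parents letters flags₀ flags₁ , λ ws code →
            ≼-respˡ (≈-sym terminals-sum) (≼-trans (terminals-cost S.q* B.good depth≡ S.q*≤b S.q*-sum S.value) (optimal ws code)))
          where
          module B = Enumerated second
          open GoodLemmas B.good
          ℓ = nats τ₄ letterᵃ
          layout = good-layout B.good
          N≡ : nats τ₄ Nᵛ 0 ≡ b + n
          N≡ = ≡.trans (same-nats B.frame Nᵛ 0 _) (cong (b +_) (n≡ env₂))
          open LayoutTree (s≤s z≤n) layout (nats τ₄ Nᵛ 0) N≡
          depth≡ : ∀ s → s < b → lens τ₄ depthᵃ s ≡ lens τ₁ depthᵃ s
          depth≡ s s<b = ≡.trans (B.old-depth s s<b) (same-lens frame depthᵃ s _)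
          letter≡ : ∀ s → s < b → ℓ s ≡ nats τ₁ letterᵃ s
          letter≡ s s<b = ≡.trans (B.old-letter s s<b) (same-nats frame letterᵃ s _)
          s<n : ∀ {s} → s < b → s < n
          s<n s<b = ℕₚ.<-trans s<b S.b<n
          parents : ∀ s → 1 ≤ s → s < b + n → nats τ₄ parentᵃ s ≡ count ℓ (ℓ s) s
          parents s 1≤s s< = by-side (s ℕₚ.<? b)
            where
            by-side : Dec (s < b) → nats τ₄ parentᵃ s ≡ count ℓ (ℓ s) s
            -- The parent of an old node depends only on letters up to that node, which the second
            -- enumeration leaves alone.
            by-side (yes s<b) = ≡.trans (B.old-parent s s<b) (≡.trans (same-nats frame parentᵃ s _) (≡.trans (A.new-parent s 1≤s (s<n s<b))
                (≡.sym (≡.trans (cong (λ j → count ℓ j s) (letter≡ s s<b)) (count-cong _ s (λ s′ s′<s → letter≡ s′ (ℕₚ.<-trans s′<s s<b)))))))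
            by-side (no s≮b) = B.new-parent s (ℕₚ.≮⇒≥ s≮b) s<
          letters : ∀ s → 1 ≤ s → s < b + n → ℓ s ≡ toℕ (toLetter (ℓ s))
          letters s 1≤s s< = ≡.sym (toℕ-toLetter (Good.letter<R B.good s 1≤s s<))
          flags₀ : ∀ s → s < b → nats τ₄ flagᵃ s ≡ 0
          flags₀ s s<b = ≡.trans (B.old-flag s s<b) (≡.trans (same-nats frame flagᵃ s _) (inner s s<b))
            where
            inner : ∀ s → s < b → nats τ₁ flagᵃ s ≡ 0
            -- The flag of the root is not written by the enumeration and keeps its initial value 0.
            inner zero _ = ≡.trans (A.old-flag 0 ℕₚ.≤-refl) flag₀
            inner (suc s) s<b = ≡.trans (A.new-flag (suc s) (s≤s z≤n) (s<n s<b)) (ℕₚ.m≤n⇒m∸n≡0 (ℕₚ.m<n⇒0<n∸m (s<n s<b)))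
          flags₁ : ∀ s → b ≤ s → s < b + n → nats τ₄ flagᵃ s ≡ 1
          flags₁ s b≤s s< = ≡.trans (B.new-flag s b≤s s<) (cong (1 ∸_) (ℕₚ.m≤n⇒m∸n≡0 b≤s))
          terminals-sum : ∑ᴸ depth (tabulate terminal) ≈ ∑ n (λ i → lens τ₄ depthᵃ (b + i))
          terminals-sum = ∑ᴸ-tabulate depth n (λ i → lens τ₄ depthᵃ (b + i)) terminal (λ i → depth-path (b + toℕ i) (terminal-bound i))
    cost : 4 + (4 + (3 + (4 + (4 + (n * 500 + (n * u * 4000 + (4 + (4 + (7 + (n * 500 + 4)))))))))) ≤ n * u * 5200
    cost = begin
      19 + (n * 500 + (n * u * 4000 + (15 + (n * 500 + 4)))) ≤⟨ ℕₚ.+-mono-≤ (grow₁ 19) (ℕₚ.+-mono-≤ (grow 500)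
        (ℕₚ.+-monoʳ-≤ (n * u * 4000) (ℕₚ.+-mono-≤ (grow₁ 15) (ℕₚ.+-mono-≤ (grow 500) (grow₁ 4))))) ⟩
      N * 19 + (N * 500 + (N * 4000 + (N * 15 + (N * 500 + N * 4)))) ≡⟨ collect-solve N ⟩
      N * 5038 ≤⟨ ℕₚ.*-monoʳ-≤ N (ℕₚ.≤ᵇ⇒≤ 5038 5200 _) ⟩
      N * 5200 ∎
      where
      open ℕₚ.≤-Reasoning
      N = n * u
      n≤N : n ≤ N
      n≤N = ℕₚ.≤-trans (ℕₚ.≤-reflexive (≡.sym (ℕₚ.*-identityʳ n))) (ℕₚ.*-monoʳ-≤ n 1≤u)
      grow : ∀ z → n * z ≤ N * z
      grow z = ℕₚ.*-monoˡ-≤ z n≤N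
      grow₁ : ∀ z → z ≤ N * z
      grow₁ z = ℕₚ.≤-trans (ℕₚ.≤-reflexive (≡.sym (ℕₚ.*-identityˡ z))) (ℕₚ.*-monoˡ-≤ z (ℕₚ.≤-trans (s≤s z≤n) n≤N))

log-positive : ∀ {r} → 2 ≤ r → 1 ≤ ⌊log₂ r ⌋
log-positive 2≤r = ⌊log₂⌋-mono-≤ 2≤r

<2^1+log : ∀ r → r < 2 ^ suc ⌊log₂ r ⌋
<2^1+log r = ℕₚ.≰⇒> (λ le → ℕₚ.<-irrefl refl (ℕₚ.≤-trans (ℕₚ.≤-reflexive (≡.sym (⌊log₂[2^n]⌋≡n (suc ⌊log₂ r ⌋)))) (⌊log₂⌋-mono-≤ le)))

private
  square : ∀ n u → n * u * 6000 * u ≡ 6000 * (n * (u * (u * 1)))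
  square = solve-∀

module Theorem {a ℓ₁ ℓ₂} (F : OrderedField a ℓ₁ ℓ₂) (r : ℕ) (c : Fin r → OrderedField.Carrier F) (2≤r : 2 ≤ r)
  (nonNeg : Cost.NonNegative F c) (sorted : Cost.Sorted F c) where
  open OrderedFieldLemmas F
  open Sums F
  open Cost F using (wordLength)
  open Execution F
  open TreeOutput F

  u : ℕ
  u = ⌊log₂ r ⌋

  1≤u : 1 ≤ u
  1≤u = log-positive 2≤r

  open Rules u 1≤u

  -- The extension of `c` to all indices is the input array itself, so that it agrees with what the
  -- program loads by definition.
  lengthAt : ℕ → ℕ → Carrier
  lengthAt n j = lens (input n c) lengthᵃ j

  lengthAt-< : ∀ n j (j<r : j < r) → lengthAt n j ≡ c (fromℕ< j<r)
  lengthAt-< n j j<r with j ℕₚ.<? r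
  ... | yes _ = cong c (Finₚ.fromℕ<-cong j j refl _ _)
  ... | no j≮r = ⊥-elim (j≮r j<r)

  lengthAt-toℕ : ∀ n i → lengthAt n (toℕ i) ≡ c i
  lengthAt-toℕ n i = ≡.trans (lengthAt-< n (toℕ i) (Finₚ.toℕ<n i)) (cong c (Finₚ.fromℕ<-toℕ i _))

  lengthAt-nonNeg : ∀ n {j} → j < r → 0# ≼ lengthAt n j
  lengthAt-nonNeg n {j} j<r = subst (0# ≼_) (≡.sym (lengthAt-< n j j<r)) (nonNeg _)

  lengthAt-sorted : ∀ n {i j} → i ≤ j → j < r → lengthAt n i ≼ lengthAt n j
  lengthAt-sorted n {i} {j} i≤j j<r = ≡.subst₂ _≼_ (≡.sym (lengthAt-< n i i<r)) (≡.sym (lengthAt-< n j j<r))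
    (sorted (≡.subst₂ _≤_ (≡.sym (Finₚ.toℕ-fromℕ< i<r)) (≡.sym (Finₚ.toℕ-fromℕ< j<r)) i≤j))
    where i<r = ℕₚ.≤-<-trans i≤j j<r

  wordLength-nonNeg : ∀ w → 0# ≼ wordLength c w
  wordLength-nonNeg [] = ≼-refl
  wordLength-nonNeg (x ∷ w) = ≼-respˡ (+-identityʳ 0#) (⊞-mono (nonNeg x) (wordLength-nonNeg w))

  total-nonNeg : ∀ ws → 0# ≼ ∑ᴸ (wordLength c) ws
  total-nonNeg [] = ≼-refl
  total-nonNeg (w ∷ ws) = ≼-respˡ (+-identityʳ 0#) (⊞-mono (wordLength-nonNeg w) (total-nonNeg ws))

  Solves : ℕ → Store → Set ℓ₂
  Solves n τ = Σ[ tree ∈ CodeTree r n ] Represents τ tree × (∀ ws → IsPrefixCode n ws → ∑ᴸ (wordLength c) (CodeTree.codewords tree) ≼ ∑ᴸ (wordLength c) ws)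

  single-layout : Layout r 1 0
  single-layout = record
    { path = λ _ → [] ; par = λ _ → 0 ; letter = λ _ → fromℕ< (ℕₚ.<⇒≤ 2≤r) ; path-root = refl
    ; path-edge = λ s 1≤s s<1 → ⊥-elim (ℕₚ.<⇒≱ s<1 1≤s) ; par<self = λ s 1≤s _ → 1≤s ; par<b = λ s 1≤s s<1 → ⊥-elim (ℕₚ.<⇒≱ s<1 1≤s)
    ; injective = λ s s′ s<1 s′<1 _ → ≡.trans (ℕₚ.n<1⇒n≡0 s<1) (≡.sym (ℕₚ.n<1⇒n≡0 s′<1)) }

  large-exec : ∀ n′ → 2 ≤ suc n′ → ∀ R → R ≤ r → R ≤ suc n′ → 2 ≤ R → R ≡ r ⊎ R ≡ suc n′ → ∀ σ →
    nats σ 0 0 ≡ suc n′ → nats σ Rᵛ 0 ≡ R → (∀ j → lens σ lengthᵃ j ≡ lengthAt (suc n′) j) → nats σ flagᵃ 0 ≡ 0 →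
    Exec u solveLarge σ (suc n′ * u * 5200) (Solves (suc n′))
  large-exec n′ n-large R R≤r R≤n 2≤R R-min σ n≡ R≡ c≡ flag₀ =
    Large.solveLarge-exec F R R≤r (ℕₚ.<⇒≤ 2≤r) c (lengthAt (suc n′)) (lengthAt-toℕ (suc n′)) (lengthAt-nonNeg (suc n′)) (lengthAt-sorted (suc n′))
      n′ u 2≤R 1≤u (ℕₚ.≤-trans R≤r (ℕₚ.<⇒≤ (<2^1+log r))) R-min n-large R≤n σ (record { n≡ = n≡ ; R≡ = R≡ ; c≡ = c≡ }) flag₀

  optimalTree-exec : ∀ n → 1 ≤ n → Exec u optimalTree (input n c) (n * u * 6000) (Solves n)
  optimalTree-exec (suc n′) _ = weaken cost (branch {l = 18 + suc n′ * u * 5200} small large)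
    where
    n = suc n′
    small : Holds (load 0 (lit 0) ≤ᴺ lit 1) (input n c) → Exec u _ (input n c) 6 (Solves n)
    small (Level.lift (s≤s z≤n)) = sequence (assignᴺ (assignᴺ
      ( LayoutTree.codeTree (s≤s z≤n) single-layout 1 refl
      , layout-represents (s≤s z≤n) single-layout _ refl (λ s 1≤s s<1 → ⊥-elim (ℕₚ.<⇒≱ s<1 1≤s)) (λ s 1≤s s<1 → ⊥-elim (ℕₚ.<⇒≱ s<1 1≤s)) (λ _ ())
          (λ { zero _ _ → refl ; (suc s) _ (s≤s ()) })
      , λ ws _ → ≼-respˡ (≈-sym (+-identityʳ 0#)) (total-nonNeg ws) )))
    large : ¬ Holds (load 0 (lit 0) ≤ᴺ lit 1) (input n c) → Exec u _ (input n c) (18 + n * u * 5200) (Solves n)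
    large ≰1 = sequence {k = 18} (weaken (ℕₚ.≤ᵇ⇒≤ _ _ _) (branch
      (λ (Level.lift n≤r) → assignᴺ (large-exec n′ n-large n n≤r ℕₚ.≤-refl n-large (inj₂ refl) _ refl refl (λ _ → refl) refl))
      (λ n≰r → assignᴺ (large-exec n′ n-large r ℕₚ.≤-refl (ℕₚ.≰⇒≥ (λ le → n≰r (Level.lift le))) 2≤r (inj₁ refl) _ refl refl (λ _ → refl) refl))))
      where
      n-large : 2 ≤ n
      n-large = ℕₚ.≰⇒> (λ le → ≰1 (Level.lift le))
    cost : 4 + (6 ⊔ (18 + n * u * 5200)) ≤ n * u * 6000
    cost = begin
      4 + (6 ⊔ (18 + N * 5200)) ≤⟨ ℕₚ.+-monoʳ-≤ 4 (ℕₚ.⊔-lub {x = 18 + N * 5200} {6} {18 + N * 5200} (ℕₚ.≤-trans (ℕₚ.≤ᵇ⇒≤ 6 18 _) (ℕₚ.m≤m+n 18 _)) ℕₚ.≤-refl) ⟩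
      22 + N * 5200 ≤⟨ ℕₚ.+-monoˡ-≤ (N * 5200) (ℕₚ.≤-trans (ℕₚ.≤-reflexive (≡.sym (ℕₚ.*-identityˡ 22))) (ℕₚ.*-monoˡ-≤ 22 (ℕₚ.*-mono-≤ {1} {n} (s≤s z≤n) 1≤u))) ⟩
      N * 22 + N * 5200 ≡⟨ ≡.sym (ℕₚ.*-distribˡ-+ N 22 5200) ⟩
      N * 5222 ≤⟨ ℕₚ.*-monoʳ-≤ N (ℕₚ.≤ᵇ⇒≤ 5222 6000 _) ⟩
      N * 6000 ∎
      where
      open ℕₚ.≤-Reasoning
      N = n * u

mainTheorem1 : ∀ {a ℓ₁ ℓ₂} → Σ[ P ∈ Program ] Σ[ K ∈ ℕ ]
    ((F : OrderedField a ℓ₁ ℓ₂) (n r : ℕ) (c : Fin r → OrderedField.Carrier F) →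
    1 ≤ n → 2 ≤ r → Cost.NonNegative F c → Cost.Sorted F c →
    ∃[ t ] ∃[ σ ] Machine.Run F P (Machine.input F n c) t σ
    × t ≤ K * (n * ⌊log₂ r ⌋ ^ 2)
    × (Σ[ T ∈ CodeTree r n ] Machine.Represents F σ T
    × Cost.IsOptimalPrefixCode F c n (CodeTree.codewords T)))
-- The bound is 6000 n u units of u operations each, which is where the square of the logarithm
-- arises.
mainTheorem1 = optimalTree , 6000 , λ F n r c 1≤n 2≤r nonNeg sorted →
  let open Theorem F r c 2≤r nonNeg sorted using (u; optimalTree-exec)
      open Execution F using (module Exec)
      open Exec (optimalTree-exec n 1≤n)
      (tree , represents , optimal) = post
  in time , final , run , ℕₚ.≤-trans bound (ℕₚ.≤-reflexive (square n u)) , tree , represents , record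
    { isPrefixCode = codewords-isPrefixCode tree
    ; minimal = λ ws code → TreeOutput.average-mono F c 1≤n (CodeTree.codewords tree) ws (optimal ws code) }
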